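{- For every closed interval $[a,b]\subset[0,1]$, as $X\to\infty$, $$\#\Omega_{[a,b]}(X)=\frac{(b-a)}{4}X^4+O(X^3),$$ and in particular $$\lim_{X\to\infty}\frac{\#\Omega_{[a,b]}(X)}{\#\Omega(X)}=b-a.$$
   Context: For positive integers $p,q$ (not necessarily coprime) let $T_{p,q}$ be the $(p,q)$-torus link, $d=\gcd(p,q)$ (its number of components) and $L=\operatorname{lcm}(p,q)$. Its single-variable Alexander polynomial (for $d\ge 2$ obtained from the multivariable Alexander polynomial $\Delta_{T_{p,q}}(X_1,\dots,X_d)$ as $(t-1)\Delta_{T_{p,q}}(t,\dots,t)$, and for $d=1$ the usual Alexander polynomial) is $$\Delta_{p,q}(t)=\frac{(t^{L}-1)^{d}(t-1)}{(t^{p}-1)(t^{q}-1)}.$$ All its roots are roots of unity. For $X>0$, $\mathcal{T}(X)$ is the set of all torus links $T_{p,q}$ with $1\le p,q\le X$, indexed by the ordered pairs $(p,q)$. $\Omega(X)$ is the multiset of pairs $(T_{p,q},\alpha)$ with $T_{p,q}\in\mathcal{T}(X)$ and $\alpha$ a root of $\Delta_{p,q}(t)$, counted with the multiplicity of $\alpha$ as a root. $\Omega_{[a,b]}(X)$ is the sub-multiset of those pairs for which $\alpha$ lies on the arc $\{e^{2\pi i\theta}:\theta\in[a,b]\}$. Cardinalities count multiplicity. $f(X)=g(X)+O(h(X))$ has its usual meaning: $|f(X)-g(X)|\le C\,h(X)$ for some constant $C$ and all sufficiently large $X$. -}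

module Defs where

open import Algebra.Bundles using (CommutativeRing)
open import Algebra.Bundles.Raw using (RawRing)
open import Algebra.Core using (Op₁)
import Algebra.Construct.NaturalChoice.Max as Max
import Algebra.Definitions.RawSemiring as RawSemiringDefs
open import Axiom.ExcludedMiddle using (ExcludedMiddle)
open import Data.List.Base using (List; []; _∷_; map; length)
import Data.List.Membership.Setoid as Membership
import Data.List.Relation.Unary.Unique.Setoid as Uniqueness
open import Data.Nat.Base as ℕ using (ℕ; zero; suc)
open import Data.Nat.GCD using (gcd)
open import Data.Nat.LCM using (lcm)
open import Data.Product.Base using (∃; _×_; _,_; proj₁; proj₂)
open import Data.Product.Relation.Binary.Pointwise.NonDependent using (_×ₛ_)
open import Function.Bundles using (_⇔_)
open import Level using (0ℓ) renaming (suc to lsuc)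
open import Relation.Binary.Bundles using (Setoid; TotalOrder)
open import Relation.Binary.Core using (Rel)
import Relation.Binary.PropositionalEquality as ≡
open import Relation.Binary.Structures using (IsTotalOrder)
open import Relation.Nullary using (¬_; Dec; yes; no)

-- The real numbers, up to isomorphism: a Dedekind-complete ordered field.
-- The inverse is a total operation, unconstrained at zero.

record RealField : Set (lsuc 0ℓ) where
  infix  4 _≤_
  infix  9 _⁻¹
  field
    commutativeRing : CommutativeRing 0ℓ 0ℓ

  open CommutativeRing commutativeRing public

  field
    _≤_          : Rel Carrier 0ℓ
    _⁻¹          : Op₁ Carrier
    isTotalOrder : IsTotalOrder _≈_ _≤_
    0≉1          : ¬ 0# ≈ 1#
    ⁻¹-cong      : ∀ {x y} → x ≈ y → x ⁻¹ ≈ y ⁻¹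
    *-inverseʳ   : ∀ x → ¬ x ≈ 0# → x * x ⁻¹ ≈ 1#
    +-monoˡ-≤    : ∀ {x y} z → x ≤ y → x + z ≤ y + z
    *-nonNeg     : ∀ {x y} → 0# ≤ x → 0# ≤ y → 0# ≤ x * y

  IsUpperBound : (Carrier → Set) → Carrier → Set
  IsUpperBound P u = ∀ x → P x → x ≤ u

  field
    supremum : ∀ (P : Carrier → Set) → ∃ P → ∃ (IsUpperBound P) →
               ∃ λ s → IsUpperBound P s × (∀ u → IsUpperBound P u → s ≤ u)

-- Polynomials as coefficient lists, constant term first; trailing zeros
-- are allowed, so equality is coefficientwise.

module Polynomial (K : RawRing 0ℓ 0ℓ) where

  open RawRing K

  Poly : Set
  Poly = List Carrier

  coeff : Poly → ℕ → Carrier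
  coeff []      _       = 0#
  coeff (a ∷ f) zero    = a
  coeff (a ∷ f) (suc k) = coeff f k

  _+ᴾ_ : Poly → Poly → Poly
  []      +ᴾ g       = g
  (a ∷ f) +ᴾ []      = a ∷ f
  (a ∷ f) +ᴾ (b ∷ g) = (a + b) ∷ (f +ᴾ g)

  _*ᴾ_ : Poly → Poly → Poly
  []      *ᴾ g = []
  (a ∷ f) *ᴾ g = map (a *_) g +ᴾ (0# ∷ (f *ᴾ g))

  polyRing : RawRing 0ℓ 0ℓ
  polyRing = record
    { Carrier = Poly
    ; _≈_     = λ f g → ∀ k → coeff f k ≈ coeff g k
    ; _+_     = _+ᴾ_
    ; _*_     = _*ᴾ_
    ; -_      = map -_
    ; 0#      = []
    ; 1#      = 1# ∷ []
    }

  const : Carrier → Poly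
  const a = a ∷ []

  t : Poly
  t = 0# ∷ 1# ∷ []

  _-ᴾ_ : Poly → Poly → Poly
  f -ᴾ g = f +ᴾ map -_ g

  open RawRing polyRing using () renaming (_≈_ to _≈ᴾ_) public
  open RawSemiringDefs (RawRing.rawSemiring polyRing)
    using () renaming (_^_ to _^ᴾ_; _∣_ to _∣ᴾ_) public

  infix  4 _HasMultiplicity_In_
  infixl 7 _*ᴾ_
  infixl 6 _+ᴾ_ _-ᴾ_

  _HasMultiplicity_In_ : Carrier → ℕ → Poly → Set
  α HasMultiplicity m In f =
    ((t -ᴾ const α) ^ᴾ m ∣ᴾ f) × ¬ ((t -ᴾ const α) ^ᴾ suc m ∣ᴾ f)

module Analysis (R : RealField) where

  open RealField R renaming (Carrier to ℝ)

  totalOrder : TotalOrder 0ℓ 0ℓ 0ℓ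
  totalOrder = record { isTotalOrder = isTotalOrder }

  open Max totalOrder using (_⊔_) public
  open RawSemiringDefs (RawRing.rawSemiring rawRing)
    using (_^_) renaming (_×_ to _·_) public

  infix  4 _<_
  infixl 7 _/_

  _<_ : Rel ℝ 0ℓ
  x < y = (x ≤ y) × ¬ (x ≈ y)

  ∣_∣ : ℝ → ℝ
  ∣ x ∣ = x ⊔ (- x)

  _/_ : ℝ → ℝ → ℝ
  x / y = x * y ⁻¹

  ι : ℕ → ℝ
  ι n = n · 1#

  infix 4 _≐_+O_ _⟶_

  _≐_+O_ : (f g h : ℝ → ℝ) → Set
  f ≐ g +O h = ∃ λ C → ∃ λ X₀ → ∀ X → X₀ ≤ X → ∣ f X - g X ∣ ≤ C * h X

  -- The limit as the argument tends to +∞.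
  _⟶_ : (ℝ → ℝ) → ℝ → Set
  f ⟶ l = ∀ ε → 0# < ε → ∃ λ X₀ → ∀ X → X₀ ≤ X → ∣ f X - l ∣ < ε

  ConvergesTo : (ℕ → ℝ) → ℝ → Set
  ConvergesTo s l = ∀ ε → 0# < ε → ∃ λ N → ∀ n → N ℕ.≤ n → ∣ s n - l ∣ < ε

  ℂ : Set
  ℂ = ℝ × ℝ

  ℂ-setoid : Setoid 0ℓ 0ℓ
  ℂ-setoid = setoid ×ₛ setoid

  ℂ-ring : RawRing 0ℓ 0ℓ
  ℂ-ring = record
    { Carrier = ℂ
    ; _≈_     = Setoid._≈_ ℂ-setoid
    ; _+_     = λ (x , y) (u , v) → (x + u) , (y + v)
    ; _*_     = λ (x , y) (u , v) → (x * u - y * v) , (x * v + y * u)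
    ; -_      = λ (x , y) → (- x) , (- y)
    ; 0#      = 0# , 0#
    ; 1#      = 1# , 0#
    }

  open RawRing ℂ-ring using ()
    renaming (_+_ to _+ᶜ_; _*_ to _*ᶜ_; 0# to 0ᶜ) public
  open RawSemiringDefs (RawRing.rawSemiring ℂ-ring)
    using () renaming (_^_ to _^ᶜ_) public

  expTerm : ℂ → ℕ → ℂ
  expTerm z k = ((ι (k ℕ.!)) ⁻¹ , 0#) *ᶜ z ^ᶜ k

  partialSum : (ℕ → ℂ) → ℕ → ℂ
  partialSum a zero    = 0ᶜ
  partialSum a (suc n) = partialSum a n +ᶜ a n

  -- IsExp z w : the exponential series at z converges to w, i.e. w = e^z.
  IsExp : ℂ → ℂ → Set
  IsExp z w = ConvergesTo (λ n → proj₁ (partialSum (expTerm z) n)) (proj₁ w)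
            × ConvergesTo (λ n → proj₂ (partialSum (expTerm z) n)) (proj₂ w)

  -- sin x = s, read off from e^(ix) = cos x + i sin x.
  IsSin : ℝ → ℝ → Set
  IsSin x s = ∃ λ c → IsExp (0# , x) (c , s)

  -- π is the least positive zero of the sine.
  IsPi : ℝ → Set
  IsPi x = (0# < x) × IsSin x 0#
         × (∀ y → 0# < y → y < x → ¬ IsSin y 0#)

module Cardinality (S : Setoid 0ℓ 0ℓ) where

  open Setoid S using (Carrier)
  open Membership S using (_∈_)
  open Uniqueness S using (Unique)

  HasCardinality : (Carrier → Set) → ℕ → Set
  HasCardinality P n =
    ∃ λ xs → Unique xs × (∀ x → P x ⇔ x ∈ xs) × length xs ≡.≡ n

  -- The cardinality of P, with the convention that it is 0 if P is infinite.
  cardinality : ExcludedMiddle 0ℓ → (Carrier → Set) → ℕ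
  cardinality em P = fromDec em
    where
    fromDec : Dec (∃ (HasCardinality P)) → ℕ
    fromDec (yes (n , _)) = n
    fromDec (no _)        = 0

module TorusLinks (em : ExcludedMiddle 0ℓ) (R : RealField)
                  (π : RealField.Carrier R) where

  open RealField R renaming (Carrier to ℝ)
  open Analysis R
  open Polynomial ℂ-ring

  _^-1 : ℕ → Poly
  n ^-1 = t ^ᴾ n -ᴾ const (1# , 0#)

  -- Δ is the exact quotient (t^L - 1)^d (t - 1) / ((t^p - 1)(t^q - 1)).
  IsAlexanderPolynomial : ℕ → ℕ → Poly → Set
  IsAlexanderPolynomial p q Δ =
    ((p ^-1) *ᴾ (q ^-1)) *ᴾ Δ ≈ᴾ ((lcm p q ^-1) ^ᴾ gcd p q) *ᴾ (1 ^-1)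

  -- α = e^(2πiθ) for some θ ∈ [a,b].
  OnArc : ℝ → ℝ → ℂ → Set
  OnArc a b α =
    ∃ λ θ → (a ≤ θ) × (θ ≤ b) × IsExp (0# , ι 2 * π * θ) α

  -- A multiset of pairs (T_{p,q} , α) is represented by the set of
  -- (p , q , α , j), where j < multiplicity labels the copies of the pair.
  Item : Setoid 0ℓ 0ℓ
  Item = ≡.setoid ℕ ×ₛ (≡.setoid ℕ ×ₛ (ℂ-setoid ×ₛ ≡.setoid ℕ))

  Ω : ℝ → Setoid.Carrier Item → Set
  Ω X (p , q , α , j) =
      ((1 ℕ.≤ p) × (ι p ≤ X))
    × ((1 ℕ.≤ q) × (ι q ≤ X))
    × ∃ λ Δ → IsAlexanderPolynomial p q Δ
    × ∃ λ m → (α HasMultiplicity m In Δ) × (j ℕ.< m)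

  Ω[_,_] : ℝ → ℝ → ℝ → Setoid.Carrier Item → Set
  Ω[ a , b ] X (p , q , α , j) = Ω X (p , q , α , j) × OnArc a b α

  open Cardinality Item

  #Ω : ℝ → ℕ
  #Ω X = cardinality em (Ω X)

  #Ω[_,_] : ℝ → ℝ → ℝ → ℕ
  #Ω[ a , b ] X = cardinality em (Ω[ a , b ] X)

{-# OPTIONS --safe #-}

-- The roots of Δ_{p,q} are L-th roots of unity, L = lcm(p,q), and each has
-- multiplicity d = gcd(p,q) up to the corrections [α = 1], [α^p = 1] and
-- [α^q = 1], whose totals over all α are at most 1, p and q.  An arc [a,b]
-- contains (b - a) L + O(1) of the L-th roots of unity, so T_{p,q} contributes
-- d ((b - a) L + O(1)) + O(p + q) = (b - a) p q + O(p + q) pairs, and summing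
-- over p, q ≤ X gives (b - a) X⁴ / 4 + O(X³).
--
-- Nothing about the sine beyond its definition is needed to see that
-- θ ↦ e^(2πiθ) is injective on [0,1): if e^(2πiθ) = 1 then e^(iπθ) = c + is
-- satisfies (c + is)² = 1, so s = 0, and πθ would be a zero of the sine
-- below π.  Polynomials are compared through their values, since a nonzero
-- polynomial has finitely many roots.

module Submission where

open import Defs
import Algebra.Construct.NaturalChoice.Max as Max
open import Algebra.Bundles using (CommutativeRing)
open import Algebra.Bundles.Raw using (RawRing)
import Algebra.Definitions.RawMagma as RawMagmaDefs
import Algebra.Definitions.RawSemiring as RawSemiringDefs
import Algebra.Properties.Group as GroupProperties
import Algebra.Properties.Ring as RingProperties
import Algebra.Properties.Semiring.Exp as SemiringExp
import Algebra.Properties.Semiring.Mult as SemiringMult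
import Algebra.Solver.Ring as RingSolver
open import Algebra.Solver.Ring.AlmostCommutativeRing
  using (fromCommutativeRing; _-Raw-AlmostCommutative⟶_)
open import Axiom.ExcludedMiddle using (ExcludedMiddle)
open import Data.Empty using (⊥-elim)
open import Data.List.Base
  using (List; []; _∷_; _++_; map; length; filter; replicate; applyDownFrom; downFrom)
open import Data.List.Membership.Propositional.Properties using (∈-downFrom⁺; ∈-downFrom⁻)
import Data.List.Membership.Setoid as Membership
import Data.List.Membership.Setoid.Properties as Membershipₚ
import Data.List.Properties as Listₚ
open import Data.List.Relation.Unary.All as All using (All; []; _∷_)
import Data.List.Relation.Unary.All.Properties as Allₚ
open import Data.List.Relation.Unary.AllPairs using ([]; _∷_)
open import Data.List.Relation.Unary.Any as Any using (Any; here; there)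
import Data.List.Relation.Unary.Any.Properties as Anyₚ
import Data.List.Relation.Unary.Unique.Propositional.Properties as Unique≡
import Data.List.Relation.Unary.Unique.Setoid as Uniqueness
import Data.List.Relation.Unary.Unique.Setoid.Properties as Uniqueₚ
open import Data.Maybe.Base using (Maybe; just; nothing)
open import Data.Nat.Base as ℕ using (ℕ; zero; suc; s≤s; z≤n; _!)
open import Data.Nat.Divisibility using (_∣_; divides; ∣⇒≤)
open import Data.Nat.GCD using (gcd; gcd-GCD; gcd[m,n]≢0; gcd[m,n]∣m; module Bézout)
open import Data.Nat.LCM using (lcm; gcd*lcm; m∣lcm[m,n]; n∣lcm[m,n])
open import Data.Nat.ListAction using (sum)
import Data.Nat.Properties as ℕₚ
open import Algebra.Properties.CommutativeSemigroup ℕₚ.+-commutativeSemigroup using (interchange)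
open import Algebra.Properties.CommutativeSemigroup ℕₚ.*-commutativeSemigroup using (x∙yz≈y∙xz)
open import Data.Product.Base using (∃; _×_; _,_; proj₁; proj₂)
open import Data.Product.Relation.Binary.Pointwise.NonDependent using (_×ₛ_)
open import Data.Sum.Base using (_⊎_; inj₁; inj₂; [_,_]′)
open import Function.Base using (_∘_; case_of_)
open import Function.Bundles using (_⇔_; mk⇔; Equivalence)
open import Level using (0ℓ)
open import Relation.Binary.Bundles using (Poset; Setoid)
import Relation.Binary.Construct.NonStrictToStrict as NonStrictToStrict
import Relation.Binary.PropositionalEquality as ≡
import Relation.Binary.Reasoning.PartialOrder as ≤-Reasoning
import Relation.Binary.Reasoning.Setoid as SetoidReasoning
open import Relation.Binary.Structures using (IsTotalOrder)
open import Relation.Nullary using (¬_; yes; no)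
open import Relation.Nullary.Decidable using (decidable-stable)

-- The data are bare: a complete ordered field, and π as the least positive zero of a power series.
-- So e^z, its addition law and e^(2πi) = 1 are derived from the series, every error being carried
-- as an explicit geometric bound. That the powers of e^(2πi/L) exhaust the L-th roots of unity
-- comes from a count: for k < L the values e^(2πik/L) are L distinct roots of t^L - 1, which has at
-- most L.
--
-- The arc is parametrised by a closed subinterval of [0,1], so the point 1 has the two parameters 0
-- and 1. It is the only root for which lying on the arc and having its angle k/L in [a,b] can
-- differ, and it costs one unit in the count.
--
-- In the definition of Ω the polynomial Δ is bound existentially, so without a proof that some Δ
-- exists there would be nothing to count. For d ≥ 2 two of the factors t^L - 1 absorb the
-- denominator; for d = 1 there is only one such factor, t - 1 has to supply the rest, and this is
-- where Bézout's identity enters.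

record IsDomainOfCharZero (K : CommutativeRing 0ℓ 0ℓ) : Set where
  open CommutativeRing K
  open RawSemiringDefs (RawRing.rawSemiring rawRing) using () renaming (_×_ to _·_)
  field
    integral : ∀ {x y} → ¬ x ≈ 0# → x * y ≈ 0# → y ≈ 0#
    -- Provides as many distinct points as a polynomial has coefficients, and keeps the derivative n
    -- α^(n-1) from vanishing at a root of unity, so that t^n - 1 has simple roots.
    charZero : ∀ n → ¬ suc n · 1# ≈ 0#

-- Identities in commutative rings by normalisation with integer coefficients.

module IntegerRingSolver (R : CommutativeRing 0ℓ 0ℓ) where

  open import Data.Integer.Base as ℤ using (ℤ; +_; -[1+_])
  import Data.Integer.Properties as ℤₚ

  open CommutativeRing R
  open RingProperties ring
  open RawSemiringDefs (RawRing.rawSemiring rawRing) using () renaming (_×_ to _·_)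
  open SemiringMult semiring using (×-homo-+; ×1-homo-*)
  open SetoidReasoning setoid

  -- The clause for 1 makes the solver constant `con (+ 1)` denote 1# itself rather than 1# + 0#.
  fromℕ : ℕ → Carrier
  fromℕ zero          = 0#
  fromℕ (suc zero)    = 1#
  fromℕ (suc (suc n)) = 1# + fromℕ (suc n)

  fromℤ : ℤ → Carrier
  fromℤ (+ n)    = fromℕ n
  fromℤ -[1+ n ] = - fromℕ (suc n)

  fromℕ≈× : ∀ n → fromℕ n ≈ n · 1#
  fromℕ≈× zero          = refl
  fromℕ≈× (suc zero)    = sym (+-identityʳ 1#)
  fromℕ≈× (suc (suc n)) = +-congˡ (fromℕ≈× (suc n))

  fromℕ-suc : ∀ n → fromℕ (suc n) ≈ 1# + fromℕ n
  fromℕ-suc n = trans (fromℕ≈× (suc n)) (+-congˡ (sym (fromℕ≈× n)))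

  fromℕ-+ : ∀ m n → fromℕ (m ℕ.+ n) ≈ fromℕ m + fromℕ n
  fromℕ-+ m n = trans (fromℕ≈× (m ℕ.+ n))
    (trans (×-homo-+ 1# m n) (+-cong (sym (fromℕ≈× m)) (sym (fromℕ≈× n))))

  fromℕ-* : ∀ m n → fromℕ (m ℕ.* n) ≈ fromℕ m * fromℕ n
  fromℕ-* m n = trans (fromℕ≈× (m ℕ.* n))
    (trans (×1-homo-* m n) (*-cong (sym (fromℕ≈× m)) (sym (fromℕ≈× n))))

  +-cancel-middle : ∀ x y z → (x + y) - (x + z) ≈ y - z
  +-cancel-middle x y z = begin
    (x + y) - (x + z)     ≈⟨ +-cong (+-comm x y) (sym (-‿+-comm x z)) ⟩
    (y + x) + (- x - z)   ≈⟨ +-assoc y x _ ⟩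
    y + (x + (- x - z))   ≈⟨ +-congˡ (+-assoc x (- x) (- z)) ⟨
    y + ((x - x) - z)     ≈⟨ +-congˡ (+-congʳ (-‿inverseʳ x)) ⟩
    y + (0# - z)          ≈⟨ +-congˡ (+-identityˡ (- z)) ⟩
    y - z                 ∎

  fromℤ-⊖ : ∀ m n → fromℤ (m ℤ.⊖ n) ≈ fromℕ m - fromℕ n
  fromℤ-⊖ m       zero    = sym (trans (+-congˡ -0#≈0#) (+-identityʳ (fromℕ m)))
  fromℤ-⊖ zero    (suc n) = sym (+-identityˡ (- fromℕ (suc n)))
  fromℤ-⊖ (suc m) (suc n) = begin
    fromℤ (suc m ℤ.⊖ suc n)                ≡⟨ ≡.cong fromℤ (ℤₚ.[1+m]⊖[1+n]≡m⊖n m n) ⟩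
    fromℤ (m ℤ.⊖ n)                        ≈⟨ fromℤ-⊖ m n ⟩
    fromℕ m - fromℕ n                      ≈⟨ +-cancel-middle 1# (fromℕ m) (fromℕ n) ⟨
    (1# + fromℕ m) - (1# + fromℕ n)        ≈⟨ +-cong (fromℕ-suc m) (-‿cong (fromℕ-suc n)) ⟨
    fromℕ (suc m) - fromℕ (suc n)          ∎

  fromℤ-+ : ∀ i j → fromℤ (i ℤ.+ j) ≈ fromℤ i + fromℤ j
  fromℤ-+ (+ m)    (+ n)    = fromℕ-+ m n
  fromℤ-+ (+ m)    -[1+ n ] = fromℤ-⊖ m (suc n)
  fromℤ-+ -[1+ m ] (+ n)    = trans (fromℤ-⊖ n (suc m)) (+-comm _ _)
  fromℤ-+ -[1+ m ] -[1+ n ] = begin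
    - fromℕ (suc (suc (m ℕ.+ n)))          ≡⟨ ≡.cong (λ k → - fromℕ (suc k)) (ℕₚ.+-suc m n) ⟨
    - fromℕ (suc m ℕ.+ suc n)              ≈⟨ -‿cong (fromℕ-+ (suc m) (suc n)) ⟩
    - (fromℕ (suc m) + fromℕ (suc n))      ≈⟨ -‿+-comm _ _ ⟨
    - fromℕ (suc m) - fromℕ (suc n)        ∎

  fromℤ-neg : ∀ i → fromℤ (ℤ.- i) ≈ - fromℤ i
  fromℤ-neg (+ zero)    = sym -0#≈0#
  fromℤ-neg (+ (suc n)) = refl
  fromℤ-neg -[1+ n ]    = sym (-‿involutive (fromℕ (suc n)))

  fromℤ-*⁺ : ∀ m j → fromℤ (+ m ℤ.* j) ≈ fromℕ m * fromℤ j
  fromℤ-*⁺ m (+ n) = begin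
    fromℤ (+ m ℤ.* + n)   ≡⟨ ≡.cong fromℤ (ℤₚ.pos-* m n) ⟨
    fromℕ (m ℕ.* n)       ≈⟨ fromℕ-* m n ⟩
    fromℕ m * fromℕ n     ∎
  fromℤ-*⁺ m -[1+ n ] = begin
    fromℤ (+ m ℤ.* -[1+ n ])      ≡⟨ ≡.cong fromℤ (ℤₚ.neg-distribʳ-* (+ m) (+ suc n)) ⟨
    fromℤ (ℤ.- (+ m ℤ.* + suc n)) ≈⟨ fromℤ-neg (+ m ℤ.* + suc n) ⟩
    - fromℤ (+ m ℤ.* + suc n)     ≈⟨ -‿cong (fromℤ-*⁺ m (+ suc n)) ⟩
    - (fromℕ m * fromℕ (suc n))   ≈⟨ -‿distribʳ-* _ _ ⟩
    fromℕ m * - fromℕ (suc n)     ∎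

  fromℤ-* : ∀ i j → fromℤ (i ℤ.* j) ≈ fromℤ i * fromℤ j
  fromℤ-* (+ m)    j = fromℤ-*⁺ m j
  fromℤ-* -[1+ m ] j = begin
    fromℤ (-[1+ m ] ℤ.* j)        ≡⟨ ≡.cong fromℤ (ℤₚ.neg-distribˡ-* (+ suc m) j) ⟨
    fromℤ (ℤ.- (+ suc m ℤ.* j))   ≈⟨ fromℤ-neg (+ suc m ℤ.* j) ⟩
    - fromℤ (+ suc m ℤ.* j)       ≈⟨ -‿cong (fromℤ-*⁺ (suc m) j) ⟩
    - (fromℕ (suc m) * fromℤ j)   ≈⟨ -‿distribˡ-* _ _ ⟩
    - fromℕ (suc m) * fromℤ j     ∎

  -- The normaliser has to recognise vanishing coefficients in order to cancel terms such as x - x.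
  -- Equality of integers can be computed, unlike equality in the ring, so integers serve as
  -- coefficients and are mapped in by `fromℤ`.
  coefficients : RawRing 0ℓ 0ℓ
  coefficients = record
    { Carrier = ℤ ; _≈_ = ≡._≡_ ; _+_ = ℤ._+_ ; _*_ = ℤ._*_ ; -_ = ℤ.-_ ; 0# = + 0 ; 1# = + 1 }

  morphism : coefficients -Raw-AlmostCommutative⟶ fromCommutativeRing R
  morphism = record
    { ⟦_⟧ = fromℤ ; +-homo = fromℤ-+ ; *-homo = fromℤ-* ; -‿homo = fromℤ-neg
    ; 0-homo = refl ; 1-homo = refl }

  _≟_ : ∀ i j → Maybe (fromℤ i ≈ fromℤ j)
  i ≟ j = case i ℤₚ.≟ j of λ where
    (yes i≡j) → just (reflexive (≡.cong fromℤ i≡j))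
    (no _)    → nothing

  open RingSolver coefficients (fromCommutativeRing R) morphism _≟_ public
    using (solve; _:=_; _:+_; _:*_; _:-_; :-_; con; Polynomial)

  :0 :1 : ∀ {n} → Polynomial n
  :0 = con (+ 0)
  :1 = con (+ 1)

-- Order, absolute value, limits and completeness of the reals.

module OrderedField (em : ExcludedMiddle 0ℓ) (R : RealField) where

  open RealField R renaming (Carrier to ℝ)
  open Analysis R
  open IntegerRingSolver commutativeRing
    using (solve; _:=_; _:+_; _:*_; _:-_; :-_; :0; :1)
  open Max totalOrder using (⊔-sel; ⊔-lub; x≤x⊔y; x≤y⊔x)
  open IsTotalOrder isTotalOrder public using (total; antisym; isPartialOrder)
    renaming (reflexive to ≤-reflexive; refl to ≤-refl; trans to ≤-trans;
              ≤-respˡ-≈ to ≤-respˡ; ≤-respʳ-≈ to ≤-respʳ; ≤-resp-≈ to ≤-resp)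

  ≤-poset : Poset 0ℓ 0ℓ 0ℓ
  ≤-poset = record { isPartialOrder = isPartialOrder }

  open ≤-Reasoning ≤-poset
  open GroupProperties +-group using () renaming (x∙y⁻¹≈ε⇒x≈y to x-y≈0⇒x≈y)
  open SemiringMult semiring using (×-homo-+; ×1-homo-*)

  private module Strict = NonStrictToStrict _≈_ _≤_

  <-≤-trans : ∀ {x y z} → x < y → y ≤ z → x < z
  <-≤-trans = Strict.<-≤-trans sym ≤-trans antisym ≤-respʳ

  ≤-<-trans : ∀ {x y z} → x ≤ y → y < z → x < z
  ≤-<-trans = Strict.≤-<-trans ≤-trans antisym ≤-respˡ

  <⇒≤ : ∀ {x y} → x < y → x ≤ y
  <⇒≤ = proj₁

  <⇒≱ : ∀ {x y} → x < y → ¬ y ≤ x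
  <⇒≱ (x≤y , x≉y) y≤x = x≉y (antisym x≤y y≤x)

  ≰⇒> : ∀ {x y} → ¬ x ≤ y → y < x
  ≰⇒> {x} {y} x≰y = [ ⊥-elim ∘ x≰y , (λ y≤x → y≤x , λ y≈x → x≰y (≤-reflexive (sym y≈x))) ]′ (total x y)

  ≤-or-> : ∀ x y → x ≤ y ⊎ y < x
  ≤-or-> x y with em {x ≤ y}
  ... | yes x≤y = inj₁ x≤y
  ... | no x≰y  = inj₂ (≰⇒> x≰y)

  ≮⇒≥ : ∀ {x y} → ¬ x < y → y ≤ x
  ≮⇒≥ {x} {y} x≮y = [ (λ y≤x → y≤x) , ⊥-elim ∘ x≮y ]′ (≤-or-> y x)

  -- With the ring solver proving the equation, this derives an inequality
  -- from an explicit nonnegative expression for the difference.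
  ≤-from-difference : ∀ {x y e} → 0# ≤ e → e ≈ y - x → x ≤ y
  ≤-from-difference {x} {y} {e} 0≤e e≈y-x = begin
    x          ≈⟨ +-identityˡ x ⟨
    0# + x     ≤⟨ +-monoˡ-≤ x 0≤e ⟩
    e + x      ≈⟨ +-congʳ e≈y-x ⟩
    y - x + x  ≈⟨ solve 2 (λ x y → y :- x :+ x := y) refl x y ⟩
    y          ∎

  0≤y-x : ∀ {x y} → x ≤ y → 0# ≤ y - x
  0≤y-x {x} {y} x≤y = ≤-respˡ (-‿inverseʳ x) (+-monoˡ-≤ (- x) x≤y)

  +-mono-≤ : ∀ {x y u v} → x ≤ y → u ≤ v → x + u ≤ y + v
  +-mono-≤ {x} {y} {u} {v} x≤y u≤v = ≤-trans (+-monoˡ-≤ u x≤y)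
    (≤-resp-comm (+-monoˡ-≤ y u≤v))
    where
    ≤-resp-comm : u + y ≤ v + y → y + u ≤ y + v
    ≤-resp-comm = ≤-respˡ (+-comm u y) ∘ ≤-respʳ (+-comm v y)

  +-nonneg : ∀ {x y} → 0# ≤ x → 0# ≤ y → 0# ≤ x + y
  +-nonneg 0≤x 0≤y = ≤-respˡ (+-identityˡ 0#) (+-mono-≤ 0≤x 0≤y)

  neg-mono-≤ : ∀ {x y} → x ≤ y → - y ≤ - x
  neg-mono-≤ {x} {y} x≤y =
    ≤-from-difference (0≤y-x x≤y) (solve 2 (λ x y → y :- x := :- x :- :- y) refl x y)

  *-monoʳ-≤ : ∀ {x y z} → 0# ≤ z → x ≤ y → x * z ≤ y * z
  *-monoʳ-≤ {x} {y} {z} 0≤z x≤y = ≤-from-difference (*-nonNeg (0≤y-x x≤y) 0≤z)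
    (solve 3 (λ x y z → (y :- x) :* z := y :* z :- x :* z) refl x y z)

  *-monoˡ-≤ : ∀ {x y z} → 0# ≤ z → x ≤ y → z * x ≤ z * y
  *-monoˡ-≤ {x} {y} {z} 0≤z x≤y =
    ≤-respˡ (*-comm x z) (≤-respʳ (*-comm y z) (*-monoʳ-≤ 0≤z x≤y))

  *-mono-≤ : ∀ {x y u v} → 0# ≤ u → 0# ≤ y → x ≤ y → u ≤ v → x * u ≤ y * v
  *-mono-≤ 0≤u 0≤y x≤y u≤v = ≤-trans (*-monoʳ-≤ 0≤u x≤y) (*-monoˡ-≤ 0≤y u≤v)

  square-nonneg : ∀ x → 0# ≤ x * x
  square-nonneg x with total 0# x
  ... | inj₁ 0≤x = *-nonNeg 0≤x 0≤x
  ... | inj₂ x≤0 = ≤-respʳ (solve 1 (λ x → (:0 :- x) :* (:0 :- x) := x :* x) refl x)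
                     (*-nonNeg (0≤y-x x≤0) (0≤y-x x≤0))

  0≤1 : 0# ≤ 1#
  0≤1 = ≤-respʳ (*-identityˡ 1#) (square-nonneg 1#)

  integral : ∀ {x y} → ¬ x ≈ 0# → x * y ≈ 0# → y ≈ 0#
  integral {x} {y} x≉0 xy≈0 = begin-equality
    y               ≈⟨ *-identityˡ y ⟨
    1# * y          ≈⟨ *-congʳ (*-inverseʳ x x≉0) ⟨
    x * x ⁻¹ * y    ≈⟨ solve 3 (λ x i y → x :* i :* y := i :* (x :* y)) refl x (x ⁻¹) y ⟩
    x ⁻¹ * (x * y)  ≈⟨ *-congˡ xy≈0 ⟩
    x ⁻¹ * 0#       ≈⟨ zeroʳ _ ⟩
    0#              ∎

  0<⇒≉0 : ∀ {x} → 0# < x → ¬ x ≈ 0#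
  0<⇒≉0 (_ , 0≉x) = 0≉x ∘ sym

  *-cancelʳ-≤ : ∀ {x y z} → 0# < z → x * z ≤ y * z → x ≤ y
  *-cancelʳ-≤ {x} {y} {z} 0<z xz≤yz with total x y
  ... | inj₁ x≤y = x≤y
  ... | inj₂ y≤x = ≤-reflexive (x-y≈0⇒x≈y _ _ (integral (0<⇒≉0 0<z) (begin-equality
    z * (x - y)    ≈⟨ solve 3 (λ x y z → z :* (x :- y) := x :* z :- y :* z) refl x y z ⟩
    x * z - y * z  ≈⟨ +-congʳ (antisym xz≤yz (*-monoʳ-≤ (<⇒≤ 0<z) y≤x)) ⟩
    y * z - y * z  ≈⟨ -‿inverseʳ _ ⟩
    0#             ∎)))

  *-pos : ∀ {x y} → 0# < x → 0# < y → 0# < x * y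
  *-pos 0<x 0<y = *-nonNeg (<⇒≤ 0<x) (<⇒≤ 0<y) , λ 0≈xy →
    0<⇒≉0 0<y (integral (0<⇒≉0 0<x) (sym 0≈xy))

  ⁻¹-pos : ∀ {x} → 0# < x → 0# < x ⁻¹
  ⁻¹-pos {x} 0<x = ≰⇒> λ x⁻¹≤0 → 0≉1 (antisym 0≤1 (begin
    1#        ≈⟨ *-inverseʳ x (0<⇒≉0 0<x) ⟨
    x * x ⁻¹  ≤⟨ *-monoˡ-≤ (<⇒≤ 0<x) x⁻¹≤0 ⟩
    x * 0#    ≈⟨ zeroʳ x ⟩
    0#        ∎))

  0≤ι : ∀ n → 0# ≤ ι n
  0≤ι zero    = ≤-refl
  0≤ι (suc n) = +-nonneg 0≤1 (0≤ι n)

  ι-+ : ∀ m n → ι (m ℕ.+ n) ≈ ι m + ι n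
  ι-+ = ×-homo-+ 1#

  ι-* : ∀ m n → ι (m ℕ.* n) ≈ ι m * ι n
  ι-* = ×1-homo-*

  ι-mono : ∀ {m n} → m ℕ.≤ n → ι m ≤ ι n
  ι-mono {n = n} z≤n = 0≤ι n
  ι-mono (s≤s m≤n) = +-mono-≤ ≤-refl (ι-mono m≤n)

  0<1 : 0# < 1#
  0<1 = 0≤1 , 0≉1

  0<ι : ∀ n → 0# < ι (suc n)
  0<ι n = <-≤-trans 0<1 (≤-respˡ (+-identityʳ 1#) (+-mono-≤ ≤-refl (0≤ι n)))

  0<ι′ : ∀ {n} → 1 ℕ.≤ n → 0# < ι n
  0<ι′ (s≤s {n = n} _) = 0<ι n

  x<x+1 : ∀ x → x < 1# + x
  x<x+1 x = ≤-from-difference 0≤1 (solve 1 (λ x → :1 := (:1 :+ x) :- x) refl x) , λ x≈1+x →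
    0≉1 (trans (solve 1 (λ x → :0 := x :- x) refl x) (trans (+-congʳ x≈1+x)
      (solve 1 (λ x → (:1 :+ x) :- x := :1) refl x)))

  ι-mono-< : ∀ {m n} → m ℕ.< n → ι m < ι n
  ι-mono-< {m} m<n = <-≤-trans (x<x+1 (ι m)) (ι-mono m<n)

  ι-cancel-≤ : ∀ {m n} → ι m ≤ ι n → m ℕ.≤ n
  ι-cancel-≤ {m} {n} ιm≤ιn with m ℕₚ.≤? n
  ... | yes m≤n = m≤n
  ... | no m≰n  = ⊥-elim (<⇒≱ (ι-mono-< (ℕₚ.≰⇒> m≰n)) ιm≤ιn)

  ι-cancel-< : ∀ {m n} → ι m < ι n → m ℕ.< n
  ι-cancel-< ιm<ιn = ℕₚ.≰⇒> λ n≤m → <⇒≱ ιm<ιn (ι-mono n≤m)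

  ∣∣-lub : ∀ {x y} → x ≤ y → - x ≤ y → ∣ x ∣ ≤ y
  ∣∣-lub = ⊔-lub

  x≤∣x∣ : ∀ x → x ≤ ∣ x ∣
  x≤∣x∣ x = x≤x⊔y x (- x)

  -x≤∣x∣ : ∀ x → - x ≤ ∣ x ∣
  -x≤∣x∣ x = x≤y⊔x x (- x)

  0≤∣x∣ : ∀ x → 0# ≤ ∣ x ∣
  0≤∣x∣ x with total 0# x
  ... | inj₁ 0≤x = ≤-trans 0≤x (x≤∣x∣ x)
  ... | inj₂ x≤0 = ≤-trans (0≤y-x x≤0) (≤-respˡ (sym (+-identityˡ (- x))) (-x≤∣x∣ x))

  ∣∣-mono-≈ : ∀ {x y} → x ≈ y → ∣ x ∣ ≤ ∣ y ∣
  ∣∣-mono-≈ {x} {y} x≈y = ∣∣-lub (≤-respˡ (sym x≈y) (x≤∣x∣ y)) (≤-respˡ (-‿cong (sym x≈y)) (-x≤∣x∣ y))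

  ∣∣-cong : ∀ {x y} → x ≈ y → ∣ x ∣ ≈ ∣ y ∣
  ∣∣-cong x≈y = antisym (∣∣-mono-≈ x≈y) (∣∣-mono-≈ (sym x≈y))

  ∣-x∣≤∣x∣ : ∀ x → ∣ - x ∣ ≤ ∣ x ∣
  ∣-x∣≤∣x∣ x = ∣∣-lub (-x≤∣x∣ x) (≤-respˡ (solve 1 (λ x → x := :- :- x) refl x) (x≤∣x∣ x))

  ∣-x∣ : ∀ x → ∣ - x ∣ ≈ ∣ x ∣
  ∣-x∣ x = antisym (∣-x∣≤∣x∣ x)
    (≤-respˡ (∣∣-cong (solve 1 (λ x → :- :- x := x) refl x)) (∣-x∣≤∣x∣ (- x)))

  ∣∣-triangle : ∀ x y → ∣ x + y ∣ ≤ ∣ x ∣ + ∣ y ∣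
  ∣∣-triangle x y = ∣∣-lub (+-mono-≤ (x≤∣x∣ x) (x≤∣x∣ y))
    (≤-respˡ (solve 2 (λ x y → :- x :+ :- y := :- (x :+ y)) refl x y)
      (+-mono-≤ (-x≤∣x∣ x) (-x≤∣x∣ y)))

  ∣∣-nonneg : ∀ {x} → 0# ≤ x → ∣ x ∣ ≈ x
  ∣∣-nonneg {x} 0≤x = antisym (∣∣-lub ≤-refl (≤-trans (neg-mono-≤ 0≤x) (≤-respˡ -0≈0 0≤x))) (x≤∣x∣ x)
    where
    -0≈0 : 0# ≈ - 0#
    -0≈0 = solve 0 (:0 := :- :0) refl

  x*y≤∣x∣*∣y∣ : ∀ x y → x * y ≤ ∣ x ∣ * ∣ y ∣
  x*y≤∣x∣*∣y∣ x y with total 0# y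
  ... | inj₁ 0≤y = *-mono-≤ 0≤y (0≤∣x∣ x) (x≤∣x∣ x) (x≤∣x∣ y)
  ... | inj₂ y≤0 = ≤-respˡ (solve 2 (λ x y → :- x :* :- y := x :* y) refl x y)
    (*-mono-≤ (≤-respʳ (+-identityˡ (- y)) (0≤y-x y≤0)) (0≤∣x∣ x) (-x≤∣x∣ x) (-x≤∣x∣ y))

  ∣∣-* : ∀ x y → ∣ x * y ∣ ≤ ∣ x ∣ * ∣ y ∣
  ∣∣-* x y = ∣∣-lub (x*y≤∣x∣*∣y∣ x y) (begin
    - (x * y)          ≈⟨ solve 2 (λ x y → :- (x :* y) := :- x :* y) refl x y ⟩
    - x * y            ≤⟨ x*y≤∣x∣*∣y∣ (- x) y ⟩
    ∣ - x ∣ * ∣ y ∣    ≈⟨ *-congʳ (∣-x∣ x) ⟩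
    ∣ x ∣ * ∣ y ∣      ∎)

  ∣∣≈0⇒≈0 : ∀ {x} → ∣ x ∣ ≤ 0# → x ≈ 0#
  ∣∣≈0⇒≈0 {x} ∣x∣≤0 = antisym (≤-trans (x≤∣x∣ x) ∣x∣≤0) (begin
    0#      ≈⟨ solve 0 (:0 := :- :0) refl ⟩
    - 0#    ≤⟨ neg-mono-≤ (≤-trans (-x≤∣x∣ x) ∣x∣≤0) ⟩
    - - x   ≈⟨ solve 1 (λ x → :- :- x := x) refl x ⟩
    x       ∎)

  -- If the naturals were bounded they would have a supremum s. As ι (n + 1) ≤ s gives ι n ≤ s - 1
  -- for every n, the smaller number s - 1 would be an upper bound too.
  archimedean : ∀ x → ∃ λ n → x ≤ ι n
  archimedean x with em {∃ λ n → x ≤ ι n}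
  ... | yes bounded = bounded
  ... | no unbounded = ⊥-elim (<⇒≱ (x<x+1 (s - 1#)) (begin
    1# + (s - 1#)  ≈⟨ solve 1 (λ s → :1 :+ (s :- :1) := s) refl s ⟩
    s              ≤⟨ s-least (s - 1#) (λ { _ (n , y≈ιn) → begin
      _                    ≈⟨ y≈ιn ⟩
      ι n                  ≈⟨ solve 1 (λ x → x := (:1 :+ x) :- :1) refl (ι n) ⟩
      ι (suc n) - 1#       ≤⟨ +-monoˡ-≤ (- 1#) (s-upper _ (suc n , refl)) ⟩
      s - 1#               ∎ }) ⟩
    s - 1#         ∎))
    where
    sup = supremum (λ y → ∃ λ n → y ≈ ι n) (0# , 0 , refl)
      (x , λ { y (n , y≈ιn) → ≤-respˡ (sym y≈ιn) (<⇒≤ (≰⇒> λ x≤ιn → unbounded (n , x≤ιn))) })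
    s       = proj₁ sup
    s-upper = proj₁ (proj₂ sup)
    s-least = proj₂ (proj₂ sup)

  archimedean′ : ∀ {ε} C → 0# < ε → ∃ λ n → C < ι n * ε
  archimedean′ {ε} C 0<ε = let n , C/ε≤ιn = archimedean (C * ε ⁻¹) in suc n , (begin-strict
    C                   ≈⟨ *-identityʳ C ⟨
    C * 1#              ≈⟨ *-congˡ (*-inverseʳ ε (0<⇒≉0 0<ε)) ⟨
    C * (ε * ε ⁻¹)      ≈⟨ solve 3 (λ C ε i → C :* (ε :* i) := C :* i :* ε) refl C ε (ε ⁻¹) ⟩
    C * ε ⁻¹ * ε        ≤⟨ *-monoʳ-≤ (<⇒≤ 0<ε) C/ε≤ιn ⟩
    ι n * ε             <⟨ ≰⇒> (λ le → <⇒≱ (x<x+1 (ι n)) (*-cancelʳ-≤ 0<ε le)) ⟩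
    ι (suc n) * ε       ∎)

  -- Descends from an Archimedean bound until ι n ≤ x, stopping at 0 at the latest because x is
  -- nonnegative. It turns the condition p, q ≤ X for real X into p, q ≤ N.
  floor : ∀ {x} → 0# ≤ x → ∃ λ n → ι n ≤ x × x < ι (suc n)
  floor {x} 0≤x = let n , x≤ιn = archimedean x in search n (≤-<-trans x≤ιn (x<x+1 (ι n)))
    where
    search : ∀ n → x < ι (suc n) → ∃ λ n → ι n ≤ x × x < ι (suc n)
    search n x<1+n with ≤-or-> (ι n) x
    ... | inj₁ n≤x = n , n≤x , x<1+n
    search zero    x<1+n | inj₂ x<0 = ⊥-elim (<⇒≱ x<0 0≤x)
    search (suc n) x<1+n | inj₂ x<n = search n x<n

  ½ : ℝ
  ½ = ι 2 ⁻¹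

  2*½≈1 : (1# + 1#) * ½ ≈ 1#
  2*½≈1 = trans (*-congʳ (+-congˡ (sym (+-identityʳ 1#)))) (*-inverseʳ (ι 2) (0<⇒≉0 (0<ι 1)))

  ½+½≈1 : ½ + ½ ≈ 1#
  ½+½≈1 = trans (solve 1 (λ h → h :+ h := (:1 :+ :1) :* h) refl ½) 2*½≈1

  0<½ : 0# < ½
  0<½ = ⁻¹-pos (0<ι 1)

  ^-nonneg : ∀ {x} n → 0# ≤ x → 0# ≤ x ^ n
  ^-nonneg zero    0≤x = 0≤1
  ^-nonneg (suc n) 0≤x = *-nonNeg 0≤x (^-nonneg n 0≤x)

  -- This is n + 1 ≤ 2^n. It is the source of all decay: it brings C ½^n below any ε, and it absorbs
  -- the n + 1 terms of a Cauchy product.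
  ½^n*[1+n]≤1 : ∀ n → ½ ^ n * ι (suc n) ≤ 1#
  ½^n*[1+n]≤1 zero    = ≤-reflexive (solve 0 (:1 :* (:1 :+ :0) := :1) refl)
  ½^n*[1+n]≤1 (suc n) = begin
    ½ * ½ ^ n * (1# + (1# + ι n))
      ≤⟨ *-monoˡ-≤ (*-nonNeg (<⇒≤ 0<½) (^-nonneg n (<⇒≤ 0<½)))
           (≤-from-difference (0≤ι n)
             (solve 1 (λ x → x := ((:1 :+ x) :+ (:1 :+ x)) :- (:1 :+ (:1 :+ x))) refl (ι n))) ⟩
    ½ * ½ ^ n * ((1# + ι n) + (1# + ι n))
      ≈⟨ solve 3 (λ h p x → h :* p :* (x :+ x) := (h :+ h) :* (p :* x)) refl ½ (½ ^ n) (1# + ι n) ⟩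
    (½ + ½) * (½ ^ n * ι (suc n))     ≈⟨ *-congʳ ½+½≈1 ⟩
    1# * (½ ^ n * ι (suc n))          ≈⟨ *-identityˡ _ ⟩
    ½ ^ n * ι (suc n)                 ≤⟨ ½^n*[1+n]≤1 n ⟩
    1#                                ∎

  ½^n≤1 : ∀ n → ½ ^ n ≤ 1#
  ½^n≤1 n = ≤-trans (begin
    ½ ^ n               ≈⟨ *-identityʳ _ ⟨
    ½ ^ n * 1#          ≤⟨ *-monoˡ-≤ (^-nonneg n (<⇒≤ 0<½))
                             (≤-from-difference (0≤ι n) (solve 1 (λ x → x := (:1 :+ x) :- :1) refl (ι n))) ⟩
    ½ ^ n * ι (suc n)   ∎) (½^n*[1+n]≤1 n)

  ½^n*n≤1 : ∀ n → ½ ^ n * ι n ≤ 1#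
  ½^n*n≤1 n = ≤-trans (*-monoˡ-≤ (^-nonneg n (<⇒≤ 0<½)) (<⇒≤ (x<x+1 (ι n)))) (½^n*[1+n]≤1 n)

  geometric<ε : ∀ C {ε} → 0# ≤ C → 0# < ε → ∃ λ N → ∀ n → N ℕ.≤ n → C * ½ ^ n < ε
  geometric<ε C {ε} 0≤C 0<ε = let N , C<Nε = archimedean′ C 0<ε in N , λ n N≤n →
    ≰⇒> λ ε≤Ch → <⇒≱ C<Nε (begin
      ι N * ε               ≤⟨ *-monoʳ-≤ (<⇒≤ 0<ε) (ι-mono N≤n) ⟩
      ι n * ε               ≤⟨ *-monoˡ-≤ (0≤ι n) ε≤Ch ⟩
      ι n * (C * ½ ^ n)     ≈⟨ solve 3 (λ x C p → x :* (C :* p) := C :* (p :* x)) refl (ι n) C (½ ^ n) ⟩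
      C * (½ ^ n * ι n)     ≤⟨ *-monoˡ-≤ 0≤C (½^n*n≤1 n) ⟩
      C * 1#                ≈⟨ *-identityʳ C ⟩
      C                     ∎)

  geometric-bound⇒≈0 : ∀ C {x} → 0# ≤ C → (∀ n → ∣ x ∣ ≤ C * ½ ^ n) → x ≈ 0#
  geometric-bound⇒≈0 C {x} 0≤C bound with ≤-or-> ∣ x ∣ 0#
  ... | inj₁ ∣x∣≤0 = ∣∣≈0⇒≈0 ∣x∣≤0
  ... | inj₂ 0<∣x∣ = let N , small = geometric<ε C 0≤C 0<∣x∣ in
    ⊥-elim (<⇒≱ (small N ℕₚ.≤-refl) (bound N))

  geometric⇒converges : ∀ C {s l} → 0# ≤ C → (∀ n → ∣ s n - l ∣ ≤ C * ½ ^ n) → ConvergesTo s l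
  geometric⇒converges C 0≤C bound ε 0<ε = let N , small = geometric<ε C 0≤C 0<ε in
    N , λ n N≤n → ≤-<-trans (bound n) (small n N≤n)

  limit-unique : ∀ {s l l′} → ConvergesTo s l → ConvergesTo s l′ → l ≈ l′
  limit-unique {s} {l} {l′} s→l s→l′ with ≤-or-> ∣ l - l′ ∣ 0#
  ... | inj₁ le = x-y≈0⇒x≈y _ _ (∣∣≈0⇒≈0 le)
  ... | inj₂ 0<d = ⊥-elim (<⇒≱ (begin-strict
    ∣ l - l′ ∣                      ≈⟨ ∣∣-cong (solve 3 (λ l m s → l :- m := :- (s :- l) :+ (s :- m)) refl l l′ (s n)) ⟩
    ∣ - (s n - l) + (s n - l′) ∣    ≤⟨ ∣∣-triangle _ _ ⟩
    ∣ - (s n - l) ∣ + ∣ s n - l′ ∣  ≈⟨ +-congʳ (∣-x∣ _) ⟩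
    ∣ s n - l ∣ + ∣ s n - l′ ∣      <⟨ +-mono-< (close₁ n (ℕₚ.m≤m⊔n N₁ N₂)) (close₂ n (ℕₚ.m≤n⊔m N₁ N₂)) ⟩
    ε + ε                           ≈⟨ distribˡ _ ½ ½ ⟨
    ∣ l - l′ ∣ * (½ + ½)            ≈⟨ trans (*-congˡ ½+½≈1) (*-identityʳ _) ⟩
    ∣ l - l′ ∣                      ∎) ≤-refl)
    where
    ε = ∣ l - l′ ∣ * ½
    0<ε = *-pos 0<d 0<½
    N₁ = proj₁ (s→l ε 0<ε)
    N₂ = proj₁ (s→l′ ε 0<ε)
    close₁ = proj₂ (s→l ε 0<ε)
    close₂ = proj₂ (s→l′ ε 0<ε)
    n = N₁ ℕ.⊔ N₂
    +-mono-< : ∀ {x y u v} → x < y → u < v → x + u < y + v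
    +-mono-< {x} {y} {u} {v} x<y u<v = ≤-<-trans (+-monoˡ-≤ u (<⇒≤ x<y)) (≰⇒> λ le →
      <⇒≱ u<v (≤-from-difference (0≤y-x le)
        (solve 3 (λ y u v → (y :+ u) :- (y :+ v) := u :- v) refl y u v)))

  converges-resp : ∀ {s s′ l l′} → (∀ n → s n ≈ s′ n) → l ≈ l′ → ConvergesTo s l → ConvergesTo s′ l′
  converges-resp s≈s′ l≈l′ s→l ε 0<ε = let N , close = s→l ε 0<ε in N , λ n N≤n →
    ≤-<-trans (≤-reflexive (∣∣-cong (+-cong (sym (s≈s′ n)) (-‿cong (sym l≈l′))))) (close n N≤n)

  step-mono : ∀ {f : ℕ → ℝ} → (∀ n → f n ≤ f (suc n)) → ∀ {m n} → m ℕ.≤ n → f m ≤ f n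
  step-mono {f} step m≤n = go (ℕₚ.≤⇒≤′ m≤n)
    where
    go : ∀ {m n} → m ℕ.≤′ n → f m ≤ f n
    go (ℕ.≤′-reflexive ≡.refl) = ≤-refl
    go (ℕ.≤′-step m≤n)         = ≤-trans (go m≤n) (step _)

  -- The intervals [s n - β n , s n + β n] are nested, and the limit is the
  -- supremum of their left endpoints.
  telescoping-limit : ∀ (s β : ℕ → ℝ) → (∀ n → 0# ≤ β n) →
    (∀ n → ∣ s (suc n) - s n ∣ ≤ β n - β (suc n)) →
    ∃ λ l → ∀ n → ∣ s n - l ∣ ≤ β n
  telescoping-limit s β 0≤β step = l , λ n → ∣∣-lub
    (≤-from-difference (0≤y-x (l-upper _ (n , refl)))
      (solve 3 (λ l s b → l :- (s :- b) := b :- (s :- l)) refl l (s n) (β n)))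
    (≤-from-difference (0≤y-x (l-least _ (upper n)))
      (solve 3 (λ l s b → (s :+ b) :- l := b :- :- (s :- l)) refl l (s n) (β n)))
    where
    left right : ℕ → ℝ
    left n  = s n - β n
    right n = s n + β n
    left-mono : ∀ n → left n ≤ left (suc n)
    left-mono n = ≤-from-difference (0≤y-x (≤-trans (-x≤∣x∣ _) (step n)))
      (solve 4 (λ s s′ b b′ → (b :- b′) :- :- (s′ :- s) := (s′ :- b′) :- (s :- b)) refl
        (s n) (s (suc n)) (β n) (β (suc n)))
    right-anti : ∀ n → - right n ≤ - right (suc n)
    right-anti n = ≤-from-difference (0≤y-x (≤-trans (x≤∣x∣ _) (step n)))
      (solve 4 (λ s s′ b b′ → (b :- b′) :- (s′ :- s) := :- (s′ :+ b′) :- :- (s :+ b)) refl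
        (s n) (s (suc n)) (β n) (β (suc n)))
    left≤right : ∀ m n → left m ≤ right n
    left≤right m n = begin
      left m   ≤⟨ step-mono left-mono (ℕₚ.m≤m⊔n m n) ⟩
      left k   ≤⟨ ≤-from-difference (+-nonneg (0≤β k) (0≤β k))
                    (solve 2 (λ s b → b :+ b := (s :+ b) :- (s :- b)) refl (s k) (β k)) ⟩
      right k  ≤⟨ ≤-from-difference (0≤y-x (step-mono right-anti (ℕₚ.m≤n⊔m m n)))
                    (solve 2 (λ r r′ → :- r′ :- :- r := r :- r′) refl (right n) (right k)) ⟩
      right n  ∎
      where k = m ℕ.⊔ n
    upper : ∀ n → IsUpperBound (λ x → ∃ λ m → x ≈ left m) (right n)
    upper n x (m , x≈left) = ≤-respˡ (sym x≈left) (left≤right m n)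
    sup = supremum (λ x → ∃ λ m → x ≈ left m) (left 0 , 0 , refl) (right 0 , upper 0)
    l       = proj₁ sup
    l-upper = proj₁ (proj₂ sup)
    l-least = proj₂ (proj₂ sup)

-- The complex numbers: ring laws, absence of zero divisors, a norm.

module Complex (em : ExcludedMiddle 0ℓ) (R : RealField) where

  open RealField R renaming (Carrier to ℝ)
  open Analysis R
  open IntegerRingSolver commutativeRing
    using (solve; _:=_; _:+_; _:*_; _:-_; :-_; :0; :1)
  open OrderedField em R
  open ≤-Reasoning ≤-poset

  ℂ-commutativeRing : CommutativeRing 0ℓ 0ℓ
  ℂ-commutativeRing = record
    { Carrier = ℂ
    ; _≈_ = Setoid._≈_ ℂ-setoid
    ; _+_ = _+ᶜ_
    ; _*_ = _*ᶜ_
    ; -_  = λ (x , y) → (- x) , (- y)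
    ; 0#  = 0ᶜ
    ; 1#  = 1# , 0#
    ; isCommutativeRing = record
      { isRing = record
        { +-isAbelianGroup = record
          { isGroup = record
            { isMonoid = record
              { isSemigroup = record
                { isMagma = record
                  { isEquivalence = Setoid.isEquivalence ℂ-setoid
                  ; ∙-cong = λ (p , q) (r , s) → +-cong p r , +-cong q s }
                ; assoc = λ _ _ _ → +-assoc _ _ _ , +-assoc _ _ _ }
              ; identity = (λ _ → +-identityˡ _ , +-identityˡ _) , (λ _ → +-identityʳ _ , +-identityʳ _) }
            ; inverse = (λ _ → -‿inverseˡ _ , -‿inverseˡ _) , (λ _ → -‿inverseʳ _ , -‿inverseʳ _)
            ; ⁻¹-cong = λ (p , q) → -‿cong p , -‿cong q }
          ; comm = λ _ _ → +-comm _ _ , +-comm _ _ }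
        ; *-cong = λ (p , q) (r , s) →
            +-cong (*-cong p r) (-‿cong (*-cong q s)) , +-cong (*-cong p s) (*-cong q r)
        ; *-assoc = λ (a , b) (c , d) (e , f) →
            solve 6 (λ a b c d e f → (a :* c :- b :* d) :* e :- (a :* d :+ b :* c) :* f :=
                                     a :* (c :* e :- d :* f) :- b :* (c :* f :+ d :* e)) refl a b c d e f ,
            solve 6 (λ a b c d e f → (a :* c :- b :* d) :* f :+ (a :* d :+ b :* c) :* e :=
                                     a :* (c :* f :+ d :* e) :+ b :* (c :* e :- d :* f)) refl a b c d e f
        ; *-identity =
            (λ (a , b) → solve 2 (λ a b → :1 :* a :- :0 :* b := a) refl a b ,
                         solve 2 (λ a b → :1 :* b :+ :0 :* a := b) refl a b) ,
            (λ (a , b) → solve 2 (λ a b → a :* :1 :- b :* :0 := a) refl a b ,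
                         solve 2 (λ a b → a :* :0 :+ b :* :1 := b) refl a b)
        ; distrib =
            (λ (a , b) (c , d) (e , f) →
              solve 6 (λ a b c d e f → a :* (c :+ e) :- b :* (d :+ f) :=
                                       (a :* c :- b :* d) :+ (a :* e :- b :* f)) refl a b c d e f ,
              solve 6 (λ a b c d e f → a :* (d :+ f) :+ b :* (c :+ e) :=
                                       (a :* d :+ b :* c) :+ (a :* f :+ b :* e)) refl a b c d e f) ,
            (λ (a , b) (c , d) (e , f) →
              solve 6 (λ a b c d e f → (c :+ e) :* a :- (d :+ f) :* b :=
                                       (c :* a :- d :* b) :+ (e :* a :- f :* b)) refl a b c d e f ,
              solve 6 (λ a b c d e f → (c :+ e) :* b :+ (d :+ f) :* a :=
                                       (c :* b :+ d :* a) :+ (e :* b :+ f :* a)) refl a b c d e f)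
        }
      ; *-comm = λ (a , b) (c , d) →
          solve 4 (λ a b c d → a :* c :- b :* d := c :* a :- d :* b) refl a b c d ,
          solve 4 (λ a b c d → a :* d :+ b :* c := c :* b :+ d :* a) refl a b c d
      }
    }

  module ℂ = CommutativeRing ℂ-commutativeRing
  open ℂ public using () renaming (_≈_ to _≈ᶜ_; -_ to -ᶜ_; _-_ to _-ᶜ_; 1# to 1ᶜ)

  open RawSemiringDefs (RawRing.rawSemiring ℂ.rawRing) using () renaming (_×_ to _·ᶜ_)

  ιᶜ : ℕ → ℂ
  ιᶜ n = n ·ᶜ 1ᶜ

  ιᶜ≈ι : ∀ n → ιᶜ n ≈ᶜ (ι n , 0#)
  ιᶜ≈ι zero    = refl , refl
  ιᶜ≈ι (suc n) = +-congˡ (proj₁ (ιᶜ≈ι n)) , trans (+-congˡ (proj₂ (ιᶜ≈ι n))) (+-identityˡ 0#)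

  ιᶜ≉0 : ∀ n → ¬ ιᶜ (suc n) ≈ᶜ 0ᶜ
  ιᶜ≉0 n eq = 0<⇒≉0 (0<ι n) (trans (sym (proj₁ (ιᶜ≈ι (suc n)))) (proj₁ eq))

  x²+y²≈0⇒x≈0 : ∀ {x y} → x * x + y * y ≈ 0# → x ≈ 0#
  x²+y²≈0⇒x≈0 {x} {y} eq with em {x ≈ 0#}
  ... | yes x≈0 = x≈0
  ... | no x≉0  = integral x≉0 (antisym (≤-respʳ eq (≤-from-difference (square-nonneg y)
    (solve 2 (λ a b → b := (a :+ b) :- a) refl (x * x) (y * y)))) (square-nonneg x))

  -- Multiplying by the conjugate of z reduces the claim to the reals.
  ℂ-integral : ∀ {z w} → ¬ z ≈ᶜ 0ᶜ → z *ᶜ w ≈ᶜ 0ᶜ → w ≈ᶜ 0ᶜ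
  ℂ-integral {x , y} {u , v} z≉0 (re , im) = integral N≉0 N*u≈0 , integral N≉0 N*v≈0
    where
    N = x * x + y * y
    N≉0 : ¬ N ≈ 0#
    N≉0 N≈0 = z≉0 (x²+y²≈0⇒x≈0 N≈0 , x²+y²≈0⇒x≈0 (trans (+-comm (y * y) (x * x)) N≈0))
    N*u≈0 : N * u ≈ 0#
    N*u≈0 = trans (solve 4 (λ x y u v → (x :* x :+ y :* y) :* u := x :* (x :* u :- y :* v) :+ y :* (x :* v :+ y :* u)) refl x y u v)
      (trans (+-cong (*-congˡ re) (*-congˡ im)) (solve 2 (λ x y → x :* :0 :+ y :* :0 := :0) refl x y))
    N*v≈0 : N * v ≈ 0#
    N*v≈0 = trans (solve 4 (λ x y u v → (x :* x :+ y :* y) :* v := x :* (x :* v :+ y :* u) :- y :* (x :* u :- y :* v)) refl x y u v)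
      (trans (+-cong (*-congˡ im) (-‿cong (*-congˡ re))) (solve 2 (λ x y → x :* :0 :- y :* :0 := :0) refl x y))

  ℂ-domain : IsDomainOfCharZero ℂ-commutativeRing
  ℂ-domain = record { integral = λ {z} {w} → ℂ-integral {z} {w} ; charZero = ιᶜ≉0 }

  -- The l¹ norm is submultiplicative, dominates both coordinates, and is built from real absolute
  -- values alone, with no square root to construct.
  ‖_‖ : ℂ → ℝ
  ‖ x , y ‖ = ∣ x ∣ + ∣ y ∣

  0≤‖z‖ : ∀ z → 0# ≤ ‖ z ‖
  0≤‖z‖ (x , y) = +-nonneg (0≤∣x∣ x) (0≤∣x∣ y)

  ‖‖-cong : ∀ {z w} → z ≈ᶜ w → ‖ z ‖ ≈ ‖ w ‖
  ‖‖-cong (re , im) = +-cong (∣∣-cong re) (∣∣-cong im)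

  ∣Re∣≤‖z‖ : ∀ z → ∣ proj₁ z ∣ ≤ ‖ z ‖
  ∣Re∣≤‖z‖ (x , y) = ≤-from-difference (0≤∣x∣ y) (solve 2 (λ a b → b := (a :+ b) :- a) refl _ _)

  ∣Im∣≤‖z‖ : ∀ z → ∣ proj₂ z ∣ ≤ ‖ z ‖
  ∣Im∣≤‖z‖ (x , y) = ≤-from-difference (0≤∣x∣ x) (solve 2 (λ a b → a := (a :+ b) :- b) refl _ _)

  ‖‖-triangle : ∀ z w → ‖ z +ᶜ w ‖ ≤ ‖ z ‖ + ‖ w ‖
  ‖‖-triangle (x , y) (u , v) = ≤-respʳ
    (solve 4 (λ a b c d → (a :+ c) :+ (b :+ d) := (a :+ b) :+ (c :+ d)) refl (∣ x ∣) (∣ y ∣) (∣ u ∣) (∣ v ∣))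
    (+-mono-≤ (∣∣-triangle x u) (∣∣-triangle y v))

  ‖-z‖ : ∀ z → ‖ -ᶜ z ‖ ≈ ‖ z ‖
  ‖-z‖ (x , y) = +-cong (∣-x∣ x) (∣-x∣ y)

  ‖‖-* : ∀ z w → ‖ z *ᶜ w ‖ ≤ ‖ z ‖ * ‖ w ‖
  ‖‖-* (x , y) (u , v) = begin
    ∣ x * u - y * v ∣ + ∣ x * v + y * u ∣
      ≤⟨ +-mono-≤ (∣∣-triangle (x * u) (- (y * v))) (∣∣-triangle (x * v) (y * u)) ⟩
    (∣ x * u ∣ + ∣ - (y * v) ∣) + (∣ x * v ∣ + ∣ y * u ∣)
      ≤⟨ +-mono-≤ (+-mono-≤ (∣∣-* x u) (≤-respˡ (sym (∣-x∣ (y * v))) (∣∣-* y v))) (+-mono-≤ (∣∣-* x v) (∣∣-* y u)) ⟩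
    (∣ x ∣ * ∣ u ∣ + ∣ y ∣ * ∣ v ∣) + (∣ x ∣ * ∣ v ∣ + ∣ y ∣ * ∣ u ∣)
      ≈⟨ solve 4 (λ x y u v → (x :* u :+ y :* v) :+ (x :* v :+ y :* u) := (x :+ y) :* (u :+ v)) refl (∣ x ∣) (∣ y ∣) (∣ u ∣) (∣ v ∣) ⟩
    (∣ x ∣ + ∣ y ∣) * (∣ u ∣ + ∣ v ∣) ∎

-- Cauchy products of sequences.

module Convolution (K : CommutativeRing 0ℓ 0ℓ) where

  open CommutativeRing K
  open RawSemiringDefs (RawRing.rawSemiring rawRing) using () renaming (_×_ to _·_)
  open IntegerRingSolver K using (solve; _:=_; _:+_; _:*_; _:-_; :-_; :0; :1)
  open SetoidReasoning setoid

  Seq : Set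
  Seq = ℕ → Carrier

  sumTo : Seq → ℕ → Carrier
  sumTo a zero    = 0#
  sumTo a (suc n) = sumTo a n + a n

  conv : Seq → Seq → ℕ → Carrier
  conv a b zero    = a 0 * b 0
  conv a b (suc n) = a 0 * b (suc n) + conv (a ∘ suc) b n

  conv-cong : ∀ {a a′ b b′} → (∀ n → a n ≈ a′ n) → (∀ n → b n ≈ b′ n) → ∀ n → conv a b n ≈ conv a′ b′ n
  conv-cong a≈ b≈ zero    = *-cong (a≈ 0) (b≈ 0)
  conv-cong a≈ b≈ (suc n) = +-cong (*-cong (a≈ 0) (b≈ (suc n))) (conv-cong (a≈ ∘ suc) b≈ n)

  conv-+ˡ : ∀ a a′ b n → conv (λ i → a i + a′ i) b n ≈ conv a b n + conv a′ b n
  conv-+ˡ a a′ b zero    = distribʳ (b 0) (a 0) (a′ 0)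
  conv-+ˡ a a′ b (suc n) = trans (+-congˡ (conv-+ˡ (a ∘ suc) (a′ ∘ suc) b n))
    (solve 5 (λ a a′ b c d → (a :+ a′) :* b :+ (c :+ d) := (a :* b :+ c) :+ (a′ :* b :+ d)) refl
      (a 0) (a′ 0) (b (suc n)) (conv (a ∘ suc) b n) (conv (a′ ∘ suc) b n))

  conv-+ʳ : ∀ a b b′ n → conv a (λ i → b i + b′ i) n ≈ conv a b n + conv a b′ n
  conv-+ʳ a b b′ zero    = distribˡ (a 0) (b 0) (b′ 0)
  conv-+ʳ a b b′ (suc n) = trans (+-congˡ (conv-+ʳ (a ∘ suc) b b′ n))
    (solve 5 (λ a b b′ c d → a :* (b :+ b′) :+ (c :+ d) := (a :* b :+ c) :+ (a :* b′ :+ d)) refl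
      (a 0) (b (suc n)) (b′ (suc n)) (conv (a ∘ suc) b n) (conv (a ∘ suc) b′ n))

  conv-*ˡ : ∀ c a b n → conv (λ i → c * a i) b n ≈ c * conv a b n
  conv-*ˡ c a b zero    = *-assoc c (a 0) (b 0)
  conv-*ˡ c a b (suc n) = trans (+-congˡ (conv-*ˡ c (a ∘ suc) b n))
    (solve 4 (λ c a b d → c :* a :* b :+ c :* d := c :* (a :* b :+ d)) refl
      c (a 0) (b (suc n)) (conv (a ∘ suc) b n))

  conv-*ʳ : ∀ c a b n → conv a (λ i → c * b i) n ≈ c * conv a b n
  conv-*ʳ c a b zero    = solve 3 (λ c a b → a :* (c :* b) := c :* (a :* b)) refl c (a 0) (b 0)
  conv-*ʳ c a b (suc n) = trans (+-congˡ (conv-*ʳ c (a ∘ suc) b n))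
    (solve 4 (λ c a b d → a :* (c :* b) :+ c :* d := c :* (a :* b :+ d)) refl
      c (a 0) (b (suc n)) (conv (a ∘ suc) b n))

  -- The recursion of `conv` splits off the term with a 0 and shifts `a`. Splitting at the other end
  -- shifts `b`, which fits the recursion of `sumTo` and the derivative falling on the second
  -- factor.
  conv-last : ∀ a b n → conv a b (suc n) ≈ conv a (b ∘ suc) n + a (suc n) * b 0
  conv-last a b zero    = refl
  conv-last a b (suc n) = trans (+-congˡ (conv-last (a ∘ suc) b n)) (sym (+-assoc _ _ _))

  θ : Seq → Seq
  θ a n = n · 1# * a n

  -- The operator θ = t d/dt on power series is a derivation.
  conv-θ : ∀ a b n → n · 1# * conv a b n ≈ conv (θ a) b n + conv a (θ b) n
  conv-θ a b zero    = solve 2 (λ a b → :0 :* (a :* b) := :0 :* a :* b :+ a :* (:0 :* b)) refl (a 0) (b 0)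
  conv-θ a b (suc n) = begin
    (1# + ν) * (a 0 * b (suc n) + C)
      ≈⟨ solve 4 (λ ν a b C → (:1 :+ ν) :* (a :* b :+ C) := (a :* ((:1 :+ ν) :* b) :+ C) :+ ν :* C) refl ν (a 0) (b (suc n)) C ⟩
    (a 0 * θ b (suc n) + C) + ν * C
      ≈⟨ +-congˡ (conv-θ (a ∘ suc) b n) ⟩
    (a 0 * θ b (suc n) + C) + (conv (θ (a ∘ suc)) b n + D)
      ≈⟨ solve 6 (λ a b x C D E → (x :+ C) :+ (E :+ D) := (:0 :* a :* b :+ (C :+ E)) :+ (x :+ D)) refl
           (a 0) (b (suc n)) (a 0 * θ b (suc n)) C D (conv (θ (a ∘ suc)) b n) ⟩
    (0# * a 0 * b (suc n) + (C + conv (θ (a ∘ suc)) b n)) + (a 0 * θ b (suc n) + D)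
      ≈⟨ +-congʳ (+-congˡ (trans (sym (conv-+ˡ (a ∘ suc) (θ (a ∘ suc)) b n))
           (conv-cong (λ i → solve 2 (λ ν a → a :+ ν :* a := (:1 :+ ν) :* a) refl (i · 1#) (a (suc i))) (λ _ → refl) n))) ⟩
    (0# * a 0 * b (suc n) + conv (θ a ∘ suc) b n) + (a 0 * θ b (suc n) + D) ∎
    where
    ν = n · 1#
    C = conv (a ∘ suc) b n
    D = conv (a ∘ suc) (θ b) n

  -- The initial value problem f' = z f, f(0) = 1, read on the coefficients of f; its solution is a
  -- n = z^n / n!. The addition law of the exponential then becomes the product rule together with
  -- uniqueness of the solution.
  IsExpSeq : Carrier → Seq → Set
  IsExpSeq z a = a 0 ≈ 1# × (∀ n → suc n · 1# * a (suc n) ≈ z * a n)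

  -- If f' = z f and g' = w g, then (f g)' = f' g + f g' = (z + w) f g. Both index-0 terms produced
  -- by `θ` carry the factor 0, which leaves convolutions of the shifted sequences.
  conv-isExpSeq : ∀ {z w a b} → IsExpSeq z a → IsExpSeq w b → IsExpSeq (z + w) (conv a b)
  conv-isExpSeq {z} {w} {a} {b} (a₀ , a₊) (b₀ , b₊) =
    trans (*-cong a₀ b₀) (*-identityˡ 1#) , λ n → begin
      suc n · 1# * conv a b (suc n)
        ≈⟨ conv-θ a b (suc n) ⟩
      (0# * a 0 * b (suc n) + conv (θ a ∘ suc) b n) + conv a (θ b) (suc n)
        ≈⟨ +-congˡ (conv-last a (θ b) n) ⟩
      (0# * a 0 * b (suc n) + conv (θ a ∘ suc) b n) + (conv a (θ b ∘ suc) n + a (suc n) * (0# * b 0))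
        ≈⟨ +-cong (+-congˡ (trans (conv-cong a₊ (λ _ → refl) n) (conv-*ˡ z a b n)))
                  (+-congʳ (trans (conv-cong (λ _ → refl) b₊ n) (conv-*ʳ w a b n))) ⟩
      (0# * a 0 * b (suc n) + z * conv a b n) + (w * conv a b n + a (suc n) * (0# * b 0))
        ≈⟨ solve 7 (λ a b a′ b′ z w c → (:0 :* a :* b :+ z :* c) :+ (w :* c :+ a′ :* (:0 :* b′)) := (z :+ w) :* c) refl
             (a 0) (b (suc n)) (a (suc n)) (b 0) z w (conv a b n) ⟩
      (z + w) * conv a b n ∎

  IsExpSeq-unique : (∀ n {x y} → suc n · 1# * x ≈ suc n · 1# * y → x ≈ y) →
    ∀ {z a b} → IsExpSeq z a → IsExpSeq z b → ∀ n → a n ≈ b n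
  IsExpSeq-unique cancel (a₀ , a₊) (b₀ , b₊) zero    = trans a₀ (sym b₀)
  IsExpSeq-unique cancel a-exp@(_ , a₊) b-exp@(_ , b₊) (suc n) =
    cancel n (trans (a₊ n) (trans (*-congˡ (IsExpSeq-unique cancel a-exp b-exp n)) (sym (b₊ n))))

  sumTo-* : ∀ a c n → sumTo a (suc n) * c ≈ conv a (λ _ → c) n
  sumTo-* a c zero    = *-congʳ (+-identityˡ (a 0))
  sumTo-* a c (suc n) = trans (distribʳ c (sumTo a (suc n)) (a (suc n)))
    (trans (+-congʳ (sumTo-* a c n)) (sym (conv-last a (λ _ → c) n)))

  sumTo-cong : ∀ {a b} → (∀ n → a n ≈ b n) → ∀ n → sumTo a n ≈ sumTo b n
  sumTo-cong a≈b zero    = refl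
  sumTo-cong a≈b (suc n) = +-cong (sumTo-cong a≈b n) (a≈b n)

  sumTo-conv : ∀ a b n → sumTo (conv a b) (suc n) ≈ conv a (λ j → sumTo b (suc j)) n
  sumTo-conv a b zero    = trans (+-identityˡ _) (*-congˡ (sym (+-identityˡ (b 0))))
  sumTo-conv a b (suc n) = begin
    sumTo (conv a b) (suc n) + conv a b (suc n)
      ≈⟨ +-cong (sumTo-conv a b n) (conv-last a b n) ⟩
    conv a (λ j → sumTo b (suc j)) n + (conv a (b ∘ suc) n + a (suc n) * b 0)
      ≈⟨ +-assoc _ _ _ ⟨
    (conv a (λ j → sumTo b (suc j)) n + conv a (b ∘ suc) n) + a (suc n) * b 0
      ≈⟨ +-cong (conv-+ʳ a _ _ n) (*-congˡ (+-identityˡ (b 0))) ⟨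
    conv a (λ j → sumTo b (suc (suc j))) n + a (suc n) * (0# + b 0)
      ≈⟨ conv-last a (λ j → sumTo b (suc j)) n ⟨
    conv a (λ j → sumTo b (suc j)) (suc n) ∎

  -- With B_j = b 0 + ... + b j, the product of the partial sums is the sum of a i times B_n, while
  -- the partial sum of the Cauchy product is the sum of a i times B_(n-i). The difference consists
  -- of the terms a i * b j with i, j ≤ n < i + j, here arranged as tails of `b` so that it can be
  -- estimated.
  sumTo-product-remainder : ∀ a b n →
    sumTo a (suc n) * sumTo b (suc n) - sumTo (conv a b) (suc n) ≈
    conv a (λ j → sumTo b (suc n) - sumTo b (suc j)) n
  sumTo-product-remainder a b n = begin
    sumTo a (suc n) * sumTo b (suc n) - sumTo (conv a b) (suc n)
      ≈⟨ +-cong (trans (sumTo-* a (sumTo b (suc n)) n) (conv-cong (λ _ → refl)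
           (λ j → solve 2 (λ s t → s := (s :- t) :+ t) refl (sumTo b (suc n)) (sumTo b (suc j))) n))
           (-‿cong (sumTo-conv a b n)) ⟩
    conv a (λ j → (sumTo b (suc n) - sumTo b (suc j)) + sumTo b (suc j)) n - conv a (λ j → sumTo b (suc j)) n
      ≈⟨ +-congʳ (conv-+ʳ a _ _ n) ⟩
    (conv a (λ j → sumTo b (suc n) - sumTo b (suc j)) n + conv a (λ j → sumTo b (suc j)) n) - conv a (λ j → sumTo b (suc j)) n
      ≈⟨ solve 2 (λ x y → (x :+ y) :- y := x) refl _ _ ⟩
    conv a (λ j → sumTo b (suc n) - sumTo b (suc j)) n ∎

  -- Here s, t, u are to be partial sums at z, w, z + w, and e, f, g their limits; every summand on
  -- the left is then small. Over an abstract ring the identity has six variables, where over pairs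
  -- of reals it would have twelve.
  product-error : ∀ e f g s t u →
    (s * t - u) + (u - g) + - ((s - e) * (t - f)) + - (f * (s - e)) + - (e * (t - f)) ≈ e * f - g
  product-error = solve 6 (λ e f g s t u →
    (s :* t :- u) :+ (u :- g) :+ :- ((s :- e) :* (t :- f)) :+ :- (f :* (s :- e)) :+ :- (e :* (t :- f)) :=
    e :* f :- g) refl

  *-rearrange : ∀ a b c d → a * (b * (c * d)) ≈ c * ((a * b) * d)
  *-rearrange = solve 4 (λ a b c d → a :* (b :* (c :* d)) := c :* ((a :* b) :* d)) refl

  +-swap-- : ∀ x y z → (x + y) - z ≈ (x - z) + y
  +-swap-- = solve 3 (λ x y z → (x :+ y) :- z := (x :- z) :+ y) refl

-- The complex exponential: convergence, addition law, conjugation.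

module Exponential (em : ExcludedMiddle 0ℓ) (R : RealField) where

  open RealField R renaming (Carrier to ℝ)
  open Analysis R
  open IntegerRingSolver commutativeRing
    using (solve; _:=_; _:+_; _:*_; _:-_; :-_; :0; :1)
  open OrderedField em R
  open Complex em R
  open Convolution ℂ-commutativeRing
  open ≤-Reasoning ≤-poset
  open SemiringExp semiring using (^-homo-*)
  open SemiringExp ℂ.semiring using (^-congˡ)
  open RingProperties ring using (-0#≈0#)
  open RingProperties ℂ.ring using (x[y-z]≈xy-xz)
  open GroupProperties ℂ.+-group using () renaming (x∙y⁻¹≈ε⇒x≈y to x-y≈0⇒x≈y-ℂ)

  -- Up to exponent m the factor m^m alone suffices; beyond that, each further step multiplies the
  -- left side by m and the right side by n + 1 ≥ m.
  m^n≤m^m*n! : ∀ m → 1 ℕ.≤ m → ∀ n → m ℕ.^ n ℕ.≤ m ℕ.^ m ℕ.* n !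
  m^n≤m^m*n! m@(suc _) 1≤m zero = ≡.subst (1 ℕ.≤_) (≡.sym (ℕₚ.*-identityʳ (m ℕ.^ m))) (ℕₚ.m^n>0 m m)
  m^n≤m^m*n! m@(suc _) 1≤m (suc n) with ℕₚ.≤-total (suc n) m
  ... | inj₁ n<m = ℕₚ.≤-trans (ℕₚ.^-monoʳ-≤ m n<m)
    (≡.subst (ℕ._≤ m ℕ.^ m ℕ.* suc n !) (ℕₚ.*-identityʳ (m ℕ.^ m)) (ℕₚ.*-monoʳ-≤ (m ℕ.^ m) (ℕₚ.1≤n! (suc n))))
  ... | inj₂ m≤n+1 = ℕₚ.≤-trans (ℕₚ.*-mono-≤ m≤n+1 (m^n≤m^m*n! m 1≤m n))
    (ℕₚ.≤-reflexive (x∙yz≈y∙xz (suc n) (m ℕ.^ m) (n !)))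

  -- Kept as a product of two powers of ½: in the estimate of a Cauchy product one of them cancels
  -- the number n + 1 of terms and the other remains as the rate.
  ¼^ : ℕ → ℝ
  ¼^ n = ½ ^ n * ½ ^ n

  0≤½^ : ∀ n → 0# ≤ ½ ^ n
  0≤½^ n = ^-nonneg n (<⇒≤ 0<½)

  0≤¼^ : ∀ n → 0# ≤ ¼^ n
  0≤¼^ n = *-nonNeg (0≤½^ n) (0≤½^ n)

  ¼^≤½^ : ∀ n → ¼^ n ≤ ½ ^ n
  ¼^≤½^ n = ≤-respʳ (*-identityʳ _) (*-monoˡ-≤ (0≤½^ n) (½^n≤1 n))

  ¼^-suc : ∀ n → ¼^ (suc n) + ¼^ (suc n) ≈ ½ * ¼^ n
  ¼^-suc n = trans
    (solve 2 (λ h p → h :* p :* (h :* p) :+ h :* p :* (h :* p) := (h :+ h) :* (h :* (p :* p))) refl ½ (½ ^ n))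
    (trans (*-congʳ ½+½≈1) (*-identityˡ _))

  ¼^-+ : ∀ m n → ¼^ (m ℕ.+ n) ≈ ¼^ m * ¼^ n
  ¼^-+ m n = trans (*-cong (^-homo-* ½ m n) (^-homo-* ½ m n))
    (solve 2 (λ p q → p :* q :* (p :* q) := p :* p :* (q :* q)) refl (½ ^ m) (½ ^ n))

  -- The right side equals 3/2 times K 4^-n. The exact constant would be 4/3 K in place of 2K;
  -- doubling keeps thirds out and still makes 2K 4^-n a telescoping bound for the tails.
  ¼^-telescopes : ∀ {K} n → 0# ≤ K → K * ¼^ n ≤ (K + K) * ¼^ n - (K + K) * ¼^ (suc n)
  ¼^-telescopes {K} n 0≤K = begin
    K * ¼^ n
      ≤⟨ ≤-from-difference (*-nonNeg 0≤K (*-nonNeg (<⇒≤ 0<½) (0≤¼^ n)))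
           (trans (solve 3 (λ K h q → K :* (h :* q) := K :* ((h :+ h) :* q) :- K :* (h :* q)) refl K ½ (¼^ n))
           (trans (+-congʳ (*-congˡ (trans (*-congʳ ½+½≈1) (*-identityˡ _))))
             (solve 3 (λ K q r → K :* q :- K :* r := ((K :+ K) :* q :- K :* r) :- K :* q) refl K (¼^ n) (½ * ¼^ n)))) ⟩
    (K + K) * ¼^ n - K * (½ * ¼^ n)
      ≈⟨ +-congˡ (-‿cong (trans (*-congˡ (sym (¼^-suc n)))
           (solve 2 (λ K q → K :* (q :+ q) := (K :+ K) :* q) refl K (¼^ (suc n))))) ⟩
    (K + K) * ¼^ n - (K + K) * ¼^ (suc n) ∎

  ‖real‖ : ∀ {x} → 0# ≤ x → ‖ x , 0# ‖ ≈ x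
  ‖real‖ 0≤x = trans (+-cong (∣∣-nonneg 0≤x) (∣∣-nonneg ≤-refl)) (+-identityʳ _)

  ‖^‖-bound : ∀ {z} M → ‖ z ‖ ≤ ι M * (½ * ½) → ∀ n → ‖ z ^ᶜ n ‖ ≤ ι (M ℕ.^ n) * ¼^ n
  ‖^‖-bound M z≤ zero    = ≤-reflexive (trans (‖real‖ 0≤1)
    (solve 0 (:1 := (:1 :+ :0) :* (:1 :* :1)) refl))
  ‖^‖-bound {z} M z≤ (suc n) = begin
    ‖ z *ᶜ z ^ᶜ n ‖                                ≤⟨ ‖‖-* z (z ^ᶜ n) ⟩
    ‖ z ‖ * ‖ z ^ᶜ n ‖                             ≤⟨ *-mono-≤ (0≤‖z‖ (z ^ᶜ n)) (*-nonNeg (0≤ι M) (*-nonNeg (<⇒≤ 0<½) (<⇒≤ 0<½)))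
                                                       z≤ (‖^‖-bound M z≤ n) ⟩
    ι M * (½ * ½) * (ι (M ℕ.^ n) * ¼^ n)           ≈⟨ solve 4 (λ a h b p → a :* (h :* h) :* (b :* (p :* p)) := a :* b :* (h :* p :* (h :* p))) refl
                                                       (ι M) ½ (ι (M ℕ.^ n)) (½ ^ n) ⟩
    ι M * ι (M ℕ.^ n) * ¼^ (suc n)                 ≈⟨ *-congʳ (ι-* M (M ℕ.^ n)) ⟨
    ι (M ℕ.^ suc n) * ¼^ (suc n)                   ∎

  0<ι! : ∀ n → 0# < ι (n !)
  0<ι! n = 0<ι′ (ℕₚ.1≤n! n)

  TermBound : ℂ → ℝ → Set
  TermBound z K = 0# ≤ K × (∀ n → ‖ expTerm z n ‖ ≤ K * ¼^ n)

  -- Choose M with ‖ z ‖ ≤ M/4. Then the n-th term is at most (M^n / n!) 4^-n, and M^n / n! ≤ M^M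
  -- for all n, so K = M^M works.
  expTerm-bound : ∀ z → ∃ (TermBound z)
  expTerm-bound z = ι (M ℕ.^ M) , 0≤ι (M ℕ.^ M) , λ n → let 0≤n!⁻¹ = <⇒≤ (⁻¹-pos (0<ι! n)) in begin
    ‖ expTerm z n ‖                                          ≤⟨ ‖‖-* _ (z ^ᶜ n) ⟩
    ‖ (ι (n !)) ⁻¹ , 0# ‖ * ‖ z ^ᶜ n ‖                       ≈⟨ *-congʳ (‖real‖ 0≤n!⁻¹) ⟩
    (ι (n !)) ⁻¹ * ‖ z ^ᶜ n ‖                                ≤⟨ *-monoˡ-≤ 0≤n!⁻¹ (‖^‖-bound M ‖z‖≤M/4 n) ⟩
    (ι (n !)) ⁻¹ * (ι (M ℕ.^ n) * ¼^ n)                      ≤⟨ *-monoˡ-≤ 0≤n!⁻¹ (*-monoʳ-≤ (0≤¼^ n) (ι-mono (m^n≤m^m*n! M (ℕ.s≤s ℕ.z≤n) n))) ⟩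
    (ι (n !)) ⁻¹ * (ι (M ℕ.^ M ℕ.* n !) * ¼^ n)              ≈⟨ *-congˡ (*-congʳ (ι-* (M ℕ.^ M) (n !))) ⟩
    (ι (n !)) ⁻¹ * (ι (M ℕ.^ M) * ι (n !) * ¼^ n)            ≈⟨ solve 4 (λ i m f q → i :* (m :* f :* q) := f :* i :* (m :* q)) refl
                                                                  ((ι (n !)) ⁻¹) (ι (M ℕ.^ M)) (ι (n !)) (¼^ n) ⟩
    ι (n !) * (ι (n !)) ⁻¹ * (ι (M ℕ.^ M) * ¼^ n)            ≈⟨ *-congʳ (*-inverseʳ _ (0<⇒≉0 (0<ι! n))) ⟩
    1# * (ι (M ℕ.^ M) * ¼^ n)                                ≈⟨ *-identityˡ _ ⟩
    ι (M ℕ.^ M) * ¼^ n                                       ∎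
    where
    bound = archimedean (‖ z ‖ * (ι 2 * ι 2))
    -- The successor guarantees M ≥ 1, as `m^n≤m^m*n!` requires.
    M = suc (proj₁ bound)
    ‖z‖≤M/4 : ‖ z ‖ ≤ ι M * (½ * ½)
    ‖z‖≤M/4 = begin
      ‖ z ‖                                  ≈⟨ trans (*-congˡ (trans (*-cong 2½≈1 2½≈1) (*-identityˡ 1#))) (*-identityʳ _) ⟨
      ‖ z ‖ * (ι 2 * ½ * (ι 2 * ½))          ≈⟨ solve 3 (λ z t h → z :* (t :* h :* (t :* h)) := z :* (t :* t) :* (h :* h)) refl (‖ z ‖) (ι 2) ½ ⟩
      ‖ z ‖ * (ι 2 * ι 2) * (½ * ½)          ≤⟨ *-monoʳ-≤ (*-nonNeg (<⇒≤ 0<½) (<⇒≤ 0<½))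
                                                  (≤-trans (proj₂ bound) (<⇒≤ (x<x+1 _))) ⟩
      ι M * (½ * ½)                          ∎
      where
      2½≈1 = *-inverseʳ (ι 2) (0<⇒≉0 (0<ι 1))

  ι1⁻¹≈1 : (ι 1) ⁻¹ ≈ 1#
  ι1⁻¹≈1 = trans (sym (*-identityˡ _)) (trans (*-congʳ (sym (+-identityʳ 1#))) (*-inverseʳ (ι 1) (0<⇒≉0 (0<ι 0))))

  n!⁻¹-step : ∀ n → ι (suc n) * (ι (suc n !)) ⁻¹ ≈ (ι (n !)) ⁻¹
  n!⁻¹-step n = begin-equality
    x * (ι (suc n !)) ⁻¹                ≈⟨ *-identityʳ _ ⟨
    x * (ι (suc n !)) ⁻¹ * 1#           ≈⟨ *-congˡ (*-inverseʳ y (0<⇒≉0 (0<ι! n))) ⟨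
    x * (ι (suc n !)) ⁻¹ * (y * y ⁻¹)   ≈⟨ solve 4 (λ x i y j → x :* i :* (y :* j) := x :* y :* i :* j) refl x ((ι (suc n !)) ⁻¹) y (y ⁻¹) ⟩
    x * y * (ι (suc n !)) ⁻¹ * y ⁻¹     ≈⟨ *-congʳ (trans (*-congʳ (sym (ι-* (suc n) (n !)))) (*-inverseʳ _ (0<⇒≉0 (0<ι! (suc n))))) ⟩
    1# * y ⁻¹                           ≈⟨ *-identityˡ _ ⟩
    y ⁻¹                                ∎
    where
    x = ι (suc n)
    y = ι (n !)

  expTerm-isExpSeq : ∀ z → IsExpSeq z (expTerm z)
  expTerm-isExpSeq z@(x , y) =
    (trans (solve 1 (λ i → i :* :1 :- :0 :* :0 := i) refl (ι 1 ⁻¹)) ι1⁻¹≈1 ,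
     solve 1 (λ i → i :* :0 :+ :0 :* :1 := :0) refl (ι 1 ⁻¹)) ,
    λ n → ℂ.trans (ℂ.*-congʳ {expTerm z (suc n)} (ιᶜ≈ι (suc n)))
      (ℂ.trans (*-rearrange (ι (suc n) , 0#) ((ι (suc n !)) ⁻¹ , 0#) z (z ^ᶜ n))
      (ℂ.*-congˡ {z} (ℂ.*-congʳ {z ^ᶜ n} (
         trans (solve 2 (λ a b → a :* b :- :0 :* :0 := a :* b) refl _ _) (n!⁻¹-step n) ,
         solve 2 (λ a b → a :* :0 :+ :0 :* b := :0) refl _ _))))

  -- Null sequences with an explicit geometric rate. The class is closed under sums, products and
  -- scaling by adding or multiplying constants, with no choice of ε, and a constant sequence in it
  -- is zero.
  Small : (ℕ → ℂ) → Set
  Small s = ∃ λ C → 0# ≤ C × (∀ n → ‖ s n ‖ ≤ C * ½ ^ n)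

  small-cong : ∀ {s s′} → (∀ n → s n ≈ᶜ s′ n) → Small s → Small s′
  small-cong s≈s′ (C , 0≤C , bound) = C , 0≤C , λ n → ≤-respˡ (‖‖-cong (s≈s′ n)) (bound n)

  small-+ : ∀ {s s′} → Small s → Small s′ → Small (λ n → s n +ᶜ s′ n)
  small-+ {s} {s′} (C , 0≤C , bound) (C′ , 0≤C′ , bound′) = C + C′ , +-nonneg 0≤C 0≤C′ , λ n →
    ≤-trans (‖‖-triangle (s n) (s′ n)) (≤-respʳ (sym (distribʳ _ C C′)) (+-mono-≤ (bound n) (bound′ n)))

  small-neg : ∀ {s} → Small s → Small (λ n → -ᶜ s n)
  small-neg {s} (C , 0≤C , bound) = C , 0≤C , λ n → ≤-respˡ (sym (‖-z‖ (s n))) (bound n)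

  small-*ˡ : ∀ {s} c → Small s → Small (λ n → c *ᶜ s n)
  small-*ˡ {s} c (C , 0≤C , bound) = ‖ c ‖ * C , *-nonNeg (0≤‖z‖ c) 0≤C , λ n →
    ≤-trans (‖‖-* c (s n)) (≤-respʳ (sym (*-assoc _ _ _)) (*-monoˡ-≤ (0≤‖z‖ c) (bound n)))

  small-* : ∀ {s s′} → Small s → Small s′ → Small (λ n → s n *ᶜ s′ n)
  small-* {s} {s′} (C , 0≤C , bound) (C′ , 0≤C′ , bound′) = C * C′ , *-nonNeg 0≤C 0≤C′ , λ n → begin
    ‖ s n *ᶜ s′ n ‖                ≤⟨ ‖‖-* (s n) (s′ n) ⟩
    ‖ s n ‖ * ‖ s′ n ‖             ≤⟨ *-mono-≤ (0≤‖z‖ (s′ n)) (*-nonNeg 0≤C (0≤½^ n)) (bound n) (bound′ n) ⟩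
    C * ½ ^ n * (C′ * ½ ^ n)       ≈⟨ solve 3 (λ C D p → C :* p :* (D :* p) := C :* D :* (p :* p)) refl C C′ (½ ^ n) ⟩
    C * C′ * ¼^ n                  ≤⟨ *-monoˡ-≤ (*-nonNeg 0≤C 0≤C′) (¼^≤½^ n) ⟩
    C * C′ * ½ ^ n                 ∎

  small-suc : ∀ {s} → Small s → Small (s ∘ suc)
  small-suc {s} (C , 0≤C , bound) = C * ½ , *-nonNeg 0≤C (<⇒≤ 0<½) , λ n →
    ≤-respʳ (sym (*-assoc _ _ _)) (bound (suc n))

  small-const⇒≈0 : ∀ {z} → Small (λ _ → z) → z ≈ᶜ 0ᶜ
  small-const⇒≈0 {z} (C , 0≤C , bound) =
    geometric-bound⇒≈0 C 0≤C (λ n → ≤-trans (∣Re∣≤‖z‖ z) (bound n)) ,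
    geometric-bound⇒≈0 C 0≤C (λ n → ≤-trans (∣Im∣≤‖z‖ z) (bound n))

  sumTo≡partialSum : ∀ a n → sumTo a n ≡.≡ partialSum a n
  sumTo≡partialSum a zero    = ≡.refl
  sumTo≡partialSum a (suc n) = ≡.cong (_+ᶜ a n) (sumTo≡partialSum a n)

  series-converges : ∀ {a K} → 0# ≤ K → (∀ n → ‖ a n ‖ ≤ K * ¼^ n) → ∃ λ w → Small (λ n → sumTo a n -ᶜ w)
  series-converges {a} {K} 0≤K bound = (proj₁ re , proj₁ im) ,
    (β₀ + β₀) , +-nonneg 0≤β₀ 0≤β₀ , λ n → begin
      ∣ proj₁ (sumTo a n) - proj₁ re ∣ + ∣ proj₂ (sumTo a n) - proj₁ im ∣
        ≤⟨ +-mono-≤ (proj₂ re n) (proj₂ im n) ⟩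
      β₀ * ¼^ n + β₀ * ¼^ n      ≈⟨ distribʳ _ β₀ β₀ ⟨
      (β₀ + β₀) * ¼^ n           ≤⟨ *-monoˡ-≤ (+-nonneg 0≤β₀ 0≤β₀) (¼^≤½^ n) ⟩
      (β₀ + β₀) * ½ ^ n          ∎
    where
    β₀ = K + K
    0≤β₀ = +-nonneg 0≤K 0≤K
    limit : (part : ℂ → ℝ) → (∀ z → ∣ part z ∣ ≤ ‖ z ‖) → (∀ z w → part (z +ᶜ w) ≈ part z + part w) →
      ∃ λ l → ∀ n → ∣ part (sumTo a n) - l ∣ ≤ β₀ * ¼^ n
    limit part part≤ part-+ = telescoping-limit (λ n → part (sumTo a n)) (λ n → β₀ * ¼^ n)
      (λ n → *-nonNeg 0≤β₀ (0≤¼^ n)) λ n → begin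
        ∣ part (sumTo a n +ᶜ a n) - part (sumTo a n) ∣
          ≈⟨ ∣∣-cong (trans (+-congʳ (part-+ (sumTo a n) (a n))) (solve 2 (λ s a → (s :+ a) :- s := a) refl _ _)) ⟩
        ∣ part (a n) ∣  ≤⟨ part≤ (a n) ⟩
        ‖ a n ‖         ≤⟨ bound n ⟩
        K * ¼^ n        ≤⟨ ¼^-telescopes n 0≤K ⟩
        β₀ * ¼^ n - β₀ * ¼^ (suc n) ∎
    re = limit proj₁ ∣Re∣≤‖z‖ (λ _ _ → refl)
    im = limit proj₂ ∣Im∣≤‖z‖ (λ _ _ → refl)

  series-tail : ∀ {a K} → 0# ≤ K → (∀ n → ‖ a n ‖ ≤ K * ¼^ n) → ∀ {m n} → m ℕ.≤ n →
    ‖ sumTo a n -ᶜ sumTo a m ‖ ≤ (K + K) * ¼^ m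
  series-tail {a} {K} 0≤K bound {m} {n} m≤n = ≤-trans (go (ℕₚ.≤⇒≤′ m≤n))
    (≤-from-difference (*-nonNeg (+-nonneg 0≤K 0≤K) (0≤¼^ n)) (solve 2 (λ x y → y := x :- (x :- y)) refl _ _))
    where
    go : ∀ {n} → m ℕ.≤′ n → ‖ sumTo a n -ᶜ sumTo a m ‖ ≤ (K + K) * ¼^ m - (K + K) * ¼^ n
    go (ℕ.≤′-reflexive ≡.refl) = ≤-reflexive (trans (‖‖-cong (ℂ.-‿inverseʳ (sumTo a m)))
      (trans (‖real‖ ≤-refl) (sym (-‿inverseʳ _))))
    go {suc n} (ℕ.≤′-step m≤n) = begin
      ‖ (sumTo a n +ᶜ a n) -ᶜ sumTo a m ‖        ≈⟨ ‖‖-cong (+-swap-- (sumTo a n) (a n) (sumTo a m)) ⟩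
      ‖ (sumTo a n -ᶜ sumTo a m) +ᶜ a n ‖        ≤⟨ ‖‖-triangle _ (a n) ⟩
      ‖ sumTo a n -ᶜ sumTo a m ‖ + ‖ a n ‖       ≤⟨ +-mono-≤ (go m≤n) (≤-trans (bound n) (¼^-telescopes n 0≤K)) ⟩
      (K + K) * ¼^ m - (K + K) * ¼^ n + ((K + K) * ¼^ n - (K + K) * ¼^ (suc n))
        ≈⟨ solve 3 (λ x y z → (x :- y) :+ (y :- z) := x :- z) refl _ _ _ ⟩
      (K + K) * ¼^ m - (K + K) * ¼^ (suc n) ∎

  conv-bound : ∀ B n {a b} → (∀ i j → i ℕ.+ j ≡.≡ n → ‖ a i ‖ * ‖ b j ‖ ≤ B) → ‖ conv a b n ‖ ≤ ι (suc n) * B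
  conv-bound B zero    {a} {b} bound = ≤-trans (‖‖-* (a 0) (b 0))
    (≤-trans (bound 0 0 ≡.refl) (≤-reflexive (solve 1 (λ B → B := (:1 :+ :0) :* B) refl B)))
  conv-bound B (suc n) {a} {b} bound = begin
    ‖ a 0 *ᶜ b (suc n) +ᶜ conv (a ∘ suc) b n ‖      ≤⟨ ‖‖-triangle _ _ ⟩
    ‖ a 0 *ᶜ b (suc n) ‖ + ‖ conv (a ∘ suc) b n ‖   ≤⟨ +-mono-≤ (≤-trans (‖‖-* (a 0) (b (suc n))) (bound 0 (suc n) ≡.refl))
                                                       (conv-bound B n λ i j i+j≡n → bound (suc i) j (≡.cong suc i+j≡n)) ⟩
    B + ι (suc n) * B                               ≈⟨ solve 2 (λ B x → B :+ x :* B := (:1 :+ x) :* B) refl B (ι (suc n)) ⟩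
    ι (suc (suc n)) * B                             ∎

  -- In the remainder written as a convolution, the term with indices i + j = n is at most K 4^-i
  -- times the tail bound 2L 4^-j. The n + 1 terms sum to at most (n + 1) C 4^-n ≤ C 2^-n with C =
  -- 2KL.
  product-remainder-small : ∀ {a b K L} → 0# ≤ K → 0# ≤ L →
    (∀ n → ‖ a n ‖ ≤ K * ¼^ n) → (∀ n → ‖ b n ‖ ≤ L * ¼^ n) →
    Small (λ n → sumTo a (suc n) *ᶜ sumTo b (suc n) -ᶜ sumTo (conv a b) (suc n))
  product-remainder-small {a} {b} {K} {L} 0≤K 0≤L a≤ b≤ =
    small-cong (λ n → ℂ.sym (sumTo-product-remainder a b n)) (K * (L + L) , 0≤C , λ n → begin
      ‖ conv a (λ j → sumTo b (suc n) -ᶜ sumTo b (suc j)) n ‖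
        ≤⟨ conv-bound (C * ¼^ n) n (λ i j i+j≡n → begin
             ‖ a i ‖ * ‖ sumTo b (suc n) -ᶜ sumTo b (suc j) ‖
               ≤⟨ *-mono-≤ (0≤‖z‖ _) (*-nonNeg 0≤K (0≤¼^ i)) (a≤ i)
                    (≤-trans (series-tail 0≤L b≤ (ℕ.s≤s (≡.subst (j ℕ.≤_) i+j≡n (ℕₚ.m≤n+m j i))))
                      (*-monoˡ-≤ (+-nonneg 0≤L 0≤L) (¼^-anti j))) ⟩
             K * ¼^ i * ((L + L) * ¼^ j)     ≈⟨ solve 4 (λ K p L q → K :* p :* (L :* q) := K :* L :* (p :* q)) refl K (¼^ i) (L + L) (¼^ j) ⟩
             C * (¼^ i * ¼^ j)               ≈⟨ *-congˡ (¼^-+ i j) ⟨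
             C * ¼^ (i ℕ.+ j)                ≡⟨ ≡.cong (λ k → C * ¼^ k) i+j≡n ⟩
             C * ¼^ n                        ∎) ⟩
      ι (suc n) * (C * ¼^ n)                 ≈⟨ solve 3 (λ x C p → x :* (C :* (p :* p)) := C :* (p :* x :* p)) refl (ι (suc n)) C (½ ^ n) ⟩
      C * (½ ^ n * ι (suc n) * ½ ^ n)        ≤⟨ *-monoˡ-≤ 0≤C (*-monoʳ-≤ (0≤½^ n) (½^n*[1+n]≤1 n)) ⟩
      C * (1# * ½ ^ n)                       ≈⟨ *-congˡ (*-identityˡ _) ⟩
      C * ½ ^ n                              ∎)
    where
    C = K * (L + L)
    0≤C = *-nonNeg 0≤K (+-nonneg 0≤L 0≤L)
    ¼^-anti : ∀ j → ¼^ (suc j) ≤ ¼^ j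
    ¼^-anti j = ≤-trans (≤-from-difference (0≤¼^ (suc j)) (solve 1 (λ q → q := (q :+ q) :- q) refl _))
      (≤-trans (≤-reflexive (¼^-suc j))
        (≤-from-difference (*-nonNeg (<⇒≤ 0<½) (0≤¼^ j))
          (trans (solve 2 (λ h q → h :* q := (h :+ h) :* q :- h :* q) refl ½ (¼^ j))
            (+-congʳ (trans (*-congʳ ½+½≈1) (*-identityˡ _))))))

  exp-exists : ∀ z → ∃ λ w → Small (λ n → sumTo (expTerm z) n -ᶜ w)
  exp-exists z = let _ , 0≤K , bound = expTerm-bound z in series-converges 0≤K bound

  abstract
    exp : ℂ → ℂ
    exp z = proj₁ (exp-exists z)

    exp-small : ∀ z → Small (λ n → sumTo (expTerm z) n -ᶜ exp z)
    exp-small z = proj₂ (exp-exists z)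

  exp-isExp : ∀ z → IsExp z (exp z)
  exp-isExp z = let C , 0≤C , bound = exp-small z in
    geometric⇒converges C 0≤C (λ n → ≤-trans (≤-reflexive (∣∣-cong (+-congʳ (reflexive (≡.cong proj₁ (≡.sym (sumTo≡partialSum (expTerm z) n)))))))
      (≤-trans (∣Re∣≤‖z‖ _) (bound n))) ,
    geometric⇒converges C 0≤C (λ n → ≤-trans (≤-reflexive (∣∣-cong (+-congʳ (reflexive (≡.cong proj₂ (≡.sym (sumTo≡partialSum (expTerm z) n)))))))
      (≤-trans (∣Im∣≤‖z‖ _) (bound n)))

  IsExp-unique : ∀ {z w w′} → IsExp z w → IsExp z w′ → w ≈ᶜ w′
  IsExp-unique (re , im) (re′ , im′) = limit-unique re re′ , limit-unique im im′

  partialSum-cong : ∀ {a b} → (∀ n → a n ≈ᶜ b n) → ∀ n → partialSum a n ≈ᶜ partialSum b n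
  partialSum-cong a≈b zero    = ℂ.refl
  partialSum-cong a≈b (suc n) = ℂ.+-cong (partialSum-cong a≈b n) (a≈b n)

  IsExp-resp : ∀ {z z′ w w′} → z ≈ᶜ z′ → w ≈ᶜ w′ → IsExp z w → IsExp z′ w′
  IsExp-resp {z} {z′} z≈z′ w≈w′ (re , im) =
    converges-resp (λ n → proj₁ (sums n)) (proj₁ w≈w′) re ,
    converges-resp (λ n → proj₂ (sums n)) (proj₂ w≈w′) im
    where
    sums : ∀ n → partialSum (expTerm z) n ≈ᶜ partialSum (expTerm z′) n
    sums = partialSum-cong (λ n → ℂ.*-congˡ (^-congˡ n z≈z′))

  IsExp⇒exp : ∀ {z w} → IsExp z w → exp z ≈ᶜ w
  IsExp⇒exp {z} = IsExp-unique (exp-isExp z)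

  exp-cong : ∀ {z z′} → z ≈ᶜ z′ → exp z ≈ᶜ exp z′
  exp-cong {z} {z′} z≈z′ = IsExp⇒exp (IsExp-resp (ℂ.sym z≈z′) ℂ.refl (exp-isExp z′))

  ιᶜ-cancel : ∀ n {x y} → ιᶜ (suc n) *ᶜ x ≈ᶜ ιᶜ (suc n) *ᶜ y → x ≈ᶜ y
  ιᶜ-cancel n {x} {y} eq = x-y≈0⇒x≈y-ℂ _ _ (ℂ-integral {ιᶜ (suc n)} {x -ᶜ y} (ιᶜ≉0 n)
    (ℂ.trans (x[y-z]≈xy-xz (ιᶜ (suc n)) x y) (ℂ.trans (ℂ.+-congʳ eq) (ℂ.-‿inverseʳ _))))

  -- The number e^z e^w - e^(z+w) does not depend on n, yet by `product-error` it is for each n a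
  -- sum of five terms of geometric decay; hence it is zero. The Cauchy product of the two term
  -- sequences is the term sequence at z + w because both satisfy the same recurrence.
  exp-+ : ∀ z w → exp (z +ᶜ w) ≈ᶜ exp z *ᶜ exp w
  exp-+ z w = ℂ.sym (x-y≈0⇒x≈y-ℂ _ _ (small-const⇒≈0 (small-cong
    (λ n → product-error (exp z) (exp w) (exp (z +ᶜ w)) (S n) (T n) (U n))
    (small-+ (small-+ (small-+ (small-+ D-small U-small)
      (small-neg (small-* S-small T-small))) (small-neg (small-*ˡ (exp w) S-small)))
      (small-neg (small-*ˡ (exp z) T-small))))))
    where
    S T U : ℕ → ℂ
    S n = sumTo (expTerm z) (suc n)
    T n = sumTo (expTerm w) (suc n)
    U n = sumTo (expTerm (z +ᶜ w)) (suc n)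
    S-small = small-suc (exp-small z)
    T-small = small-suc (exp-small w)
    U-small = small-suc (exp-small (z +ᶜ w))
    conv≈ : ∀ n → conv (expTerm z) (expTerm w) n ≈ᶜ expTerm (z +ᶜ w) n
    conv≈ = IsExpSeq-unique ιᶜ-cancel (conv-isExpSeq (expTerm-isExpSeq z) (expTerm-isExpSeq w)) (expTerm-isExpSeq (z +ᶜ w))
    D-small : Small (λ n → S n *ᶜ T n -ᶜ U n)
    D-small = let _ , 0≤K , z-bound = expTerm-bound z ; _ , 0≤L , w-bound = expTerm-bound w in
      small-cong (λ n → ℂ.+-congˡ (ℂ.-‿cong (sumTo-cong conv≈ (suc n)))) (product-remainder-small 0≤K 0≤L z-bound w-bound)

  exp-0 : exp 0ᶜ ≈ᶜ 1ᶜ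
  exp-0 = ℂ.sym (x-y≈0⇒x≈y-ℂ _ _ (small-const⇒≈0
    (small-cong (λ n → ℂ.+-congʳ (sum≈1 n)) (small-suc (exp-small 0ᶜ)))))
    where
    sum≈1 : ∀ n → sumTo (expTerm 0ᶜ) (suc n) ≈ᶜ 1ᶜ
    sum≈1 zero    = ℂ.trans (ℂ.+-identityˡ _) (proj₁ (expTerm-isExpSeq 0ᶜ))
    sum≈1 (suc n) = ℂ.trans (ℂ.+-cong (sum≈1 n)
      (ℂ.trans (ℂ.*-congˡ {(ι (suc n !)) ⁻¹ , 0#} (ℂ.zeroˡ (0ᶜ ^ᶜ n))) (ℂ.zeroʳ _))) (ℂ.+-identityʳ 1ᶜ)

  conj : ℂ → ℂ
  conj (x , y) = x , - y

  conj-* : ∀ z w → conj (z *ᶜ w) ≈ᶜ conj z *ᶜ conj w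
  conj-* (x , y) (u , v) =
    solve 4 (λ x y u v → x :* u :- y :* v := x :* u :- :- y :* :- v) refl x y u v ,
    solve 4 (λ x y u v → :- (x :* v :+ y :* u) := x :* :- v :+ :- y :* u) refl x y u v

  conj-^ : ∀ z n → conj (z ^ᶜ n) ≈ᶜ conj z ^ᶜ n
  conj-^ z zero    = refl , -0#≈0#
  conj-^ z (suc n) = ℂ.trans (conj-* z (z ^ᶜ n)) (ℂ.*-congˡ {conj z} (conj-^ z n))

  conj-expTerm : ∀ z n → conj (expTerm z n) ≈ᶜ expTerm (conj z) n
  conj-expTerm z n = ℂ.trans (conj-* ((ι (n !)) ⁻¹ , 0#) (z ^ᶜ n)) (ℂ.*-cong (refl , -0#≈0#) (conj-^ z n))

  conj-sum : ∀ z n → conj (partialSum (expTerm z) n) ≈ᶜ partialSum (expTerm (conj z)) n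
  conj-sum z zero    = refl , -0#≈0#
  conj-sum z (suc n) = ℂ.trans
    (refl , solve 2 (λ x y → :- (x :+ y) := :- x :+ :- y) refl _ _)
    (ℂ.+-cong (conj-sum z n) (conj-expTerm z n))

  -- The series has real coefficients, so conjugation passes through the partial sums. This supplies
  -- the value e^(-iπ) used for the period.
  exp-conj : ∀ z → exp (conj z) ≈ᶜ conj (exp z)
  exp-conj z = let re , im = exp-isExp z in IsExp⇒exp
    (converges-resp (λ n → proj₁ (conj-sum z n)) refl re ,
     converges-resp (λ n → proj₂ (conj-sum z n)) refl (converges-neg im))
    where
    converges-neg : ∀ {s l} → ConvergesTo s l → ConvergesTo (λ n → - s n) (- l)
    converges-neg s→l ε 0<ε = let N , close = s→l ε 0<ε in N , λ n N≤n →
      ≤-<-trans (≤-reflexive (trans (∣∣-cong (solve 2 (λ s l → :- s :- :- l := :- (s :- l)) refl _ _)) (∣-x∣ _))) (close n N≤n)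

-- The parametrisation of the unit circle by e^(2πiθ), its period and injectivity.

module Circle (em : ExcludedMiddle 0ℓ) (R : RealField) (π : RealField.Carrier R)
              (isPi : Analysis.IsPi R π) where

  open RealField R renaming (Carrier to ℝ)
  open Analysis R
  open IntegerRingSolver commutativeRing
    using (solve; _:=_; _:+_; _:*_; _:-_; :-_; :0; :1)
  open OrderedField em R
  open Complex em R
  open Exponential em R
  open GroupProperties +-group using () renaming (x∙y⁻¹≈ε⇒x≈y to x-y≈0⇒x≈y)
  open ≤-Reasoning ≤-poset

  0<π : 0# < π
  0<π = proj₁ isPi

  τ : ℝ
  τ = ι 2 * π

  abstract
    e : ℝ → ℂ
    e θ = exp (0# , τ * θ)

    e-isExp : ∀ θ → IsExp (0# , τ * θ) (e θ)
    e-isExp θ = exp-isExp (0# , τ * θ)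

    IsExp⇒e : ∀ {θ α} → IsExp (0# , τ * θ) α → e θ ≈ᶜ α
    IsExp⇒e = IsExp⇒exp

    e-cong : ∀ {x y} → x ≈ y → e x ≈ᶜ e y
    e-cong x≈y = exp-cong (refl , *-congˡ x≈y)

    e-+ : ∀ x y → e (x + y) ≈ᶜ e x *ᶜ e y
    e-+ x y = ℂ.trans (exp-cong (sym (+-identityˡ 0#) , distribˡ τ x y)) (exp-+ (0# , τ * x) (0# , τ * y))

    e-0 : e 0# ≈ᶜ 1ᶜ
    e-0 = ℂ.trans (exp-cong (refl , zeroʳ τ)) exp-0

    double-angle : ∀ θ → e θ ≈ᶜ exp (0# , π * θ) *ᶜ exp (0# , π * θ)
    double-angle θ = ℂ.trans
      (exp-cong (sym (+-identityˡ 0#) , solve 2 (λ p x → (:1 :+ (:1 :+ :0)) :* p :* x := p :* x :+ p :* x) refl π θ))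
      (exp-+ (0# , π * θ) (0# , π * θ))

  exp-iπ : ∃ λ c → exp (0# , π) ≈ᶜ (c , 0#)
  exp-iπ = let _ , (c , isExp) , _ = isPi in c , IsExp⇒exp isExp

  -- As sin π = 0, e^(iπ) is a real number c, so it equals its own conjugate e^(-iπ). Hence e^(2πi)
  -- = c c = e^(iπ) e^(-iπ) = e^0, whatever the sign of c.
  e-1 : e 1# ≈ᶜ 1ᶜ
  e-1 = let c , eq = exp-iπ ; z = c , 0# in
    ℂ.trans (double-angle 1#)
    (ℂ.trans (ℂ.*-cong (ℂ.trans (exp-cong (refl , *-identityʳ π)) eq) (ℂ.trans (exp-cong (refl , *-identityʳ π)) eq))
    (ℂ.trans (ℂ.*-congˡ {z} (ℂ.trans (refl , solve 0 (:0 := :- :0) refl) (ℂ.trans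
        (refl , -‿cong (sym (proj₂ eq))) (ℂ.trans (sym (proj₁ eq) , refl) (ℂ.sym (exp-conj (0# , π)))))))
    (ℂ.trans (ℂ.*-congʳ (ℂ.sym eq))
    (ℂ.trans (ℂ.sym (exp-+ (0# , π) (conj (0# , π))))
    (ℂ.trans (exp-cong (+-identityˡ 0# , -‿inverseʳ π)) exp-0)))))

  e-kernel : ∀ {θ} → 0# ≤ θ → θ < 1# → e θ ≈ᶜ 1ᶜ → θ ≈ 0#
  e-kernel {θ} 0≤θ θ<1 eθ≈1 with em {0# ≈ θ}
  ... | yes 0≈θ = sym 0≈θ
  ... | no 0≉θ  = ⊥-elim (sin≉0 (π * θ) (*-pos 0<π (0≤θ , 0≉θ)) πθ<π
    (proj₁ z , IsExp-resp ℂ.refl (refl , s≈0) (exp-isExp (0# , π * θ))))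
    where
    sin≉0 = proj₂ (proj₂ isPi)
    πθ<π : π * θ < π
    πθ<π = ≰⇒> λ π≤πθ → <⇒≱ θ<1 (*-cancelʳ-≤ 0<π
      (≤-respˡ (sym (*-identityˡ π)) (≤-respʳ (*-comm π θ) π≤πθ)))
    z = exp (0# , π * θ)
    c = proj₁ z
    s = proj₂ z
    z²≈1 : z *ᶜ z ≈ᶜ 1ᶜ
    z²≈1 = ℂ.trans (ℂ.sym (double-angle θ)) eθ≈1
    -- The real part of (c + is)² = 1 reads c² - s² = 1, which for c = 0 would make 1 nonpositive.
    -- With c nonzero, the imaginary part 2cs = 0 forces s = 0.
    c≉0 : ¬ c ≈ 0#
    c≉0 c≈0 = <⇒≱ 0<1 (begin
      1#             ≈⟨ proj₁ z²≈1 ⟨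
      c * c - s * s  ≈⟨ +-congʳ (*-congʳ c≈0) ⟩
      0# * c - s * s ≤⟨ ≤-from-difference (square-nonneg s)
                          (solve 2 (λ c s → s :* s := :0 :- (:0 :* c :- s :* s)) refl c s) ⟩
      0#             ∎)
    s≈0 : s ≈ 0#
    s≈0 = integral c≉0 (integral (0<⇒≉0 (0<ι 1)) (trans
      (solve 2 (λ c s → (:1 :+ (:1 :+ :0)) :* (c :* s) := c :* s :+ s :* c) refl c s) (proj₂ z²≈1)))

  e-ι : ∀ k → e (ι k) ≈ᶜ 1ᶜ
  e-ι zero    = e-0
  e-ι (suc k) = ℂ.trans (e-+ 1# (ι k)) (ℂ.trans (ℂ.*-cong e-1 (e-ι k)) (ℂ.*-identityˡ 1ᶜ))

  e-^ : ∀ θ n → e θ ^ᶜ n ≈ᶜ e (ι n * θ)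
  e-^ θ zero    = ℂ.sym (ℂ.trans (e-cong (zeroˡ θ)) e-0)
  e-^ θ (suc n) = ℂ.trans (ℂ.*-congˡ {e θ} (e-^ θ n)) (ℂ.sym (ℂ.trans
    (e-cong (solve 2 (λ n x → (:1 :+ n) :* x := x :+ n :* x) refl (ι n) θ)) (e-+ θ (ι n * θ))))

  e-cancel : ∀ {x y} → e x ≈ᶜ e y → e (y - x) ≈ᶜ 1ᶜ
  e-cancel {x} {y} eq = ℂ.trans (e-+ y (- x)) (ℂ.trans (ℂ.*-congʳ (ℂ.sym eq))
    (ℂ.trans (ℂ.sym (e-+ x (- x))) (ℂ.trans (e-cong (-‿inverseʳ x)) e-0)))

  e-injective-≤ : ∀ {x y} → 0# ≤ x → y < 1# → x ≤ y → e x ≈ᶜ e y → x ≈ y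
  e-injective-≤ {x} {y} 0≤x y<1 x≤y eq = sym (x-y≈0⇒x≈y _ _ (e-kernel (0≤y-x x≤y)
    (≤-<-trans (≤-from-difference 0≤x (solve 2 (λ x y → x := y :- (y :- x)) refl x y)) y<1)
    (e-cancel eq)))

  e-injective : ∀ {x y} → 0# ≤ x → x < 1# → 0# ≤ y → y < 1# → e x ≈ᶜ e y → x ≈ y
  e-injective {x} {y} 0≤x x<1 0≤y y<1 eq with total x y
  ... | inj₁ x≤y = e-injective-≤ 0≤x y<1 x≤y eq
  ... | inj₂ y≤x = sym (e-injective-≤ 0≤y x<1 y≤x (ℂ.sym eq))

-- Polynomials over a domain of characteristic zero: values, roots, multiplicities, t^n - 1.

module PolynomialFunctions (em : ExcludedMiddle 0ℓ) (K : CommutativeRing 0ℓ 0ℓ)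
  (domain : IsDomainOfCharZero K) where

  open CommutativeRing K
  open IsDomainOfCharZero domain
  open RawSemiringDefs (RawRing.rawSemiring rawRing) using (_^_) renaming (_×_ to _·_)
  open Polynomial rawRing
  open Uniqueness setoid using (Unique)
  open IntegerRingSolver K
    using (solve; _:=_; _:+_; _:*_; _:-_; :-_; :0; :1)
  open SetoidReasoning setoid
  open SemiringExp semiring using (^-homo-*; ^-congˡ)
  open GroupProperties +-group renaming (x∙y⁻¹≈ε⇒x≈y to x-y≈0⇒x≈y; x≈y⇒x∙y⁻¹≈ε to x≈y⇒x-y≈0) using ()
  open SemiringMult semiring using (×-homo-+)

  ^≉0 : ∀ {x} n → ¬ x ≈ 0# → ¬ x ^ n ≈ 0#
  ^≉0 zero    x≉0 1≈0 = charZero 0 (trans (+-identityʳ 1#) 1≈0)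
  ^≉0 (suc n) x≉0 eq  = ^≉0 n x≉0 (integral x≉0 eq)

  *-cancelˡ : ∀ {x y z} → ¬ x ≈ 0# → x * y ≈ x * z → y ≈ z
  *-cancelˡ {x} {y} {z} x≉0 eq = x-y≈0⇒x≈y _ _ (integral x≉0
    (trans (solve 3 (λ x y z → x :* (y :- z) := x :* y :- x :* z) refl x y z) (x≈y⇒x-y≈0 eq)))

  ×1-injective-< : ∀ {m n} → m ℕ.< n → ¬ m · 1# ≈ n · 1#
  ×1-injective-< {m} {n} m<n eq = charZero d (begin
    suc d · 1#                          ≈⟨ solve 2 (λ x y → x := (y :+ x) :- y) refl _ _ ⟩
    (m · 1# + suc d · 1#) - m · 1#      ≈⟨ +-congʳ (×-homo-+ 1# m (suc d)) ⟨
    (m ℕ.+ suc d) · 1# - m · 1#         ≡⟨ ≡.cong (λ k → k · 1# - m · 1#) (≡.trans (ℕₚ.+-suc m d) (ℕₚ.m+[n∸m]≡n m<n)) ⟩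
    n · 1# - m · 1#                     ≈⟨ x≈y⇒x-y≈0 (sym eq) ⟩
    0#                                  ∎)
    where d = n ℕ.∸ suc m

  eval : Poly → Carrier → Carrier
  eval []      x = 0#
  eval (a ∷ f) x = a + x * eval f x

  IsZero : Poly → Set
  IsZero f = ∀ k → coeff f k ≈ 0#

  eval-zero : ∀ f → IsZero f → ∀ x → eval f x ≈ 0#
  eval-zero []      f≈0 x = refl
  eval-zero (a ∷ f) f≈0 x = trans (+-cong (f≈0 0) (trans (*-congˡ (eval-zero f (f≈0 ∘ suc) x)) (zeroʳ x))) (+-identityˡ 0#)

  eval-cong : ∀ f g → f ≈ᴾ g → ∀ x → eval f x ≈ eval g x
  eval-cong []      g       f≈g x = sym (eval-zero g (sym ∘ f≈g) x)
  eval-cong (a ∷ f) []      f≈g x = eval-zero (a ∷ f) f≈g x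
  eval-cong (a ∷ f) (b ∷ g) f≈g x = +-cong (f≈g 0) (*-congˡ (eval-cong f g (f≈g ∘ suc) x))

  eval-+ : ∀ f g x → eval (f +ᴾ g) x ≈ eval f x + eval g x
  eval-+ []      g       x = sym (+-identityˡ _)
  eval-+ (a ∷ f) []      x = sym (+-identityʳ _)
  eval-+ (a ∷ f) (b ∷ g) x = trans (+-congˡ (*-congˡ (eval-+ f g x)))
    (solve 5 (λ a b x f g → (a :+ b) :+ x :* (f :+ g) := (a :+ x :* f) :+ (b :+ x :* g)) refl a b x (eval f x) (eval g x))

  eval-scale : ∀ c f x → eval (map (c *_) f) x ≈ c * eval f x
  eval-scale c []      x = sym (zeroʳ c)
  eval-scale c (a ∷ f) x = trans (+-congˡ (*-congˡ (eval-scale c f x)))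
    (solve 4 (λ c a x f → c :* a :+ x :* (c :* f) := c :* (a :+ x :* f)) refl c a x (eval f x))

  eval-neg : ∀ f x → eval (map -_ f) x ≈ - eval f x
  eval-neg []      x = solve 0 (:0 := :- :0) refl
  eval-neg (a ∷ f) x = trans (+-congˡ (*-congˡ (eval-neg f x)))
    (solve 3 (λ a x f → :- a :+ x :* :- f := :- (a :+ x :* f)) refl a x (eval f x))

  eval-- : ∀ f g x → eval (f -ᴾ g) x ≈ eval f x - eval g x
  eval-- f g x = trans (eval-+ f (map -_ g) x) (+-congˡ (eval-neg g x))

  eval-* : ∀ f g x → eval (f *ᴾ g) x ≈ eval f x * eval g x
  eval-* []      g x = sym (zeroˡ _)
  eval-* (a ∷ f) g x = begin
    eval (map (a *_) g +ᴾ (0# ∷ f *ᴾ g)) x              ≈⟨ eval-+ (map (a *_) g) (0# ∷ f *ᴾ g) x ⟩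
    eval (map (a *_) g) x + (0# + x * eval (f *ᴾ g) x)  ≈⟨ +-cong (eval-scale a g x) (+-congˡ (*-congˡ (eval-* f g x))) ⟩
    a * eval g x + (0# + x * (eval f x * eval g x))     ≈⟨ solve 4 (λ a x f g → a :* g :+ (:0 :+ x :* (f :* g)) := (a :+ x :* f) :* g) refl
                                                             a x (eval f x) (eval g x) ⟩
    (a + x * eval f x) * eval g x                       ∎

  eval-const : ∀ c x → eval (const c) x ≈ c
  eval-const c x = solve 2 (λ c x → c :+ x :* :0 := c) refl c x

  eval-t : ∀ x → eval t x ≈ x
  eval-t x = solve 1 (λ x → :0 :+ x :* (:1 :+ x :* :0) := x) refl x

  eval-^ : ∀ f n x → eval (f ^ᴾ n) x ≈ eval f x ^ n
  eval-^ f zero    x = eval-const 1# x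
  eval-^ f (suc n) x = trans (eval-* f (f ^ᴾ n) x) (*-congˡ (eval-^ f n x))

  eval-t-α : ∀ α x → eval (t -ᴾ const α) x ≈ x - α
  eval-t-α α x = trans (eval-- t (const α) x) (+-cong (eval-t x) (-‿cong (eval-const α x)))

  -- Synthetic division by t - α: by Horner's scheme the coefficients of the quotient are the values
  -- at α of the successive tails of the list, and the remainder is the value of the whole list.
  quot : Carrier → Poly → Poly
  quot α []              = []
  quot α (a ∷ [])        = []
  quot α (a ∷ f@(_ ∷ _)) = eval f α ∷ quot α f

  length-quot : ∀ α a f → length (quot α (a ∷ f)) ≡.≡ length f
  length-quot α a []      = ≡.refl
  length-quot α a (b ∷ f) = ≡.cong suc (length-quot α b f)

  eval-quot : ∀ α f x → eval f x ≈ eval f α + (x - α) * eval (quot α f) x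
  eval-quot α []              x = solve 2 (λ x α → :0 := :0 :+ (x :- α) :* :0) refl x α
  eval-quot α (a ∷ [])        x = solve 3 (λ a x α → a :+ x :* :0 := a :+ α :* :0 :+ (x :- α) :* :0) refl a x α
  eval-quot α (a ∷ f@(_ ∷ _)) x = trans (+-congˡ (*-congˡ (eval-quot α f x)))
    (solve 5 (λ a x α r q → a :+ x :* (r :+ (x :- α) :* q) := a :+ α :* r :+ (x :- α) :* (r :+ x :* q)) refl
      a x α (eval f α) (eval (quot α f) x))

  -- The counterpart of `eval-quot` for coefficients, from which the passage from values to
  -- coefficients starts. The head of the quotient is the value at α of the tail; once it vanishes,
  -- the value of the whole list is its constant term, and the tail is treated the same way.
  quot-zero : ∀ α f → IsZero (quot α f) → eval f α ≈ 0# → IsZero f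
  quot-zero α []              q≈0 fα≈0 k       = refl
  quot-zero α (a ∷ [])        q≈0 fα≈0 zero    = trans (sym (eval-const a α)) fα≈0
  quot-zero α (a ∷ [])        q≈0 fα≈0 (suc k) = refl
  quot-zero α (a ∷ f@(_ ∷ _)) q≈0 fα≈0 zero    = trans (sym (trans (+-congˡ (trans (*-congˡ (q≈0 0)) (zeroʳ α))) (+-identityʳ a))) fα≈0
  quot-zero α (a ∷ f@(_ ∷ _)) q≈0 fα≈0 (suc k) = quot-zero α f (q≈0 ∘ suc) (q≈0 0) k

  -- Division by t - α for the first root α shortens the list by one and keeps the other roots,
  -- since x - α is nonzero there. The length of the list plays the part of degree plus one,
  -- trailing zeros included.
  many-roots⇒zero : ∀ xs f → Unique xs → length f ℕ.≤ length xs → All (λ x → eval f x ≈ 0#) xs → IsZero f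
  many-roots⇒zero xs       []      _                 _       _            _ = refl
  many-roots⇒zero (α ∷ xs) (a ∷ f) (α∉xs ∷ xs!) (ℕ.s≤s le) (fα≈0 ∷ fxs≈0) =
    quot-zero α (a ∷ f) (many-roots⇒zero xs (quot α (a ∷ f)) xs!
      (≡.subst (ℕ._≤ length xs) (≡.sym (length-quot α a f)) le)
      (All.zipWith quot-root (α∉xs , fxs≈0))) fα≈0
    where
    quot-root : ∀ {x} → ¬ α ≈ x × eval (a ∷ f) x ≈ 0# → eval (quot α (a ∷ f)) x ≈ 0#
    quot-root {x} (α≉x , fx≈0) = integral (λ x-α≈0 → α≉x (sym (x-y≈0⇒x≈y _ _ x-α≈0))) (begin
      (x - α) * q                         ≈⟨ +-identityˡ _ ⟨
      0# + (x - α) * q                    ≈⟨ +-congʳ fα≈0 ⟨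
      eval (a ∷ f) α + (x - α) * q        ≈⟨ eval-quot α (a ∷ f) x ⟨
      eval (a ∷ f) x                      ≈⟨ fx≈0 ⟩
      0#                                  ∎)
      where q = eval (quot α (a ∷ f)) x

  -- The points α + 1, α + 2, ... are pairwise distinct and differ from α, so there are as many
  -- roots as coefficients. Exempting α is what later permits cancelling powers of x - α pointwise.
  zero-off-point : ∀ α f → (∀ x → ¬ x ≈ α → eval f x ≈ 0#) → IsZero f
  zero-off-point α f f≈0 = many-roots⇒zero (applyDownFrom point n) f
    (Uniqueₚ.applyDownFrom⁺₁ setoid point n λ j<i _ eq → ×1-injective-< (ℕ.s≤s j<i)
      (x+-cancel (sym eq)))
    (ℕₚ.≤-reflexive (≡.sym (Listₚ.length-applyDownFrom point n)))
    (Allₚ.applyDownFrom⁺₂ point n λ i → f≈0 (point i) λ eq → charZero i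
      (x+-cancel (trans eq (sym (+-identityʳ α)))))
    where
    n = length f
    point : ℕ → Carrier
    point i = α + suc i · 1#
    x+-cancel : ∀ {x y} → α + x ≈ α + y → x ≈ y
    x+-cancel {x} {y} eq = trans (solve 2 (λ a x → x := (a :+ x) :- a) refl α x)
      (trans (+-congʳ eq) (solve 2 (λ a y → (a :+ y) :- a := y) refl α y))

  coeff-+ : ∀ f g k → coeff (f +ᴾ g) k ≈ coeff f k + coeff g k
  coeff-+ []      g       k       = sym (+-identityˡ _)
  coeff-+ (a ∷ f) []      k       = sym (+-identityʳ _)
  coeff-+ (a ∷ f) (b ∷ g) zero    = refl
  coeff-+ (a ∷ f) (b ∷ g) (suc k) = coeff-+ f g k

  coeff-neg : ∀ f k → coeff (map -_ f) k ≈ - coeff f k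
  coeff-neg []      k       = solve 0 (:0 := :- :0) refl
  coeff-neg (a ∷ f) zero    = refl
  coeff-neg (a ∷ f) (suc k) = coeff-neg f k

  agree-off-point : ∀ α f g → (∀ x → ¬ x ≈ α → eval f x ≈ eval g x) → f ≈ᴾ g
  agree-off-point α f g f≈g k = x-y≈0⇒x≈y _ _ (trans
    (sym (trans (coeff-+ f (map -_ g) k) (+-congˡ (coeff-neg g k))))
    (zero-off-point α (f -ᴾ g) (λ x x≉α → trans (eval-- f g x) (x≈y⇒x-y≈0 (f≈g x x≉α))) k))

  eval-faithful : ∀ f g → (∀ x → eval f x ≈ eval g x) → f ≈ᴾ g
  eval-faithful f g f≈g = agree-off-point 0# f g (λ x _ → f≈g x)

  -- The multiplicity is attached to a function rather than to a coefficient list, so that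
  -- expressions such as (x^p - 1) * (x^q - 1) are handled factor by factor; orders add under
  -- multiplication.
  record Order (α : Carrier) (F : Carrier → Carrier) (m : ℕ) : Set where
    constructor mkOrder
    field
      cofactor     : Poly
      factorises   : ∀ x → F x ≈ (x - α) ^ m * eval cofactor x
      nonvanishing : ¬ eval cofactor α ≈ 0#

  Order-cong : ∀ {α F G m} → (∀ x → F x ≈ G x) → Order α F m → Order α G m
  Order-cong F≈G (mkOrder g F≈ gα≉0) = mkOrder g (λ x → trans (sym (F≈G x)) (F≈ x)) gα≉0

  -- If m > n, cancelling (x - α)^n away from α leaves h = (x - α)^(m-n) g there. Two polynomials
  -- that agree off α agree at α, so h would vanish at α.
  Order-≤ : ∀ {α F m n} → Order α F m → Order α F n → m ℕ.≤ n
  Order-≤ {α} {F} {m} {n} (mkOrder g F≈g _) (mkOrder h F≈h hα≉0) with m ℕₚ.≤? n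
  ... | yes m≤n = m≤n
  ... | no m≰n  = ⊥-elim (hα≉0 (begin
    eval h α               ≈⟨ eval-cong h k (agree-off-point α h k h≈k) α ⟩
    eval k α               ≈⟨ eval-k α ⟩
    (α - α) * ((α - α) ^ d * eval g α) ≈⟨ *-congʳ (-‿inverseʳ α) ⟩
    0# * ((α - α) ^ d * eval g α)      ≈⟨ zeroˡ _ ⟩
    0#                                 ∎))
    where
    d = m ℕ.∸ suc n
    k = (t -ᴾ const α) ^ᴾ suc d *ᴾ g
    eval-k : ∀ x → eval k x ≈ (x - α) * ((x - α) ^ d * eval g x)
    eval-k x = trans (eval-* ((t -ᴾ const α) ^ᴾ suc d) g x)
      (trans (*-congʳ (trans (eval-^ (t -ᴾ const α) (suc d) x) (^-congˡ (suc d) (eval-t-α α x)))) (*-assoc _ _ _))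
    h≈k : ∀ x → ¬ x ≈ α → eval h x ≈ eval k x
    h≈k x x≉α = *-cancelˡ (^≉0 n (x≉α ∘ x-y≈0⇒x≈y _ _)) (begin
      (x - α) ^ n * eval h x                            ≈⟨ F≈h x ⟨
      F x                                               ≈⟨ F≈g x ⟩
      (x - α) ^ m * eval g x                            ≡⟨ ≡.cong (λ j → (x - α) ^ j * eval g x)
                                                            (≡.trans (≡.sym (ℕₚ.m+[n∸m]≡n (ℕₚ.≰⇒> m≰n))) (≡.sym (ℕₚ.+-suc n d))) ⟩
      (x - α) ^ (n ℕ.+ suc d) * eval g x                ≈⟨ *-congʳ (^-homo-* (x - α) n (suc d)) ⟩
      (x - α) ^ n * (x - α) ^ suc d * eval g x          ≈⟨ solve 4 (λ p y q g → p :* (y :* q) :* g := p :* (y :* (q :* g))) refl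
                                                            ((x - α) ^ n) (x - α) ((x - α) ^ d) (eval g x) ⟩
      (x - α) ^ n * ((x - α) * ((x - α) ^ d * eval g x)) ≈⟨ *-congˡ (eval-k x) ⟨
      (x - α) ^ n * eval k x                            ∎)

  Order-unique : ∀ {α F m n} → Order α F m → Order α F n → m ≡.≡ n
  Order-unique o o′ = ℕₚ.≤-antisym (Order-≤ o o′) (Order-≤ o′ o)

  Order-* : ∀ {α F G m n} → Order α F m → Order α G n → Order α (λ x → F x * G x) (m ℕ.+ n)
  Order-* {α} {F} {G} {m} {n} (mkOrder f F≈ fα≉0) (mkOrder g G≈ gα≉0) = mkOrder (f *ᴾ g) (λ x → begin
    F x * G x                                                ≈⟨ *-cong (F≈ x) (G≈ x) ⟩
    (x - α) ^ m * eval f x * ((x - α) ^ n * eval g x)        ≈⟨ solve 4 (λ p f q g → p :* f :* (q :* g) := p :* q :* (f :* g)) refl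
                                                                  ((x - α) ^ m) (eval f x) ((x - α) ^ n) (eval g x) ⟩
    (x - α) ^ m * (x - α) ^ n * (eval f x * eval g x)        ≈⟨ *-cong (^-homo-* (x - α) m n) (eval-* f g x) ⟨
    (x - α) ^ (m ℕ.+ n) * eval (f *ᴾ g) x                    ∎)
    λ fgα≈0 → gα≉0 (integral fα≉0 (trans (sym (eval-* f g α)) fgα≈0))

  Order⇒nonzero : ∀ {α F m} → Order α F m → ¬ (∀ x → F x ≈ 0#)
  Order⇒nonzero {α} {F} {m} (mkOrder g F≈g gα≉0) F≈0 = gα≉0
    (eval-cong g [] (agree-off-point α g [] λ x x≉α → integral (^≉0 m (x≉α ∘ x-y≈0⇒x≈y _ _)) (trans (sym (F≈g x)) (F≈0 x))) α)

  Order-0 : ∀ {α} f → ¬ eval f α ≈ 0# → Order α (eval f) 0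
  Order-0 f fα≉0 = mkOrder f (λ x → sym (*-identityˡ _)) fα≉0

  Order-1 : ∀ {α} → Order α (λ _ → 1#) 0
  Order-1 {α} = Order-cong (eval-const 1#) (Order-0 (const 1#)
    (λ eq → charZero 0 (trans (+-identityʳ 1#) (trans (sym (eval-const 1# α)) eq))))

  Order-^ : ∀ {α F m} → Order α F m → ∀ n → Order α (λ x → F x ^ n) (n ℕ.* m)
  Order-^ o zero    = Order-1
  Order-^ o (suc n) = Order-* o (Order-^ o n)

  -- Divides by t - α as long as α is a root. The recursion runs on the length bound `n`, because
  -- the quotient is a new list and not a sublist of the old one.
  Order-exists : ∀ α n f → length f ℕ.≤ n → ¬ IsZero f → ∃ (Order α (eval f))
  Order-exists α n f le f≉0 with em {eval f α ≈ 0#}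
  ... | no fα≉0 = 0 , Order-0 f fα≉0
  Order-exists α n       []      le         f≉0 | yes fα≈0 = ⊥-elim (f≉0 λ _ → refl)
  Order-exists α (suc n) (a ∷ f) (ℕ.s≤s le) f≉0 | yes fα≈0 =
    let m , mkOrder g q≈ gα≉0 = Order-exists α n q (≡.subst (ℕ._≤ n) (≡.sym (length-quot α a f)) le)
                              (λ q≈0 → f≉0 (quot-zero α (a ∷ f) q≈0 fα≈0))
    in suc m , mkOrder g (λ x → begin
      eval (a ∷ f) x                             ≈⟨ eval-quot α (a ∷ f) x ⟩
      eval (a ∷ f) α + (x - α) * eval q x        ≈⟨ +-cong fα≈0 (*-congˡ (q≈ x)) ⟩
      0# + (x - α) * ((x - α) ^ m * eval g x)    ≈⟨ solve 3 (λ y p g → :0 :+ y :* (p :* g) := y :* p :* g) refl _ _ _ ⟩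
      (x - α) ^ suc m * eval g x                 ∎) gα≉0
    where q = quot α (a ∷ f)

  -- The divisibility relation in the definition of multiplicity puts the cofactor on the left,
  -- while `Order` puts the power first.
  eval-factor : ∀ α m g x → eval (g *ᴾ (t -ᴾ const α) ^ᴾ m) x ≈ (x - α) ^ m * eval g x
  eval-factor α m g x = trans (eval-* g ((t -ᴾ const α) ^ᴾ m) x)
    (trans (*-congˡ (trans (eval-^ (t -ᴾ const α) m x) (^-congˡ m (eval-t-α α x)))) (*-comm _ _))

  -- A cofactor that vanished at α could be divided by t - α once more, against the maximality of m.
  HasMultiplicity⇒Order : ∀ {α m f} → α HasMultiplicity m In f → Order α (eval f) m
  HasMultiplicity⇒Order {α} {m} {f} ((g RawMagmaDefs., g*≈f) , ∤f) = mkOrder g f≈ λ gα≈0 →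
    ∤f (quot α g RawMagmaDefs., eval-faithful (quot α g *ᴾ (t -ᴾ const α) ^ᴾ suc m) f (λ x → begin
      eval (quot α g *ᴾ (t -ᴾ const α) ^ᴾ suc m) x         ≈⟨ eval-factor α (suc m) (quot α g) x ⟩
      (x - α) * (x - α) ^ m * eval (quot α g) x            ≈⟨ solve 3 (λ y p q → y :* p :* q := p :* (:0 :+ y :* q)) refl _ _ _ ⟩
      (x - α) ^ m * (0# + (x - α) * eval (quot α g) x)     ≈⟨ *-congˡ (+-congʳ gα≈0) ⟨
      (x - α) ^ m * (eval g α + (x - α) * eval (quot α g) x) ≈⟨ *-congˡ (eval-quot α g x) ⟨
      (x - α) ^ m * eval g x                               ≈⟨ f≈ x ⟨
      eval f x                                             ∎))
    where
    f≈ : ∀ x → eval f x ≈ (x - α) ^ m * eval g x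
    f≈ x = trans (sym (eval-cong (g *ᴾ (t -ᴾ const α) ^ᴾ m) f g*≈f x)) (eval-factor α m g x)

  Order⇒HasMultiplicity : ∀ {α m f} → Order α (eval f) m → α HasMultiplicity m In f
  Order⇒HasMultiplicity {α} {m} {f} (mkOrder g f≈ gα≉0) =
    (g RawMagmaDefs., eval-faithful (g *ᴾ (t -ᴾ const α) ^ᴾ m) f (λ x → trans (eval-factor α m g x) (sym (f≈ x)))) ,
    λ (h RawMagmaDefs., h*≈f) → gα≉0 (begin
      eval g α                               ≈⟨ eval-cong g (h *ᴾ (t -ᴾ const α) ^ᴾ 1) (agree-off-point α g (h *ᴾ (t -ᴾ const α) ^ᴾ 1) λ x x≉α →
                                                  *-cancelˡ (^≉0 m (x≉α ∘ x-y≈0⇒x≈y _ _)) (begin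
        (x - α) ^ m * eval g x                                  ≈⟨ f≈ x ⟨
        eval f x                                                ≈⟨ eval-cong (h *ᴾ (t -ᴾ const α) ^ᴾ suc m) f h*≈f x ⟨
        eval (h *ᴾ (t -ᴾ const α) ^ᴾ suc m) x                   ≈⟨ eval-factor α (suc m) h x ⟩
        (x - α) * (x - α) ^ m * eval h x                        ≈⟨ solve 3 (λ y p h → y :* p :* h := p :* (y :* :1 :* h)) refl _ _ _ ⟩
        (x - α) ^ m * ((x - α) ^ 1 * eval h x)                  ≈⟨ *-congˡ (eval-factor α 1 h x) ⟨
        (x - α) ^ m * eval (h *ᴾ (t -ᴾ const α) ^ᴾ 1) x         ∎)) α ⟩
      eval (h *ᴾ (t -ᴾ const α) ^ᴾ 1) α      ≈⟨ eval-factor α 1 h α ⟩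
      (α - α) * 1# * eval h α                ≈⟨ solve 2 (λ a h → (a :- a) :* :1 :* h := :0) refl α (eval h α) ⟩
      0#                                     ∎)

  -- The quotient (t^n - α^n) / (t - α), with coefficients α^(n-1), ..., α, 1.
  powerQuot : Carrier → ℕ → Poly
  powerQuot α zero    = []
  powerQuot α (suc n) = (α ^ n) ∷ powerQuot α n

  eval-powerQuot : ∀ α n x → x ^ n - α ^ n ≈ (x - α) * eval (powerQuot α n) x
  eval-powerQuot α zero    x = solve 2 (λ x α → :1 :- :1 := (x :- α) :* :0) refl x α
  eval-powerQuot α (suc n) x = begin
    x * x ^ n - α * α ^ n                                    ≈⟨ solve 4 (λ x α p q → x :* p :- α :* q := (x :- α) :* q :+ x :* (p :- q)) refl x α (x ^ n) (α ^ n) ⟩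
    (x - α) * α ^ n + x * (x ^ n - α ^ n)                    ≈⟨ +-congˡ (*-congˡ (eval-powerQuot α n x)) ⟩
    (x - α) * α ^ n + x * ((x - α) * eval (powerQuot α n) x) ≈⟨ solve 4 (λ x α q h → (x :- α) :* q :+ x :* ((x :- α) :* h) := (x :- α) :* (q :+ x :* h)) refl
                                                                  x α (α ^ n) (eval (powerQuot α n) x) ⟩
    (x - α) * (α ^ n + x * eval (powerQuot α n) x)           ∎

  -- The value of the quotient at t = α is the derivative n α^(n-1). Multiplying by α avoids the
  -- exponent n - 1; at a root of unity the result is n itself, which is nonzero, so the root is
  -- simple.
  eval-powerQuot-diagonal : ∀ α n → α * eval (powerQuot α n) α ≈ n · 1# * α ^ n
  eval-powerQuot-diagonal α zero    = solve 1 (λ α → α :* :0 := :0 :* :1) refl α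
  eval-powerQuot-diagonal α (suc n) = trans (*-congˡ (+-congˡ (eval-powerQuot-diagonal α n)))
    (solve 3 (λ α p m → α :* (p :+ m :* p) := (:1 :+ m) :* (α :* p)) refl α (α ^ n) (n · 1#))

  Order-xⁿ-1-root : ∀ {α n} → 1 ℕ.≤ n → α ^ n ≈ 1# → Order α (λ x → x ^ n - 1#) 1
  Order-xⁿ-1-root {α} {n@(suc m)} _ αⁿ≈1 = mkOrder (powerQuot α n)
    (λ x → trans (+-congˡ (-‿cong (sym αⁿ≈1))) (trans (eval-powerQuot α n x) (*-congʳ (sym (*-identityʳ _)))))
    λ eq → charZero m (begin
      n · 1#                                ≈⟨ *-identityʳ _ ⟨
      n · 1# * 1#                           ≈⟨ *-congˡ αⁿ≈1 ⟨
      n · 1# * α ^ n                        ≈⟨ eval-powerQuot-diagonal α n ⟨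
      α * eval (powerQuot α n) α            ≈⟨ *-congˡ eq ⟩
      α * 0#                                ≈⟨ zeroʳ α ⟩
      0#                                    ∎)

  eval-tⁿ-1 : ∀ n x → eval (t ^ᴾ n -ᴾ const 1#) x ≈ x ^ n - 1#
  eval-tⁿ-1 n x = trans (eval-- (t ^ᴾ n) (const 1#) x)
    (+-cong (trans (eval-^ t n x) (^-congˡ n (eval-t x))) (-‿cong (eval-const 1# x)))

  Order-xⁿ-1-nonroot : ∀ {α n} → ¬ α ^ n ≈ 1# → Order α (λ x → x ^ n - 1#) 0
  Order-xⁿ-1-nonroot {α} {n} αⁿ≉1 = Order-cong (eval-tⁿ-1 n) (Order-0 (t ^ᴾ n -ᴾ const 1#)
    (λ eq → αⁿ≉1 (x-y≈0⇒x≈y _ _ (trans (sym (eval-tⁿ-1 n α)) eq))))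

  -- A form of t^n whose length and leading coefficient can be read off, as the bound on the number
  -- of roots of unity requires.
  xⁿ-as-list : ℕ → Poly
  xⁿ-as-list n = replicate n 0# ++ 1# ∷ []

  eval-xⁿ-as-list : ∀ n x → eval (xⁿ-as-list n) x ≈ x ^ n
  eval-xⁿ-as-list zero    x = eval-const 1# x
  eval-xⁿ-as-list (suc n) x = trans (+-identityˡ _) (*-congˡ (eval-xⁿ-as-list n x))

  length-xⁿ-as-list : ∀ n → length (xⁿ-as-list n) ≡.≡ suc n
  length-xⁿ-as-list zero    = ≡.refl
  length-xⁿ-as-list (suc n) = ≡.cong suc (length-xⁿ-as-list n)

  coeff-xⁿ-as-list : ∀ n → coeff (xⁿ-as-list n) n ≈ 1#
  coeff-xⁿ-as-list zero    = refl
  coeff-xⁿ-as-list (suc n) = coeff-xⁿ-as-list n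

  -- More than n roots would make every coefficient of t^n - 1 vanish, but the leading one is 1.
  roots-of-unity-≤ : ∀ {n} xs → 1 ℕ.≤ n → Unique xs → All (λ x → x ^ n ≈ 1#) xs → length xs ℕ.≤ n
  roots-of-unity-≤ {suc n} xs _ xs! roots with length xs ℕₚ.≤? suc n
  ... | yes le = le
  ... | no ¬le = ⊥-elim (charZero 0 (trans (+-identityʳ 1#) (trans (sym (coeff-xⁿ-as-list n))
    (many-roots⇒zero xs (- 1# ∷ xⁿ-as-list n) xs!
      (≡.subst (ℕ._≤ length xs) (≡.cong suc (≡.sym (length-xⁿ-as-list n))) (ℕₚ.≰⇒> ¬le))
      (All.map (λ {x} xⁿ≈1 → trans (+-congˡ (trans (*-congˡ (eval-xⁿ-as-list n x)) xⁿ≈1)) (-‿inverseˡ 1#)) roots)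
      (suc n)))))

  geometricSum : ℕ → ℕ → Poly
  geometricSum m zero    = []
  geometricSum m (suc n) = const 1# +ᴾ t ^ᴾ m *ᴾ geometricSum m n

  eval-geometricSum : ∀ m n x → (x ^ m - 1#) * eval (geometricSum m n) x ≈ x ^ (n ℕ.* m) - 1#
  eval-geometricSum m zero    x = solve 1 (λ y → (y :- :1) :* :0 := :1 :- :1) refl (x ^ m)
  eval-geometricSum m (suc n) x = begin
    (x ^ m - 1#) * eval (const 1# +ᴾ t ^ᴾ m *ᴾ G) x   ≈⟨ *-congˡ (trans (eval-+ (const 1#) (t ^ᴾ m *ᴾ G) x) (+-cong (eval-const 1# x)
                                                            (trans (eval-* (t ^ᴾ m) G x) (*-congʳ (trans (eval-^ t m x) (^-congˡ m (eval-t x))))))) ⟩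
    (x ^ m - 1#) * (1# + x ^ m * eval G x)            ≈⟨ solve 2 (λ y g → (y :- :1) :* (:1 :+ y :* g) := (y :- :1) :+ y :* ((y :- :1) :* g)) refl (x ^ m) (eval G x) ⟩
    (x ^ m - 1#) + x ^ m * ((x ^ m - 1#) * eval G x)  ≈⟨ +-congˡ (*-congˡ (eval-geometricSum m n x)) ⟩
    (x ^ m - 1#) + x ^ m * (x ^ (n ℕ.* m) - 1#)       ≈⟨ solve 2 (λ y z → (y :- :1) :+ y :* (z :- :1) := y :* z :- :1) refl (x ^ m) (x ^ (n ℕ.* m)) ⟩
    x ^ m * x ^ (n ℕ.* m) - 1#                        ≈⟨ +-congʳ (^-homo-* x m (n ℕ.* m)) ⟨
    x ^ (suc n ℕ.* m) - 1#                            ∎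
    where G = geometricSum m n

-- Indicator functions and counts of natural numbers below a bound.

module Indicator (em : ExcludedMiddle 0ℓ) where

  χ : Set → ℕ
  χ P with em {P}
  ... | yes _ = 1
  ... | no _  = 0

  χ-true : ∀ {P} → P → χ P ≡.≡ 1
  χ-true {P} p with em {P}
  ... | yes _ = ≡.refl
  ... | no ¬p = ⊥-elim (¬p p)

  χ-false : ∀ {P} → ¬ P → χ P ≡.≡ 0
  χ-false {P} ¬p with em {P}
  ... | yes p = ⊥-elim (¬p p)
  ... | no _  = ≡.refl

  χ≤1 : ∀ P → χ P ℕ.≤ 1
  χ≤1 P with em {P}
  ... | yes _ = ℕₚ.≤-refl
  ... | no _  = ℕ.z≤n

  χ-mono : ∀ {P Q} → (P → Q) → χ P ℕ.≤ χ Q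
  χ-mono {P} {Q} P⇒Q with em {P}
  ... | yes p = ℕₚ.≤-reflexive (≡.sym (χ-true (P⇒Q p)))
  ... | no _  = ℕ.z≤n

  χ-cong : ∀ {P Q} → (P → Q) → (Q → P) → χ P ≡.≡ χ Q
  χ-cong P⇒Q Q⇒P = ℕₚ.≤-antisym (χ-mono P⇒Q) (χ-mono Q⇒P)

  module _ {A : Set} where

    sum-mono : ∀ {f g : A → ℕ} {xs} → All (λ x → f x ℕ.≤ g x) xs → sum (map f xs) ℕ.≤ sum (map g xs)
    sum-mono []        = ℕ.z≤n
    sum-mono (le ∷ les) = ℕₚ.+-mono-≤ le (sum-mono les)

    sum-+ : ∀ (f g : A → ℕ) xs → sum (map (λ x → f x ℕ.+ g x) xs) ≡.≡ sum (map f xs) ℕ.+ sum (map g xs)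
    sum-+ f g []       = ≡.refl
    sum-+ f g (x ∷ xs) = ≡.trans (≡.cong (f x ℕ.+ g x ℕ.+_) (sum-+ f g xs)) (interchange (f x) (g x) _ _)

    sum-const : ∀ d (xs : List A) → sum (map (λ _ → d) xs) ≡.≡ length xs ℕ.* d
    sum-const d []       = ≡.refl
    sum-const d (x ∷ xs) = ≡.cong (d ℕ.+_) (sum-const d xs)

    sum-χ : ∀ (P : A → Set) xs → sum (map (χ ∘ P) xs) ≡.≡ length (filter (λ x → em {P x}) xs)
    sum-χ P []       = ≡.refl
    sum-χ P (x ∷ xs) with em {P x}
    ... | yes _ = ≡.cong suc (sum-χ P xs)
    ... | no _  = sum-χ P xs

  count : (ℕ → Set) → ℕ → ℕ
  count P zero    = 0
  count P (suc n) = χ (P n) ℕ.+ count P n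

  length-filter-applyDownFrom : ∀ {A : Set} (P : A → Set) f n →
    length (filter (λ x → em {P x}) (applyDownFrom f n)) ≡.≡ count (P ∘ f) n
  length-filter-applyDownFrom P f zero = ≡.refl
  length-filter-applyDownFrom P f (suc n) with em {P (f n)}
  ... | yes _ = ≡.cong suc (length-filter-applyDownFrom P f n)
  ... | no _  = length-filter-applyDownFrom P f n

  count-mono : ∀ {P Q : ℕ → Set} n → (∀ k → k ℕ.< n → P k → Q k) → count P n ℕ.≤ count Q n
  count-mono zero    P⇒Q = ℕ.z≤n
  count-mono (suc n) P⇒Q = ℕₚ.+-mono-≤ (χ-mono (P⇒Q n ℕₚ.≤-refl)) (count-mono n λ k k<n → P⇒Q k (ℕₚ.m<n⇒m<1+n k<n))

  count-+ : ∀ {P Q S : ℕ → Set} n → (∀ k → χ (P k) ℕ.+ χ (Q k) ≡.≡ χ (S k)) → count P n ℕ.+ count Q n ≡.≡ count S n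
  count-+ zero    eq = ≡.refl
  count-+ {P} {Q} (suc n) eq = ≡.trans (interchange (χ (P n)) (count P n) (χ (Q n)) (count Q n))
    (≡.cong₂ ℕ._+_ (eq n) (count-+ n eq))

  -- The index 0 stands for the root 1, which may lie on an arc because of the parameter 1 although
  -- its own angle 0 is outside; this exception costs one.
  count-except-0 : ∀ {P Q : ℕ → Set} n → (∀ k → k ℕ.< n → ¬ k ≡.≡ 0 → P k → Q k) → count P n ℕ.≤ suc (count Q n)
  count-except-0 zero          P⇒Q = ℕ.z≤n
  count-except-0 {P} {Q} (suc zero)    P⇒Q = ℕₚ.+-mono-≤ {χ (P 0)} {1} (χ≤1 (P 0)) ℕ.z≤n
  count-except-0 {P} {Q} (suc (suc n)) P⇒Q = ℕₚ.≤-trans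
    (ℕₚ.+-mono-≤ (χ-mono (P⇒Q (suc n) ℕₚ.≤-refl λ ())) (count-except-0 (suc n) λ k k<n → P⇒Q k (ℕₚ.m<n⇒m<1+n k<n)))
    (ℕₚ.≤-reflexive (ℕₚ.+-suc (χ (Q (suc n))) (count Q (suc n))))

  module _ {Q : ℕ → Set} (down : ∀ {j k} → j ℕ.≤ k → Q k → Q j) where

    count-full : ∀ n → (∀ k → k ℕ.< n → Q k) → count Q n ≡.≡ n
    count-full zero    all = ≡.refl
    count-full (suc n) all = ≡.cong₂ ℕ._+_ (χ-true (all n ℕₚ.≤-refl)) (count-full n λ k k<n → all k (ℕₚ.m<n⇒m<1+n k<n))

    count≤ : ∀ n → count Q n ℕ.≤ n
    count≤ zero    = ℕ.z≤n
    count≤ (suc n) = ℕₚ.+-mono-≤ (χ≤1 (Q n)) (count≤ n)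

    -- Downward closure makes the counted indices an initial segment. Its last member is therefore
    -- the predecessor of the count, and, as `count-missed` adds, the count itself is the first
    -- index left out.
    last-counted : ∀ n k → count Q n ≡.≡ suc k → Q k
    last-counted (suc n) k eq with em {Q n}
    ... | yes Qn = down (ℕₚ.≤-trans (ℕₚ.≤-reflexive (ℕₚ.suc-injective (≡.sym eq))) (count≤ n)) Qn
    ... | no _   = last-counted n k eq

    count-missed : ∀ n → count Q n ℕ.< n → ¬ Q (count Q n)
    count-missed (suc n) c<1+n with em {Q n}
    ... | yes Qn = ⊥-elim (ℕₚ.<-irrefl (≡.cong suc (count-full n λ k k<n → down (ℕₚ.<⇒≤ k<n) Qn)) c<1+n)
    ... | no ¬Qn with count Q n ℕₚ.<? n
    ...   | yes c<n = count-missed n c<n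
    ...   | no c≮n  = ≡.subst (¬_ ∘ Q) (ℕₚ.≤-antisym (ℕₚ.≮⇒≥ c≮n) (ℕₚ.≤-pred c<1+n)) ¬Qn

-- The Alexander polynomial of a torus link: existence and root multiplicities.

module TorusPolynomial (em : ExcludedMiddle 0ℓ) (K : CommutativeRing 0ℓ 0ℓ)
  (domain : IsDomainOfCharZero K) where

  open CommutativeRing K
  open IsDomainOfCharZero domain
  open RawSemiringDefs (RawRing.rawSemiring rawRing) using (_^_)
  open Polynomial rawRing
  open IntegerRingSolver K
    using (solve; _:=_; _:*_; _:-_; :1)
  open SetoidReasoning setoid
  open SemiringExp semiring using (^-congˡ)
  open Indicator em
  open PolynomialFunctions em K domain

  tⁿ-1 : ℕ → Poly
  tⁿ-1 n = t ^ᴾ n -ᴾ const 1#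

  -- The defining equation over a general domain; over the complex numbers it unfolds to
  -- `IsAlexanderPolynomial`.
  AlexanderPolynomial : ℕ → ℕ → Poly → Set
  AlexanderPolynomial p q Δ = (tⁿ-1 p *ᴾ tⁿ-1 q) *ᴾ Δ ≈ᴾ (tⁿ-1 (lcm p q) ^ᴾ gcd p q) *ᴾ tⁿ-1 1

  denominator numerator : ℕ → ℕ → Carrier → Carrier
  denominator p q x = (x ^ p - 1#) * (x ^ q - 1#)
  numerator   p q x = (x ^ lcm p q - 1#) ^ gcd p q * (x ^ 1 - 1#)

  eval-denominator : ∀ p q Δ x → eval ((tⁿ-1 p *ᴾ tⁿ-1 q) *ᴾ Δ) x ≈ denominator p q x * eval Δ x
  eval-denominator p q Δ x = trans (eval-* (tⁿ-1 p *ᴾ tⁿ-1 q) Δ x)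
    (*-congʳ (trans (eval-* (tⁿ-1 p) (tⁿ-1 q) x) (*-cong (eval-tⁿ-1 p x) (eval-tⁿ-1 q x))))

  eval-numerator : ∀ p q x → eval ((tⁿ-1 (lcm p q) ^ᴾ gcd p q) *ᴾ tⁿ-1 1) x ≈ numerator p q x
  eval-numerator p q x = trans (eval-* (tⁿ-1 (lcm p q) ^ᴾ gcd p q) (tⁿ-1 1) x)
    (*-cong (trans (eval-^ (tⁿ-1 (lcm p q)) (gcd p q) x) (^-congˡ (gcd p q) (eval-tⁿ-1 (lcm p q) x))) (eval-tⁿ-1 1 x))

  alexander⇒eval : ∀ {p q Δ} → AlexanderPolynomial p q Δ → ∀ x → denominator p q x * eval Δ x ≈ numerator p q x
  alexander⇒eval {p} {q} {Δ} Δ-alex x = trans (sym (eval-denominator p q Δ x))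
    (trans (eval-cong ((tⁿ-1 p *ᴾ tⁿ-1 q) *ᴾ Δ) ((tⁿ-1 (lcm p q) ^ᴾ gcd p q) *ᴾ tⁿ-1 1) Δ-alex x) (eval-numerator p q x))

  eval⇒alexander : ∀ {p q Δ} → (∀ x → denominator p q x * eval Δ x ≈ numerator p q x) → AlexanderPolynomial p q Δ
  eval⇒alexander {p} {q} {Δ} eq = eval-faithful ((tⁿ-1 p *ᴾ tⁿ-1 q) *ᴾ Δ) ((tⁿ-1 (lcm p q) ^ᴾ gcd p q) *ᴾ tⁿ-1 1)
    λ x → trans (eval-denominator p q Δ x) (trans (eq x) (sym (eval-numerator p q x)))

  divides⇒quotient : ∀ {m n} → m ∣ n → ∃ λ g → ∀ x → (x ^ m - 1#) * eval g x ≈ x ^ n - 1#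
  divides⇒quotient {m} (divides k ≡.refl) = geometricSum m k , eval-geometricSum m k

  -- If 1 + y q = x p then t - 1 = (t^(x p) - 1) - t (t^(y q) - 1).
  coprime-quotient : ∀ {p q L} x y → 1 ℕ.+ y ℕ.* q ≡.≡ x ℕ.* p → p ∣ L → q ∣ L →
    ∃ λ Δ → ∀ z → denominator p q z * eval Δ z ≈ (z ^ L - 1#) * (z ^ 1 - 1#)
  coprime-quotient {p} {q} {L} x y bézout p∣L q∣L = Gq *ᴾ Gx -ᴾ t *ᴾ (Gp *ᴾ Gy) , λ z → begin
    denominator p q z * eval (Gq *ᴾ Gx -ᴾ t *ᴾ (Gp *ᴾ Gy)) z
      ≈⟨ *-congˡ (trans (eval-- (Gq *ᴾ Gx) (t *ᴾ (Gp *ᴾ Gy)) z)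
           (+-cong (eval-* Gq Gx z) (-‿cong (trans (eval-* t (Gp *ᴾ Gy) z) (*-cong (eval-t z) (eval-* Gp Gy z)))))) ⟩
    (z ^ p - 1#) * (z ^ q - 1#) * (eval Gq z * eval Gx z - z * (eval Gp z * eval Gy z))
      ≈⟨ solve 7 (λ P Q gq gx z gp gy → P :* Q :* (gq :* gx :- z :* (gp :* gy)) :=
                                        (Q :* gq) :* (P :* gx) :- (P :* gp) :* (z :* (Q :* gy))) refl
           (z ^ p - 1#) (z ^ q - 1#) (eval Gq z) (eval Gx z) z (eval Gp z) (eval Gy z) ⟩
    (z ^ q - 1#) * eval Gq z * ((z ^ p - 1#) * eval Gx z) - (z ^ p - 1#) * eval Gp z * (z * ((z ^ q - 1#) * eval Gy z))
      ≈⟨ +-cong (*-cong (Gq≈ z) (eval-geometricSum p x z)) (-‿cong (*-cong (Gp≈ z) (*-congˡ (eval-geometricSum q y z)))) ⟩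
    (z ^ L - 1#) * (z ^ (x ℕ.* p) - 1#) - (z ^ L - 1#) * (z * (z ^ (y ℕ.* q) - 1#))
      ≡⟨ ≡.cong (λ k → (z ^ L - 1#) * (z ^ k - 1#) - (z ^ L - 1#) * (z * (z ^ (y ℕ.* q) - 1#))) bézout ⟨
    (z ^ L - 1#) * (z * z ^ (y ℕ.* q) - 1#) - (z ^ L - 1#) * (z * (z ^ (y ℕ.* q) - 1#))
      ≈⟨ solve 3 (λ l z w → (l :- :1) :* (z :* w :- :1) :- (l :- :1) :* (z :* (w :- :1)) := (l :- :1) :* (z :* :1 :- :1)) refl
           (z ^ L) z (z ^ (y ℕ.* q)) ⟩
    (z ^ L - 1#) * (z ^ 1 - 1#) ∎
    where
    Gx = geometricSum p x
    Gy = geometricSum q y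
    Gp = proj₁ (divides⇒quotient p∣L)
    Gq = proj₁ (divides⇒quotient q∣L)
    Gp≈ = proj₂ (divides⇒quotient p∣L)
    Gq≈ = proj₂ (divides⇒quotient q∣L)

  -- With d ≥ 2, one factor t^L - 1 is divided by t^p - 1 and another by t^q - 1. With d = 1 both
  -- must divide (t^L - 1)(t - 1), which rests on Bézout's identity for p and q; the two signs of
  -- that identity exchange the roles of p and q.
  quotient-exists : ∀ {p q L} d → 1 ℕ.≤ d → p ∣ L → q ∣ L → (d ≡.≡ 1 → Bézout.Identity.Identity 1 p q) →
    ∃ λ Δ → ∀ z → denominator p q z * eval Δ z ≈ (z ^ L - 1#) ^ d * (z ^ 1 - 1#)
  quotient-exists 1 _ p∣L q∣L bézout with bézout ≡.refl
  ... | Bézout.Identity.+- x y eq = let Δ , Δ≈ = coprime-quotient x y eq p∣L q∣L in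
    Δ , λ z → trans (Δ≈ z) (*-congʳ (sym (*-identityʳ _)))
  ... | Bézout.Identity.-+ x y eq = let Δ , Δ≈ = coprime-quotient y x eq q∣L p∣L in
    Δ , λ z → trans (*-congʳ (*-comm _ _)) (trans (Δ≈ z) (*-congʳ (sym (*-identityʳ _))))
  quotient-exists {p} {q} {L} (suc (suc d)) _ p∣L q∣L _ =
    let Gp , Gp≈ = divides⇒quotient p∣L
        Gq , Gq≈ = divides⇒quotient q∣L in
    Gp *ᴾ Gq *ᴾ (tⁿ-1 L ^ᴾ d *ᴾ tⁿ-1 1) , λ z → begin
      denominator p q z * eval (Gp *ᴾ Gq *ᴾ (tⁿ-1 L ^ᴾ d *ᴾ tⁿ-1 1)) z
        ≈⟨ *-congˡ (trans (eval-* (Gp *ᴾ Gq) (tⁿ-1 L ^ᴾ d *ᴾ tⁿ-1 1) z) (*-cong (eval-* Gp Gq z)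
             (trans (eval-* (tⁿ-1 L ^ᴾ d) (tⁿ-1 1) z)
               (*-cong (trans (eval-^ (tⁿ-1 L) d z) (^-congˡ d (eval-tⁿ-1 L z))) (eval-tⁿ-1 1 z))))) ⟩
      (z ^ p - 1#) * (z ^ q - 1#) * (eval Gp z * eval Gq z * ((z ^ L - 1#) ^ d * (z ^ 1 - 1#)))
        ≈⟨ solve 6 (λ P Q gp gq l o → P :* Q :* (gp :* gq :* (l :* o)) := (P :* gp) :* ((Q :* gq) :* l) :* o) refl
             (z ^ p - 1#) (z ^ q - 1#) (eval Gp z) (eval Gq z) ((z ^ L - 1#) ^ d) (z ^ 1 - 1#) ⟩
      (z ^ p - 1#) * eval Gp z * ((z ^ q - 1#) * eval Gq z * (z ^ L - 1#) ^ d) * (z ^ 1 - 1#)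
        ≈⟨ *-congʳ (*-cong (Gp≈ z) (*-congʳ (Gq≈ z))) ⟩
      (z ^ L - 1#) ^ suc (suc d) * (z ^ 1 - 1#) ∎

  alexander-exists : ∀ {p q} → 1 ℕ.≤ gcd p q → ∃ (AlexanderPolynomial p q)
  alexander-exists {p} {q} 1≤d =
    let Δ , Δ≈ = quotient-exists (gcd p q) 1≤d (m∣lcm[m,n] p q) (n∣lcm[m,n] p q)
                   (λ gcd≡1 → ≡.subst (λ d → Bézout.Identity.Identity d p q) gcd≡1 (Bézout.identity (gcd-GCD p q)))
    in Δ , eval⇒alexander {p} {q} {Δ} Δ≈

  IsRootOfUnity : ℕ → Carrier → Set
  IsRootOfUnity n α = α ^ n ≈ 1#

  Order-xⁿ-1 : ∀ {α n} → 1 ℕ.≤ n → Order α (λ x → x ^ n - 1#) (χ (IsRootOfUnity n α))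
  Order-xⁿ-1 {α} {n} 1≤n with em {IsRootOfUnity n α}
  ... | yes αⁿ≈1 = Order-xⁿ-1-root 1≤n αⁿ≈1
  ... | no αⁿ≉1  = Order-xⁿ-1-nonroot {α} {n} αⁿ≉1

  -- For p, q ≥ 1 the subtraction is never truncated.
  multiplicity : ℕ → ℕ → Carrier → ℕ
  multiplicity p q α = (gcd p q ℕ.* χ (IsRootOfUnity (lcm p q) α) ℕ.+ χ (IsRootOfUnity 1 α))
                       ℕ.∸ (χ (IsRootOfUnity p α) ℕ.+ χ (IsRootOfUnity q α))

  module _ {p q} (1≤p : 1 ℕ.≤ p) (1≤q : 1 ℕ.≤ q) (1≤d : 1 ℕ.≤ gcd p q) (1≤L : 1 ℕ.≤ lcm p q) where

    private
      numerator-order : ∀ α → Order α (numerator p q) (gcd p q ℕ.* χ (IsRootOfUnity (lcm p q) α) ℕ.+ χ (IsRootOfUnity 1 α))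
      numerator-order α = Order-* (Order-^ (Order-xⁿ-1 1≤L) (gcd p q)) (Order-xⁿ-1 {α} {1} (ℕ.s≤s ℕ.z≤n))

      denominator-order : ∀ α → Order α (denominator p q) (χ (IsRootOfUnity p α) ℕ.+ χ (IsRootOfUnity q α))
      denominator-order α = Order-* (Order-xⁿ-1 1≤p) (Order-xⁿ-1 1≤q)

    -- Orders add in the equation denominator * Δ = numerator, so the order of Δ is the difference
    -- of the other two. In particular it is the same for every Δ that satisfies the equation.
    alexander-multiplicity : ∀ {α Δ m} → AlexanderPolynomial p q Δ → Order α (eval Δ) m → m ≡.≡ multiplicity p q α
    alexander-multiplicity {α} {Δ} {m} Δ-alex o = ≡.trans
      (≡.sym (ℕₚ.m+n∸m≡n (χ (IsRootOfUnity p α) ℕ.+ χ (IsRootOfUnity q α)) m))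
      (≡.cong (ℕ._∸ (χ (IsRootOfUnity p α) ℕ.+ χ (IsRootOfUnity q α)))
        (Order-unique (Order-cong (alexander⇒eval {p} {q} {Δ} Δ-alex) (Order-* (denominator-order α) o)) (numerator-order α)))

    alexander-nonzero : ∀ {Δ} → AlexanderPolynomial p q Δ → ¬ IsZero Δ
    alexander-nonzero {Δ} Δ-alex Δ≈0 = Order⇒nonzero (numerator-order 1#) λ x →
      trans (sym (alexander⇒eval {p} {q} {Δ} Δ-alex x)) (trans (*-congˡ (eval-zero Δ Δ≈0 x)) (zeroʳ _))

    -- The left side quantifies over Δ. From right to left a Δ must be exhibited, and it must be
    -- nonzero, for otherwise every power of t - α would divide it and no multiplicity would exist.
    root-copy⇔<multiplicity : ∀ {α j} →
      (∃ λ Δ → AlexanderPolynomial p q Δ × ∃ λ m → (α HasMultiplicity m In Δ) × (j ℕ.< m)) ⇔ (j ℕ.< multiplicity p q α)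
    root-copy⇔<multiplicity {α} {j} = mk⇔
      (λ (Δ , Δ-alex , m , α-mult , j<m) → ≡.subst (j ℕ.<_) (alexander-multiplicity {α} {Δ} Δ-alex (HasMultiplicity⇒Order {α} {m} {Δ} α-mult)) j<m)
      (λ j<mult → has-copy j<mult (alexander-exists {p} {q} 1≤d))
      where
      has-copy : j ℕ.< multiplicity p q α → ∃ (AlexanderPolynomial p q) →
        ∃ λ Δ → AlexanderPolynomial p q Δ × ∃ λ m → (α HasMultiplicity m In Δ) × (j ℕ.< m)
      has-copy j<mult (Δ , Δ-alex) = Δ , Δ-alex , copy (Order-exists α (length Δ) Δ ℕₚ.≤-refl (alexander-nonzero {Δ} Δ-alex))
        where
        copy : ∃ (Order α (eval Δ)) → ∃ λ m → (α HasMultiplicity m In Δ) × (j ℕ.< m)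
        copy (m , o) = m , Order⇒HasMultiplicity {α} {m} {Δ} o ,
          ≡.subst (j ℕ.<_) (≡.sym (alexander-multiplicity {α} {Δ} {m} Δ-alex o)) j<mult

  multiplicity-cong : ∀ p q {α β} → α ≈ β → multiplicity p q α ≡.≡ multiplicity p q β
  multiplicity-cong p q {α} {β} α≈β = ≡.cong₂ ℕ._∸_
    (≡.cong₂ ℕ._+_ (≡.cong (gcd p q ℕ.*_) (same (lcm p q))) (same 1)) (≡.cong₂ ℕ._+_ (same p) (same q))
    where
    same : ∀ n → χ (IsRootOfUnity n α) ≡.≡ χ (IsRootOfUnity n β)
    same n = χ-cong (trans (^-congˡ n (sym α≈β))) (trans (^-congˡ n α≈β))

  multiplicity-≤ : ∀ p q α → multiplicity p q α ℕ.≤ gcd p q ℕ.+ χ (IsRootOfUnity 1 α)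
  multiplicity-≤ p q α = ℕₚ.≤-trans (ℕₚ.m∸n≤m _ (χ (IsRootOfUnity p α) ℕ.+ χ (IsRootOfUnity q α)))
    (ℕₚ.+-monoˡ-≤ (χ (IsRootOfUnity 1 α)) (ℕₚ.≤-trans (ℕₚ.*-monoʳ-≤ (gcd p q) (χ≤1 (IsRootOfUnity (lcm p q) α)))
      (ℕₚ.≤-reflexive (ℕₚ.*-identityʳ (gcd p q)))))

  multiplicity-≥ : ∀ p q {α} → IsRootOfUnity (lcm p q) α →
    gcd p q ℕ.≤ multiplicity p q α ℕ.+ (χ (IsRootOfUnity p α) ℕ.+ χ (IsRootOfUnity q α))
  multiplicity-≥ p q {α} root = ℕₚ.≤-trans
    (ℕₚ.≤-trans (ℕₚ.≤-reflexive (≡.sym (≡.trans (≡.cong (gcd p q ℕ.*_) (χ-true root)) (ℕₚ.*-identityʳ (gcd p q)))))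
      (ℕₚ.m≤m+n _ (χ (IsRootOfUnity 1 α))))
    (ℕₚ.≤-trans (ℕₚ.m≤n+m∸n _ b) (ℕₚ.≤-reflexive (ℕₚ.+-comm b _)))
    where b = χ (IsRootOfUnity p α) ℕ.+ χ (IsRootOfUnity q α)

  1^n≈1 : ∀ n → 1# ^ n ≈ 1#
  1^n≈1 zero    = refl
  1^n≈1 (suc n) = trans (*-identityˡ _) (1^n≈1 n)

  -- Away from the L-th roots of unity both terms that the numerator contributes are 0, the second
  -- because 1 is itself an L-th root.
  <multiplicity⇒root : ∀ p q {α j} → j ℕ.< multiplicity p q α → IsRootOfUnity (lcm p q) α
  <multiplicity⇒root p q {α} {j} j<mult = decidable-stable em λ ¬root → (ℕₚ.n≮0 (ℕₚ.<-≤-trans j<mult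
    (ℕₚ.≤-trans (ℕₚ.m∸n≤m _ (χ (IsRootOfUnity p α) ℕ.+ χ (IsRootOfUnity q α)))
    (ℕₚ.≤-reflexive (≡.cong₂ ℕ._+_ (≡.trans (≡.cong (gcd p q ℕ.*_) (χ-false ¬root)) (ℕₚ.*-zeroʳ (gcd p q)))
      (χ-false λ α≈1 → ¬root (trans (^-congˡ (lcm p q) (trans (sym (*-identityʳ α)) α≈1)) (1^n≈1 (lcm p q)))))))))

-- Cardinalities through duplicate-free lists, and lists of dependent pairs.

module FiniteSets where

  module UniqueLists (S : Setoid 0ℓ 0ℓ) where

    open Setoid S
    open Membership S using (_∈_)
    open Uniqueness S using (Unique)
    open Cardinality S

    remove : ∀ {x ys} → x ∈ ys → ∃ λ zs → length ys ≡.≡ suc (length zs) × (∀ {y} → y ∈ ys → ¬ x ≈ y → y ∈ zs)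
    remove {x} {y ∷ ys} (here x≈y) = ys , ≡.refl , λ where
      (here z≈y) x≉z → ⊥-elim (x≉z (trans x≈y (sym z≈y)))
      (there z∈ys) _ → z∈ys
    remove {x} {y ∷ ys} (there x∈ys) = let zs , eq , keep = remove x∈ys in
      y ∷ zs , ≡.cong suc eq , λ where
        (here z≈y) _     → here z≈y
        (there z∈ys) x≉z → there (keep z∈ys x≉z)

    unique-⊆⇒length-≤ : ∀ {xs ys} → Unique xs → (∀ {x} → x ∈ xs → x ∈ ys) → length xs ℕ.≤ length ys
    unique-⊆⇒length-≤ {[]}     _            _     = ℕ.z≤n
    unique-⊆⇒length-≤ {x ∷ xs} (x∉xs ∷ xs!) xs⊆ys = let zs , eq , keep = remove (xs⊆ys (here refl)) in
      ≡.subst (suc (length xs) ℕ.≤_) (≡.sym eq) (ℕ.s≤s (unique-⊆⇒length-≤ xs! λ y∈xs →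
        keep (xs⊆ys (there y∈xs)) λ x≈y → Allₚ.All¬⇒¬Any x∉xs (Any.map (trans x≈y) y∈xs)))

    HasCardinality-unique : ∀ {P m n} → HasCardinality P m → HasCardinality P n → m ≡.≡ n
    HasCardinality-unique (xs , xs! , P⇔xs , ≡.refl) (ys , ys! , P⇔ys , ≡.refl) = ℕₚ.≤-antisym
      (unique-⊆⇒length-≤ xs! λ {x} x∈xs → Equivalence.to (P⇔ys x) (Equivalence.from (P⇔xs x) x∈xs))
      (unique-⊆⇒length-≤ ys! λ {x} x∈ys → Equivalence.to (P⇔xs x) (Equivalence.from (P⇔ys x) x∈ys))

    -- Excluded middle hands `cardinality` some list that is not under control; any two
    -- duplicate-free lists of the same set have equal length, so any explicit enumeration decides
    -- the value.
    cardinality≡ : ∀ (em : ExcludedMiddle 0ℓ) {P n} → HasCardinality P n → cardinality em P ≡.≡ n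
    cardinality≡ em {P} P#n with em {∃ (HasCardinality P)}
    ... | yes (_ , P#m) = HasCardinality-unique P#m P#n
    ... | no ¬P# = ⊥-elim (¬P# (_ , P#n))

  module SigmaLists (S T : Setoid 0ℓ 0ℓ) where

    private
      module S = Setoid S
      module T = Setoid T
    open Membership T using () renaming (_∈_ to _∈ᵀ_)
    open Membership (S ×ₛ T) using (_∈_)

    sigma : List S.Carrier → (S.Carrier → List T.Carrier) → List (S.Carrier × T.Carrier)
    sigma []       ys = []
    sigma (x ∷ xs) ys = map (x ,_) (ys x) ++ sigma xs ys

    length-sigma : ∀ xs ys → length (sigma xs ys) ≡.≡ sum (map (length ∘ ys) xs)
    length-sigma []       ys = ≡.refl
    length-sigma (x ∷ xs) ys = ≡.trans (Listₚ.length-++ (map (x ,_) (ys x)))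
      (≡.cong₂ ℕ._+_ (Listₚ.length-map (x ,_) (ys x)) (length-sigma xs ys))

    -- The second component is sought over the listed representative x′ and not over x, since `ys`
    -- is a plain function on representatives that may give different lists at equal arguments.
    ∈-sigma⁺ : ∀ {xs ys x y} → Any (λ x′ → x S.≈ x′ × y ∈ᵀ ys x′) xs → (x , y) ∈ sigma xs ys
    ∈-sigma⁺ {x′ ∷ xs} {ys} (here (x≈x′ , y∈)) =
      Membershipₚ.∈-++⁺ˡ (S ×ₛ T) (Anyₚ.map⁺ (Any.map (x≈x′ ,_) y∈))
    ∈-sigma⁺ {x′ ∷ xs} {ys} (there any) = Membershipₚ.∈-++⁺ʳ (S ×ₛ T) (map (x′ ,_) (ys x′)) (∈-sigma⁺ any)

    ∈-sigma⁻ : ∀ xs ys {x y} → (x , y) ∈ sigma xs ys → Any (λ x′ → x S.≈ x′ × y ∈ᵀ ys x′) xs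
    ∈-sigma⁻ (x′ ∷ xs) ys x,y∈ with Membershipₚ.∈-++⁻ (S ×ₛ T) (map (x′ ,_) (ys x′)) x,y∈
    ... | inj₂ x,y∈ = there (∈-sigma⁻ xs ys x,y∈)
    ... | inj₁ x,y∈ with Anyₚ.map⁻ x,y∈
    ...   | any = here (proj₁ (proj₂ (Any.satisfied any)) , Any.map proj₂ any)

    sigma-unique : ∀ {xs ys} → Uniqueness.Unique S xs → (∀ x → Uniqueness.Unique T (ys x)) →
      Uniqueness.Unique (S ×ₛ T) (sigma xs ys)
    sigma-unique {[]}     _            ys! = []
    sigma-unique {x ∷ xs} {ys} (x∉xs ∷ xs!) ys! = Uniqueₚ.++⁺ (S ×ₛ T)
      (Uniqueₚ.map⁺ T (S ×ₛ T) proj₂ (ys! x)) (sigma-unique xs! ys!)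
      λ (∈map , ∈sigma) → Allₚ.All¬⇒¬Any x∉xs (Any.map
        (λ (x″≈x′ , _) → S.trans (S.sym (proj₁ (proj₂ (Any.satisfied (Anyₚ.map⁻ ∈map))))) x″≈x′)
        (∈-sigma⁻ xs ys ∈sigma))

-- The L-th roots of unity and how many of them lie on an arc.

module RootsOnArc (em : ExcludedMiddle 0ℓ) (R : RealField) (π : RealField.Carrier R)
              (isPi : Analysis.IsPi R π) where

  open RealField R renaming (Carrier to ℝ)
  open Analysis R
  open TorusLinks em R π
  open IntegerRingSolver commutativeRing
    using (solve; _:=_; _:+_; _:*_; _:-_; :-_; :0; :1)
  open Indicator em
  open OrderedField em R
  open Complex em R
  open Exponential em R using (IsExp-resp)
  open Circle em R π isPi
  open PolynomialFunctions em ℂ-commutativeRing ℂ-domain using (roots-of-unity-≤)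
  open TorusPolynomial em ℂ-commutativeRing ℂ-domain using (IsRootOfUnity)
  open ≤-Reasoning ≤-poset
  open Membership ℂ-setoid using (_∈_)
  open Uniqueness ℂ-setoid using (Unique)

  OnArc⇒e : ∀ {a b α} → OnArc a b α → ∃ λ θ → a ≤ θ × θ ≤ b × e θ ≈ᶜ α
  OnArc⇒e (θ , a≤θ , θ≤b , isExp) = θ , a≤θ , θ≤b , IsExp⇒e isExp

  e⇒OnArc : ∀ {a b α θ} → a ≤ θ → θ ≤ b → e θ ≈ᶜ α → OnArc a b α
  e⇒OnArc {α = α} {θ = θ} a≤θ θ≤b eθ≈α = θ , a≤θ , θ≤b , IsExp-resp ℂ.refl eθ≈α (e-isExp θ)

  OnArc-resp : ∀ {a b α β} → α ≈ᶜ β → OnArc a b α → OnArc a b β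
  OnArc-resp α≈β onArc = let θ , a≤θ , θ≤b , eθ≈α = OnArc⇒e onArc in e⇒OnArc a≤θ θ≤b (ℂ.trans eθ≈α α≈β)

  module Roots (L : ℕ) where

    angle : ℕ → ℝ
    angle k = ι k * ι L ⁻¹

    ζ : ℕ → ℂ
    ζ k = e (angle k)

    allRoots : List ℂ
    allRoots = applyDownFrom ζ L

    arcRoots : ℝ → ℝ → List ℂ
    arcRoots a b = filter (λ α → em {OnArc a b α}) allRoots

  module _ (L : ℕ) (1≤L : 1 ℕ.≤ L) where

    open Roots L

    0<L⁻¹ : 0# < ι L ⁻¹
    0<L⁻¹ = ⁻¹-pos (0<ι′ 1≤L)

    L*angle : ∀ k → ι L * angle k ≈ ι k
    L*angle k = trans (solve 3 (λ l k i → l :* (k :* i) := k :* (l :* i)) refl (ι L) (ι k) (ι L ⁻¹))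
      (trans (*-congˡ (*-inverseʳ (ι L) (0<⇒≉0 (0<ι′ 1≤L)))) (*-identityʳ (ι k)))

    0≤angle : ∀ k → 0# ≤ angle k
    0≤angle k = *-nonNeg (0≤ι k) (<⇒≤ 0<L⁻¹)

    angle-mono : ∀ {j k} → j ℕ.≤ k → angle j ≤ angle k
    angle-mono j≤k = *-monoʳ-≤ (<⇒≤ 0<L⁻¹) (ι-mono j≤k)

    angle<1 : ∀ {k} → k ℕ.< L → angle k < 1#
    angle<1 {k} k<L = ≰⇒> λ 1≤angle → <⇒≱ (ι-mono-< k<L) (begin
      ι L               ≈⟨ *-identityʳ (ι L) ⟨
      ι L * 1#          ≤⟨ *-monoˡ-≤ (0≤ι L) 1≤angle ⟩
      ι L * angle k     ≈⟨ L*angle k ⟩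
      ι k               ∎)

    angle-injective : ∀ {j k} → angle j ≈ angle k → ι j ≈ ι k
    angle-injective {j} {k} eq = trans (sym (L*angle j)) (trans (*-congˡ eq) (L*angle k))

    ζ-root : ∀ k → IsRootOfUnity L (ζ k)
    ζ-root k = ℂ.trans (e-^ (angle k) L) (ℂ.trans (e-cong (L*angle k)) (e-ι k))

    allRoots-unique : Unique allRoots
    allRoots-unique = Uniqueₚ.applyDownFrom⁺₁ ℂ-setoid ζ L λ {i} {j} j<i i<L ζi≈ζj →
      proj₂ (ι-mono-< j<i) (sym (angle-injective {i} {j}
        (e-injective (0≤angle i) (angle<1 i<L) (0≤angle j) (angle<1 (ℕₚ.<-trans j<i i<L)) ζi≈ζj)))

    -- A root outside the list would, together with the L distinct roots in it, give L + 1 roots of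
    -- t^L - 1.
    allRoots-complete : ∀ {α} → IsRootOfUnity L α → α ∈ allRoots
    allRoots-complete {α} α-root = decidable-stable em λ α∉ → ℕₚ.<-irrefl ≡.refl
      (≡.subst (ℕ._< L) (Listₚ.length-applyDownFrom ζ L) (roots-of-unity-≤ (α ∷ allRoots) 1≤L
        (Allₚ.¬Any⇒All¬ allRoots α∉ ∷ allRoots-unique)
        (α-root ∷ Allₚ.applyDownFrom⁺₂ ζ L ζ-root)))

    module Arc {a b : ℝ} (0≤a : 0# ≤ a) (a≤b : a ≤ b) (b≤1 : b ≤ 1#) where

      arcRoots-unique : Unique (arcRoots a b)
      arcRoots-unique = Uniqueₚ.filter⁺ ℂ-setoid (λ α → em {OnArc a b α}) allRoots-unique

      arcRoots-root : All (IsRootOfUnity L) (arcRoots a b)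
      arcRoots-root = Allₚ.filter⁺ (λ α → em {OnArc a b α}) (Allₚ.applyDownFrom⁺₂ ζ L ζ-root)

      arcRoots-onArc : All (OnArc a b) (arcRoots a b)
      arcRoots-onArc = Allₚ.all-filter (λ α → em {OnArc a b α}) allRoots

      ∈arcRoots : ∀ {α} → IsRootOfUnity L α → OnArc a b α → α ∈ arcRoots a b
      ∈arcRoots α-root α-arc = Membershipₚ.∈-filter⁺ ℂ-setoid (λ α → em {OnArc a b α}) OnArc-resp
        (allRoots-complete α-root) α-arc

      -- The indices in `Inside` need not start at 0, but those in `Below` and `UpTo` form initial
      -- segments, and the first is contained in the second because a ≤ b. So `Inside` is counted as
      -- their difference.
      Inside Below UpTo : ℕ → Set
      Inside k = a ≤ angle k × angle k ≤ b
      Below  k = angle k < a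
      UpTo   k = angle k ≤ b

      -- A parameter θ < 1 of ζ k equals k/L by injectivity on [0,1). The remaining parameter θ = 1
      -- gives ζ k = 1 and hence k = 0, which has to be excluded: for a > 0 and b = 1 the point 1 is
      -- on the arc while the angle 0 is not in [a,b].
      arc⇒inside : ∀ k → k ℕ.< L → ¬ k ≡.≡ 0 → OnArc a b (ζ k) → Inside k
      arc⇒inside k k<L k≢0 onArc with OnArc⇒e onArc
      ... | θ , a≤θ , θ≤b , eθ≈ζ with ≤-or-> 1# θ
      ...   | inj₂ θ<1 = ≤-respʳ θ≈ a≤θ , ≤-respˡ θ≈ θ≤b
        where θ≈ = e-injective (≤-trans 0≤a a≤θ) θ<1 (0≤angle k) (angle<1 k<L) eθ≈ζ
      ...   | inj₁ 1≤θ = ⊥-elim (proj₂ (ι-mono-< (ℕₚ.n≢0⇒n>0 k≢0)) (trans (sym (zeroʳ (ι L))) (trans (*-congˡ (sym angle≈0)) (L*angle k))))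
        where
        angle≈0 : angle k ≈ 0#
        angle≈0 = e-kernel (0≤angle k) (angle<1 k<L)
          (ℂ.trans (ℂ.sym eθ≈ζ) (ℂ.trans (e-cong (antisym (≤-trans θ≤b b≤1) 1≤θ)) e-1))

      inside⇒arc : ∀ k → Inside k → OnArc a b (ζ k)
      inside⇒arc k (a≤ , ≤b) = e⇒OnArc a≤ ≤b ℂ.refl

      -- The count c is the first index that fails and c - 1 the last that holds, so (c - 1)/L ≤ v ≤
      -- c/L. The bounds on v take care of the extremes: v ≤ 1 when no index fails, 0 ≤ v when none
      -- holds.
      count-bounds : ∀ {Q v} → 0# ≤ v → v ≤ 1# → (∀ {j k} → j ℕ.≤ k → Q k → Q j) →
        (∀ k → Q k → angle k ≤ v) → (∀ k → ¬ Q k → v ≤ angle k) →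
        ι L * v ≤ ι (count Q L) × ι (count Q L) ≤ 1# + ι L * v
      count-bounds {Q} {v} 0≤v v≤1 down below above = lower , upper (count Q L) ≡.refl
        where
        lower : ι L * v ≤ ι (count Q L)
        lower with count Q L ℕₚ.<? L
        ... | yes c<L = ≤-respʳ (L*angle (count Q L)) (*-monoˡ-≤ (0≤ι L) (above _ (count-missed down L c<L)))
        ... | no c≮L  = ≤-trans (≤-respʳ (*-identityʳ (ι L)) (*-monoˡ-≤ (0≤ι L) v≤1)) (ι-mono (ℕₚ.≮⇒≥ c≮L))
        upper : ∀ c → count Q L ≡.≡ c → ι c ≤ 1# + ι L * v
        upper zero    eq = +-nonneg 0≤1 (*-nonNeg (0≤ι L) 0≤v)
        upper (suc c) eq = +-mono-≤ ≤-refl (≤-respˡ (L*angle c) (*-monoˡ-≤ (0≤ι L) (below c (last-counted down L c eq))))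

      below+inside : ∀ k → χ (Below k) ℕ.+ χ (Inside k) ≡.≡ χ (UpTo k)
      below+inside k with ≤-or-> a (angle k)
      ... | inj₁ a≤ = ≡.trans (≡.cong (ℕ._+ χ (Inside k)) (χ-false λ <a → <⇒≱ <a a≤)) (χ-cong proj₂ (a≤ ,_))
      ... | inj₂ <a = ≡.trans (≡.cong₂ ℕ._+_ (χ-true <a) (χ-false {Inside k} λ (a≤ , _) → <⇒≱ <a a≤))
                        (≡.sym (χ-true (≤-trans (<⇒≤ <a) a≤b)))

      0≤b = ≤-trans 0≤a a≤b

      inside-bounds : ι L * (b - a) ≤ 1# + ι (count Inside L) × ι (count Inside L) ≤ 1# + ι L * (b - a)
      inside-bounds =
        ≤-from-difference (+-nonneg (0≤y-x (proj₁ upTo)) (0≤y-x (proj₂ below)))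
          (trans (+-congʳ (+-congʳ (sym total≈)))
            (solve 5 (λ l a b c d → ((c :+ d) :- l :* b) :+ (:1 :+ l :* a :- c) := (:1 :+ d) :- l :* (b :- a)) refl (ι L) a b (ι C) (ι D))) ,
        ≤-from-difference (+-nonneg (0≤y-x (proj₁ below)) (0≤y-x (proj₂ upTo)))
          (trans (+-congˡ (+-congˡ (-‿cong (sym total≈))))
            (solve 5 (λ l a b c d → (c :- l :* a) :+ (:1 :+ l :* b :- (c :+ d)) := (:1 :+ l :* (b :- a)) :- d) refl (ι L) a b (ι C) (ι D)))
        where
        C = count Below L
        D = count Inside L
        below = count-bounds {Below} 0≤a (≤-trans a≤b b≤1)
          (λ j≤k <a → ≤-<-trans (angle-mono j≤k) <a) (λ k → <⇒≤) (λ k → ≮⇒≥)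
        upTo = count-bounds {UpTo} 0≤b b≤1
          (λ j≤k ≤b → ≤-trans (angle-mono j≤k) ≤b) (λ k ≤b → ≤b) (λ k ≰b → <⇒≤ (≰⇒> ≰b))
        total≈ : ι C + ι D ≈ ι (count UpTo L)
        total≈ = trans (sym (ι-+ C D)) (reflexive (≡.cong ι (count-+ L below+inside)))

      length-arcRoots : length (arcRoots a b) ≡.≡ count (OnArc a b ∘ ζ) L
      length-arcRoots = length-filter-applyDownFrom (OnArc a b) ζ L

      arcRoots-length-≥ : ι L * (b - a) ≤ 1# + ι (length (arcRoots a b))
      arcRoots-length-≥ = ≤-trans (proj₁ inside-bounds) (+-mono-≤ ≤-refl (ι-mono
        (≡.subst (count Inside L ℕ.≤_) (≡.sym length-arcRoots) (count-mono L λ k _ → inside⇒arc k))))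

      -- One unit is the rounding in `inside-bounds`, the other is the root 1, which the arc may
      -- reach through the parameter 1.
      arcRoots-length-≤ : ι (length (arcRoots a b)) ≤ 1# + (1# + ι L * (b - a))
      arcRoots-length-≤ = ≤-trans (ι-mono (≡.subst (ℕ._≤ suc (count Inside L)) (≡.sym length-arcRoots)
        (count-except-0 L arc⇒inside))) (+-mono-≤ ≤-refl (proj₂ inside-bounds))

-- The count for a single link and its sum over all links.

module LinkCount (em : ExcludedMiddle 0ℓ) (R : RealField) (π : RealField.Carrier R)
              (isPi : Analysis.IsPi R π) where

  open RealField R renaming (Carrier to ℝ)
  open Analysis R
  open IntegerRingSolver commutativeRing
    using (solve; _:=_; _:+_; _:*_; _:-_; :-_; :0; :1)
  open Indicator em
  open OrderedField em R
  open Complex em R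
  open PolynomialFunctions em ℂ-commutativeRing ℂ-domain using (roots-of-unity-≤)
  open TorusPolynomial em ℂ-commutativeRing ℂ-domain
    using (IsRootOfUnity; multiplicity; multiplicity-≤; multiplicity-≥)
  open RootsOnArc em R π isPi
  open ≤-Reasoning ≤-poset
  open Uniqueness ℂ-setoid using (Unique)

  gcd≥1 : ∀ {p} q → 1 ℕ.≤ p → 1 ℕ.≤ gcd p q
  gcd≥1 {p} q 1≤p = ℕₚ.n≢0⇒n>0 (gcd[m,n]≢0 p q (inj₁ (ℕₚ.>⇒≢ 1≤p)))

  lcm≥1 : ∀ {p q} → 1 ℕ.≤ p → 1 ℕ.≤ q → 1 ℕ.≤ lcm p q
  lcm≥1 {p} {q} 1≤p 1≤q = ℕₚ.n≢0⇒n>0 λ lcm≡0 → ℕₚ.<-irrefl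
    (≡.trans (≡.sym (ℕₚ.*-zeroʳ (gcd p q))) (≡.trans (≡.cong (gcd p q ℕ.*_) (≡.sym lcm≡0)) (gcd*lcm p q)))
    (ℕₚ.*-mono-≤ 1≤p 1≤q)

  gcd≤ˡ : ∀ {p} q → 1 ℕ.≤ p → gcd p q ℕ.≤ p
  gcd≤ˡ {p@(suc _)} q _ = ∣⇒≤ (gcd[m,n]∣m p q)

  Σroots≤ : ∀ {n} xs → 1 ℕ.≤ n → Unique xs → sum (map (χ ∘ IsRootOfUnity n) xs) ℕ.≤ n
  Σroots≤ {n} xs 1≤n xs! = ≡.subst (ℕ._≤ n) (≡.sym (sum-χ (IsRootOfUnity n) xs))
    (roots-of-unity-≤ _ 1≤n (Uniqueₚ.filter⁺ ℂ-setoid (λ α → em {IsRootOfUnity n α}) xs!)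
      (Allₚ.all-filter (λ α → em {IsRootOfUnity n α}) xs))

  Σmultiplicity : ℕ → ℕ → List ℂ → ℕ
  Σmultiplicity p q xs = sum (map (multiplicity p q) xs)

  Σmultiplicity-≤ : ∀ p q {xs} → Unique xs → Σmultiplicity p q xs ℕ.≤ length xs ℕ.* gcd p q ℕ.+ 1
  Σmultiplicity-≤ p q {xs} xs! = ℕₚ.≤-trans (sum-mono (All.universal (multiplicity-≤ p q) xs))
    (≡.subst (ℕ._≤ length xs ℕ.* gcd p q ℕ.+ 1)
      (≡.sym (≡.trans (sum-+ (λ _ → gcd p q) (χ ∘ IsRootOfUnity 1) xs) (≡.cong (ℕ._+ sum (map (χ ∘ IsRootOfUnity 1) xs)) (sum-const (gcd p q) xs))))
      (ℕₚ.+-monoʳ-≤ (length xs ℕ.* gcd p q) (Σroots≤ xs (ℕ.s≤s ℕ.z≤n) xs!)))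

  Σmultiplicity-≥ : ∀ {p q xs} → 1 ℕ.≤ p → 1 ℕ.≤ q → Unique xs → All (IsRootOfUnity (lcm p q)) xs →
    length xs ℕ.* gcd p q ℕ.≤ Σmultiplicity p q xs ℕ.+ (p ℕ.+ q)
  Σmultiplicity-≥ {p} {q} {xs} 1≤p 1≤q xs! roots = ≡.subst (ℕ._≤ Σmultiplicity p q xs ℕ.+ (p ℕ.+ q)) (sum-const (gcd p q) xs)
    (ℕₚ.≤-trans (sum-mono (All.map (multiplicity-≥ p q) roots))
    (≡.subst (ℕ._≤ Σmultiplicity p q xs ℕ.+ (p ℕ.+ q))
      (≡.sym (≡.trans (sum-+ (multiplicity p q) _ xs)
        (≡.cong (Σmultiplicity p q xs ℕ.+_) (sum-+ (χ ∘ IsRootOfUnity p) (χ ∘ IsRootOfUnity q) xs))))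
      (ℕₚ.+-monoʳ-≤ (Σmultiplicity p q xs) (ℕₚ.+-mono-≤ (Σroots≤ xs 1≤p xs!) (Σroots≤ xs 1≤q xs!)))))

  arcCount : ℝ → ℝ → ℕ → ℕ → ℕ
  arcCount a b p q = Σmultiplicity p q (Roots.arcRoots (lcm p q) a b)

  module _ {a b : ℝ} (0≤a : 0# ≤ a) (a≤b : a ≤ b) (b≤1 : b ≤ 1#) where

    -- The main term d L (b - a) is (b - a) p q because gcd times lcm is the product. The excess is
    -- at most 2d + 1: two roots of multiplicity d, and the extra factor t - 1. The deficit is at
    -- most d + p + q: one root, and the two factors of the denominator. Since d ≤ p ≤ N and 1 ≤ N,
    -- either is at most 3N.
    arcCount-approx : ∀ {p q N} → 1 ℕ.≤ p → 1 ℕ.≤ q → p ℕ.≤ N → q ℕ.≤ N →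
      ∣ ι (arcCount a b p q) - (b - a) * ι p * ι q ∣ ≤ ι 3 * ι N
    arcCount-approx {p} {q} {N} 1≤p 1≤q p≤N q≤N = bounds
      (ι-mono (Σmultiplicity-≤ p q arcRoots-unique)) (ι-mono (Σmultiplicity-≥ 1≤p 1≤q arcRoots-unique arcRoots-root))
      where
      L = lcm p q
      d = gcd p q
      open Arc L (lcm≥1 1≤p 1≤q) 0≤a a≤b b≤1
      A = length (Roots.arcRoots L a b)
      M = arcCount a b p q
      1≤N : 1# ≤ ι N
      1≤N = ≤-respˡ (+-identityʳ 1#) (ι-mono (ℕₚ.≤-trans 1≤p p≤N))
      d≤N : ι d ≤ ι N
      d≤N = ι-mono (ℕₚ.≤-trans (gcd≤ˡ q 1≤p) p≤N)
      dL≈pq : ι d * ι L ≈ ι p * ι q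
      dL≈pq = trans (sym (ι-* d L)) (trans (reflexive (≡.cong ι (gcd*lcm p q))) (ι-* p q))
      main : (b - a) * ι p * ι q ≈ ι d * (ι L * (b - a))
      main = trans (*-assoc _ _ _) (trans (*-congˡ (sym dL≈pq))
        (solve 3 (λ c d l → c :* (d :* l) := d :* (l :* c)) refl (b - a) (ι d) (ι L)))
      bounds : ι M ≤ ι (A ℕ.* d ℕ.+ 1) → ι (A ℕ.* d) ≤ ι (M ℕ.+ (p ℕ.+ q)) → ∣ ι M - (b - a) * ι p * ι q ∣ ≤ ι 3 * ι N
      bounds upper lower = ∣∣-lub
        (begin
          ι M - (b - a) * ι p * ι q
            ≤⟨ +-mono-≤ (≤-trans upper (≤-reflexive (trans (ι-+ (A ℕ.* d) 1) (+-congʳ (ι-* A d))))) (≤-reflexive (-‿cong main)) ⟩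
          ι A * ι d + ι 1 - ι d * (ι L * (b - a))
            ≤⟨ ≤-from-difference (*-nonNeg (0≤ι d) (0≤y-x arcRoots-length-≤))
                 (solve 3 (λ A d x → d :* ((:1 :+ (:1 :+ x)) :- A) := (d :+ d :+ :1) :- (A :* d :+ (:1 :+ :0) :- d :* x)) refl (ι A) (ι d) (ι L * (b - a))) ⟩
          ι d + ι d + 1#
            ≤⟨ +-mono-≤ (+-mono-≤ d≤N d≤N) 1≤N ⟩
          ι N + ι N + ι N
            ≈⟨ solve 1 (λ n → n :+ n :+ n := (:1 :+ (:1 :+ (:1 :+ :0))) :* n) refl (ι N) ⟩
          ι 3 * ι N ∎)
        (begin
          - (ι M - (b - a) * ι p * ι q)
            ≈⟨ trans (-‿cong (+-congˡ (-‿cong main))) (solve 2 (λ m x → :- (m :- x) := x :- m) refl _ _) ⟩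
          ι d * (ι L * (b - a)) - ι M
            ≤⟨ +-mono-≤ (*-monoˡ-≤ (0≤ι d) arcRoots-length-≥) ≤-refl ⟩
          ι d * (1# + ι A) - ι M
            ≤⟨ ≤-from-difference (0≤y-x (≤-respˡ (ι-* A d) (≤-respʳ (trans (ι-+ M (p ℕ.+ q)) (+-congˡ (ι-+ p q))) lower)))
                 (solve 5 (λ A d m p q → (m :+ (p :+ q)) :- A :* d := (d :+ p :+ q) :- (d :* (:1 :+ A) :- m)) refl (ι A) (ι d) (ι M) (ι p) (ι q)) ⟩
          ι d + ι p + ι q
            ≤⟨ +-mono-≤ (+-mono-≤ d≤N (ι-mono p≤N)) (ι-mono q≤N) ⟩
          ι N + ι N + ι N
            ≈⟨ solve 1 (λ n → n :+ n :+ n := (:1 :+ (:1 :+ (:1 :+ :0))) :* n) refl (ι N) ⟩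
          ι 3 * ι N ∎)

  -- The main term (b - a) p q separates in p and q, so its sum over the square is (b - a) times the
  -- square of this number.
  triangular : ℕ → ℝ
  triangular zero    = 0#
  triangular (suc n) = ι (suc n) + triangular n

  2*triangular : ∀ n → (1# + 1#) * triangular n ≈ ι n * ι (suc n)
  2*triangular zero    = solve 0 ((:1 :+ :1) :* :0 := :0 :* (:1 :+ :0)) refl
  2*triangular (suc n) = trans (distribˡ _ _ _) (trans (+-congˡ (2*triangular n))
    (solve 1 (λ n → (:1 :+ :1) :* (:1 :+ n) :+ n :* (:1 :+ n) := (:1 :+ n) :* (:1 :+ (:1 :+ n))) refl (ι n)))

  range : ℕ → List ℕ
  range = applyDownFrom suc

  -- Applied twice: to the inner sum over q with slope (b - a) p and error 3N, then to the outer sum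
  -- over p with slope (b - a) times `triangular N` and error 3N².
  sum-range-approx : ∀ {F : ℕ → ℕ} {c B} N → (∀ k → 1 ℕ.≤ k → k ℕ.≤ N → ∣ ι (F k) - c * ι k ∣ ≤ B) →
    ∣ ι (sum (map F (range N))) - c * triangular N ∣ ≤ ι N * B
  sum-range-approx {c = c} {B} zero    approx = ≤-reflexive (trans
    (∣∣-cong (solve 1 (λ c → :0 :- c :* :0 := :0) refl c))
    (trans (∣∣-nonneg ≤-refl) (sym (zeroˡ B))))
  sum-range-approx {F} {c} {B} (suc n) approx = begin
    ∣ ι (F (suc n) ℕ.+ S) - c * (ι (suc n) + T) ∣
      ≈⟨ ∣∣-cong (trans (+-congʳ (ι-+ (F (suc n)) S))
           (solve 5 (λ f s c k t → (f :+ s) :- c :* (k :+ t) := (f :- c :* k) :+ (s :- c :* t)) refl (ι (F (suc n))) (ι S) c (ι (suc n)) T)) ⟩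
    ∣ (ι (F (suc n)) - c * ι (suc n)) + (ι S - c * T) ∣
      ≤⟨ ∣∣-triangle _ _ ⟩
    ∣ ι (F (suc n)) - c * ι (suc n) ∣ + ∣ ι S - c * T ∣
      ≤⟨ +-mono-≤ (approx (suc n) (ℕ.s≤s ℕ.z≤n) ℕₚ.≤-refl)
                  (sum-range-approx n λ k 1≤k k≤n → approx k 1≤k (ℕₚ.m≤n⇒m≤1+n k≤n)) ⟩
    B + ι n * B
      ≈⟨ solve 2 (λ n B → B :+ n :* B := (:1 :+ n) :* B) refl (ι n) B ⟩
    ι (suc n) * B ∎
    where
    S = sum (map F (range n))
    T = triangular n

  totalCount : ℝ → ℝ → ℕ → ℕ
  totalCount a b N = sum (map (λ p → sum (map (arcCount a b p) (range N))) (range N))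

  totalCount-approx : ∀ {a b} → 0# ≤ a → a ≤ b → b ≤ 1# → ∀ N →
    ∣ ι (totalCount a b N) - (b - a) * triangular N * triangular N ∣ ≤ ι N * (ι N * (ι 3 * ι N))
  totalCount-approx {a} {b} 0≤a a≤b b≤1 N = sum-range-approx N λ p 1≤p p≤N →
    ≤-respˡ (∣∣-cong (+-congˡ (-‿cong (solve 3 (λ c p t → c :* p :* t := c :* t :* p) refl (b - a) (ι p) (triangular N)))))
    (sum-range-approx N λ q 1≤q q≤N → arcCount-approx 0≤a a≤b b≤1 1≤p 1≤q p≤N q≤N)

-- A duplicate-free enumeration of the pairs of a link and a root.

module Enumeration (em : ExcludedMiddle 0ℓ) (R : RealField) (π : RealField.Carrier R)
              (isPi : Analysis.IsPi R π) where

  open RealField R renaming (Carrier to ℝ)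
  open Analysis R
  open TorusLinks em R π
  open Cardinality Item using (HasCardinality)
  open FiniteSets
  open OrderedField em R
  open Complex em R
  open TorusPolynomial em ℂ-commutativeRing ℂ-domain
    using (multiplicity; multiplicity-cong; root-copy⇔<multiplicity; <multiplicity⇒root)
  open RootsOnArc em R π isPi
  open LinkCount em R π isPi
  open Membership Item using (_∈_)

  private
    ℕ-setoid Copies Fibre : Setoid 0ℓ 0ℓ
    ℕ-setoid = ≡.setoid ℕ
    Copies   = ℂ-setoid ×ₛ ℕ-setoid
    Fibre    = ℕ-setoid ×ₛ Copies

  open SigmaLists ℂ-setoid ℕ-setoid using () renaming
    (sigma to sigma₃; length-sigma to length-sigma₃; ∈-sigma⁺ to ∈-sigma₃⁺; ∈-sigma⁻ to ∈-sigma₃⁻; sigma-unique to sigma₃-unique)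
  open SigmaLists ℕ-setoid Copies using () renaming
    (sigma to sigma₂; length-sigma to length-sigma₂; ∈-sigma⁺ to ∈-sigma₂⁺; ∈-sigma⁻ to ∈-sigma₂⁻; sigma-unique to sigma₂-unique)
  open SigmaLists ℕ-setoid Fibre using () renaming
    (sigma to sigma₁; length-sigma to length-sigma₁; ∈-sigma⁺ to ∈-sigma₁⁺; ∈-sigma⁻ to ∈-sigma₁⁻; sigma-unique to sigma₁-unique)

  IsAlexanderRootCopy : ℕ → ℕ → ℂ → ℕ → Set
  IsAlexanderRootCopy p q α j =
    ∃ λ Δ → IsAlexanderPolynomial p q Δ × ∃ λ m → (α HasMultiplicity m In Δ) × (j ℕ.< m)
    where open Polynomial ℂ-ring

  copy⇔ : ∀ {p q α j} → 1 ℕ.≤ p → 1 ℕ.≤ q → IsAlexanderRootCopy p q α j ⇔ (j ℕ.< multiplicity p q α)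
  copy⇔ {p} {q} {α} {j} 1≤p 1≤q = root-copy⇔<multiplicity 1≤p 1≤q (gcd≥1 q 1≤p) (lcm≥1 1≤p 1≤q) {α} {j}

  range-unique : ∀ N → Uniqueness.Unique ℕ-setoid (range N)
  range-unique N = Uniqueₚ.applyDownFrom⁺₁ ℕ-setoid suc N λ j<i _ eq → ℕₚ.<⇒≢ j<i (≡.sym (ℕₚ.suc-injective eq))

  range⁺ : ∀ {P : ℕ → Set} {k N} → 1 ℕ.≤ k → k ℕ.≤ N → P k → Any P (range N)
  range⁺ {k = suc i} _ i<N pk = Anyₚ.applyDownFrom⁺ suc pk i<N

  range⁻ : ∀ {P : ℕ → Set} {N} → Any P (range N) → ∃ λ k → 1 ℕ.≤ k × k ℕ.≤ N × P k
  range⁻ any = let i , i<N , pi = Anyₚ.applyDownFrom⁻ suc any in suc i , ℕ.s≤s ℕ.z≤n , i<N , pi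

  module _ {a b : ℝ} (0≤a : 0# ≤ a) (a≤b : a ≤ b) (b≤1 : b ≤ 1#) where

    copies : ℕ → ℕ → List (ℂ × ℕ)
    copies p q = sigma₃ (Roots.arcRoots (lcm p q) a b) λ α → downFrom (multiplicity p q α)

    fibre : ℕ → ℕ → List (ℕ × ℂ × ℕ)
    fibre N p = sigma₂ (range N) (copies p)

    items : ℕ → List (ℕ × ℕ × ℂ × ℕ)
    items N = sigma₁ (range N) (fibre N)

    length-copies : ∀ p q → length (copies p q) ≡.≡ arcCount a b p q
    length-copies p q = ≡.trans (length-sigma₃ arc (downFrom ∘ multiplicity p q))
      (≡.cong sum (Listₚ.map-cong (λ α → Listₚ.length-downFrom (multiplicity p q α)) arc))
      where arc = Roots.arcRoots (lcm p q) a b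

    length-items : ∀ N → length (items N) ≡.≡ totalCount a b N
    length-items N = ≡.trans (length-sigma₁ (range N) (fibre N)) (≡.cong sum (Listₚ.map-cong (λ p →
      ≡.trans (length-sigma₂ (range N) (copies p)) (≡.cong sum (Listₚ.map-cong (length-copies p) (range N)))) (range N)))

    -- `sigma-unique` asks for uniqueness over all p and q, also those outside the range, whose lcm
    -- may be 0; then the list of roots is empty.
    arcRoots-unique′ : ∀ L → Uniqueness.Unique ℂ-setoid (Roots.arcRoots L a b)
    arcRoots-unique′ zero    = []
    arcRoots-unique′ (suc L) = Arc.arcRoots-unique (suc L) (ℕ.s≤s ℕ.z≤n) 0≤a a≤b b≤1

    items-unique : ∀ N → Uniqueness.Unique Item (items N)
    items-unique N = sigma₁-unique (range-unique N) λ p → sigma₂-unique (range-unique N) λ q →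
      sigma₃-unique (arcRoots-unique′ (lcm p q)) λ α → Unique≡.downFrom⁺ (multiplicity p q α)

    module _ {X N} (N≤X : ι N ≤ X) (X<1+N : X < ι (suc N)) where

      ≤X⇒≤N : ∀ {p} → ι p ≤ X → p ℕ.≤ N
      ≤X⇒≤N ιp≤X = ℕₚ.≤-pred (ι-cancel-< (≤-<-trans ιp≤X X<1+N))

      ≤N⇒≤X : ∀ {p} → p ℕ.≤ N → ι p ≤ X
      ≤N⇒≤X p≤N = ≤-trans (ι-mono p≤N) N≤X

      Ω⇒∈ : ∀ {p q α j} → Ω[ a , b ] X (p , q , α , j) → (p , q , α , j) ∈ items N
      Ω⇒∈ {p} {q} {α} {j} (((1≤p , ιp≤X) , (1≤q , ιq≤X) , copy) , onArc) =
        ∈-sigma₁⁺ (range⁺ 1≤p (≤X⇒≤N ιp≤X) (≡.refl ,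
        ∈-sigma₂⁺ (range⁺ 1≤q (≤X⇒≤N ιq≤X) (≡.refl ,
        -- The list contains some β equal to α as a complex number; the label j is below the
        -- multiplicity of β because multiplicities respect this equality.
        ∈-sigma₃⁺ (Any.map (λ {β} α≈β → α≈β , ∈-downFrom⁺ (≡.subst (j ℕ.<_) (multiplicity-cong p q α≈β) j<mult))
          (Arc.∈arcRoots (lcm p q) (lcm≥1 1≤p 1≤q) 0≤a a≤b b≤1 (<multiplicity⇒root p q j<mult) onArc))))))
        where
        j<mult : j ℕ.< multiplicity p q α
        j<mult = Equivalence.to (copy⇔ 1≤p 1≤q) copy

      ∈⇒Ω : ∀ {p q α j} → (p , q , α , j) ∈ items N → Ω[ a , b ] X (p , q , α , j)
      ∈⇒Ω {p} {q} {α} {j} ∈items with range⁻ (∈-sigma₁⁻ (range N) (fibre N) ∈items)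
      ... | .p , 1≤p , p≤N , ≡.refl , ∈fibre with range⁻ (∈-sigma₂⁻ (range N) (copies p) ∈fibre)
      ...   | .q , 1≤q , q≤N , ≡.refl , ∈copies =
        ((1≤p , ≤N⇒≤X p≤N) , (1≤q , ≤N⇒≤X q≤N) , Equivalence.from (copy⇔ 1≤p 1≤q) j<mult) , onArc
        where
        any = ∈-sigma₃⁻ (Roots.arcRoots (lcm p q) a b) (downFrom ∘ multiplicity p q) ∈copies
        found = All.lookupAny (Arc.arcRoots-onArc (lcm p q) (lcm≥1 1≤p 1≤q) 0≤a a≤b b≤1) any
        α≈β = proj₁ (proj₂ found)
        onArc = OnArc-resp (ℂ.sym α≈β) (proj₁ found)
        j<mult : j ℕ.< multiplicity p q α
        j<mult = ≡.subst (j ℕ.<_) (multiplicity-cong p q (ℂ.sym α≈β)) (∈-downFrom⁻ (proj₂ (proj₂ found)))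

      Ω[]-cardinality : HasCardinality (Ω[ a , b ] X) (totalCount a b N)
      Ω[]-cardinality = items N , items-unique N , (λ _ → mk⇔ Ω⇒∈ ∈⇒Ω) , length-items N

      #Ω[]≡ : #Ω[ a , b ] X ≡.≡ totalCount a b N
      #Ω[]≡ = UniqueLists.cardinality≡ Item em Ω[]-cardinality

-- From the exact count to the asymptotic formula and the limit.

module Asymptotics (em : ExcludedMiddle 0ℓ) (R : RealField) (π : RealField.Carrier R)
              (isPi : Analysis.IsPi R π) where

  open RealField R renaming (Carrier to ℝ)
  open Analysis R
  open TorusLinks em R π
  open Cardinality Item using (HasCardinality)
  open FiniteSets
  open IntegerRingSolver commutativeRing
    using (Polynomial; solve; _:=_; _:+_; _:*_; _:-_; :-_; :0; :1)
  open OrderedField em R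
  open Complex em R
  open TorusPolynomial em ℂ-commutativeRing ℂ-domain
    using (IsRootOfUnity; <multiplicity⇒root)
  open RootsOnArc em R π isPi
  open LinkCount em R π isPi
  open Enumeration em R π isPi
  open ≤-Reasoning ≤-poset

  root⇒OnArc : ∀ {L α} (1≤L : 1 ℕ.≤ L) → IsRootOfUnity L α → OnArc 0# 1# α
  root⇒OnArc {L} {α} 1≤L α-root = onArc (Anyₚ.applyDownFrom⁻ (Roots.ζ L) (allRoots-complete L 1≤L {α} α-root))
    where
    onArc : (∃ λ k → k ℕ.< L × α ≈ᶜ Roots.ζ L k) → OnArc 0# 1# α
    onArc (k , k<L , α≈ζk) = e⇒OnArc (0≤angle L 1≤L k) (<⇒≤ (angle<1 L 1≤L k<L)) (ℂ.sym α≈ζk)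

  module _ {X N} (N≤X : ι N ≤ X) (X<1+N : X < ι (suc N)) where

    -- Every root is an L-th root of unity and so has an angle in [0,1). The enumeration for a = 0
    -- and b = 1 therefore lists all of Ω, and the denominator of the ratio is an instance of the
    -- same estimate.
    Ω-cardinality : HasCardinality (Ω X) (totalCount 0# 1# N)
    Ω-cardinality = let xs , xs! , Ω[]⇔ , eq = Ω[]-cardinality ≤-refl 0≤1 ≤-refl {X} {N} N≤X X<1+N in
      xs , xs! , (λ x → mk⇔ (λ ω → Equivalence.to (Ω[]⇔ x) (ω , onArc ω)) (λ x∈ → proj₁ (Equivalence.from (Ω[]⇔ x) x∈))) , eq
      where
      onArc : ∀ {p q α j} → Ω X (p , q , α , j) → OnArc 0# 1# α
      onArc {p} {q} {α} ((1≤p , _) , (1≤q , _) , copy) = root⇒OnArc (lcm≥1 1≤p 1≤q)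
        (<multiplicity⇒root p q {α} (Equivalence.to (copy⇔ 1≤p 1≤q) copy))

    #Ω≡ : #Ω X ≡.≡ totalCount 0# 1# N
    #Ω≡ = UniqueLists.cardinality≡ Item em Ω-cardinality

  ¼ : ℝ
  ¼ = ι 4 ⁻¹

  4*¼≈1 : ι 4 * ¼ ≈ 1#
  4*¼≈1 = *-inverseʳ (ι 4) (0<⇒≉0 (0<ι 3))

  0≤¼ : 0# ≤ ¼
  0≤¼ = <⇒≤ (⁻¹-pos (0<ι 3))

  ¼≤1 : ¼ ≤ 1#
  ¼≤1 = *-cancelʳ-≤ (0<ι 3) (begin
    ¼ * ι 4    ≈⟨ trans (*-comm _ _) 4*¼≈1 ⟩
    1#         ≈⟨ +-identityʳ 1# ⟨
    ι 1        ≤⟨ ι-mono {1} {4} (ℕ.s≤s ℕ.z≤n) ⟩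
    ι 4        ≈⟨ *-identityˡ _ ⟨
    1# * ι 4   ∎)

  ∣∣-contract : ∀ {c x B} → 0# ≤ c → c ≤ 1# → ∣ x ∣ ≤ B → ∣ c * x ∣ ≤ B
  ∣∣-contract {c} {x} {B} 0≤c c≤1 ∣x∣≤B = begin
    ∣ c * x ∣       ≤⟨ ∣∣-* c x ⟩
    ∣ c ∣ * ∣ x ∣   ≈⟨ *-congʳ (∣∣-nonneg 0≤c) ⟩
    c * ∣ x ∣       ≤⟨ *-monoʳ-≤ (0≤∣x∣ x) c≤1 ⟩
    1# * ∣ x ∣      ≈⟨ *-identityˡ _ ⟩
    ∣ x ∣           ≤⟨ ∣x∣≤B ⟩
    B               ∎

  module _ {X N} (1≤X : 1# ≤ X) (N≤X : ι N ≤ X) (X<1+N : X < ι (suc N)) where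

    private
      n = ι N
      T = triangular N
      0≤X : 0# ≤ X
      0≤X = ≤-trans 0≤1 1≤X
      0≤X-1 : 0# ≤ X - 1#
      0≤X-1 = 0≤y-x 1≤X
      0≤X² : 0# ≤ X * X
      0≤X² = *-nonNeg 0≤X 0≤X
      X-1≤n : X - 1# ≤ n
      X-1≤n = ≤-from-difference (0≤y-x (<⇒≤ X<1+N)) (solve 2 (λ n x → (:1 :+ n) :- x := n :- (x :- :1)) refl n X)
      u = n * ι (suc N)
      lower : (X - 1#) * X ≤ u
      lower = *-mono-≤ 0≤X (0≤ι N) X-1≤n (<⇒≤ X<1+N)
      upper : u ≤ X * (1# + X)
      upper = *-mono-≤ (0≤ι (suc N)) 0≤X N≤X (+-mono-≤ ≤-refl N≤X)
      0≤u : 0# ≤ u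
      0≤u = *-nonNeg (0≤ι N) (0≤ι (suc N))
      4T²≈u² : ι 4 * (T * T) ≈ u * u
      4T²≈u² = trans (solve 1 (λ t → (:1 :+ (:1 :+ (:1 :+ (:1 :+ :0)))) :* (t :* t) := ((:1 :+ :1) :* t) :* ((:1 :+ :1) :* t)) refl T)
        (*-cong (2*triangular N) (2*triangular N))

    -- Here 2T = N(N + 1) lies between (X - 1) X and X (X + 1). The squares of these bounds differ
    -- from X⁴ by 2X³ - X² and 2X³ + X², both at most 3X³ since X ≥ 1.
    4T²-X⁴ : ∣ ι 4 * (T * T) - X ^ 4 ∣ ≤ ι 3 * X ^ 3
    4T²-X⁴ = ≤-respˡ (∣∣-cong (+-congʳ (sym 4T²≈u²))) (∣∣-lub
      (begin
        u * u - X ^ 4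
          ≤⟨ +-monoˡ-≤ _ (*-mono-≤ 0≤u (≤-trans 0≤u upper) upper upper) ⟩
        X * (1# + X) * (X * (1# + X)) - X ^ 4
          ≤⟨ ≤-from-difference (*-nonNeg 0≤X² 0≤X-1)
               (solve 1 (λ x → (x :* x) :* (x :- :1) := (:1 :+ (:1 :+ (:1 :+ :0))) :* (x :* (x :* (x :* :1))) :-
                                (x :* (:1 :+ x) :* (x :* (:1 :+ x)) :- x :* (x :* (x :* (x :* :1))))) refl X) ⟩
        ι 3 * X ^ 3 ∎)
      (begin
        - (u * u - X ^ 4)
          ≈⟨ solve 2 (λ a b → :- (a :- b) := b :- a) refl _ _ ⟩
        X ^ 4 - u * u
          ≤⟨ +-mono-≤ ≤-refl (neg-mono-≤ (*-mono-≤ (*-nonNeg 0≤X-1 0≤X) 0≤u lower lower)) ⟩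
        X ^ 4 - (X - 1#) * X * ((X - 1#) * X)
          ≤⟨ ≤-from-difference (*-nonNeg 0≤X² (+-nonneg 0≤X 0≤1))
               (solve 1 (λ x → (x :* x) :* (x :+ :1) := (:1 :+ (:1 :+ (:1 :+ :0))) :* (x :* (x :* (x :* :1))) :-
                                (x :* (x :* (x :* (x :* :1))) :- (x :- :1) :* x :* ((x :- :1) :* x))) refl X) ⟩
        ι 3 * X ^ 3 ∎))

    -- The constant 6 is 3 + 3: summing the errors of the single links gives 3N³ ≤ 3X³, and
    -- replacing T² by X⁴/4 gives at most 3X³ again, the factors b - a and 1/4 being at most 1.
    totalCount≈X⁴ : ∀ {a b} → 0# ≤ a → a ≤ b → b ≤ 1# →
      ∣ ι (totalCount a b N) - (b - a) / ι 4 * X ^ 4 ∣ ≤ ι 6 * X ^ 3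
    totalCount≈X⁴ {a} {b} 0≤a a≤b b≤1 = begin
      ∣ M - c * ¼ * X ^ 4 ∣
        ≈⟨ ∣∣-cong split ⟨
      ∣ (M - c * T * T) + c * (¼ * (ι 4 * (T * T) - X ^ 4)) ∣
        ≤⟨ ∣∣-triangle _ _ ⟩
      ∣ M - c * T * T ∣ + ∣ c * (¼ * (ι 4 * (T * T) - X ^ 4)) ∣
        ≤⟨ +-mono-≤ (totalCount-approx 0≤a a≤b b≤1 N) (∣∣-contract (0≤y-x a≤b) c≤1 (∣∣-contract 0≤¼ ¼≤1 4T²-X⁴)) ⟩
      n * (n * (ι 3 * n)) + ι 3 * X ^ 3
        ≤⟨ +-mono-≤ (*-mono-≤ (*-nonNeg (0≤ι N) (*-nonNeg (0≤ι 3) (0≤ι N))) 0≤X N≤X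
                      (*-mono-≤ (*-nonNeg (0≤ι 3) (0≤ι N)) 0≤X N≤X (*-monoˡ-≤ (0≤ι 3) N≤X))) ≤-refl ⟩
      X * (X * (ι 3 * X)) + ι 3 * X ^ 3
        ≈⟨ solve 1 (λ x → x :* (x :* (three :* x)) :+ three :* (x :* (x :* (x :* :1))) :=
             (:1 :+ (:1 :+ (:1 :+ three))) :* (x :* (x :* (x :* :1)))) refl X ⟩
      ι 6 * X ^ 3 ∎
      where
      three : ∀ {k} → Polynomial k
      three = :1 :+ (:1 :+ (:1 :+ :0))
      M = ι (totalCount a b N)
      c = b - a
      split : (M - c * T * T) + c * (¼ * (ι 4 * (T * T) - X ^ 4)) ≈ M - c * ¼ * X ^ 4
      split = begin-equality
        (M - c * T * T) + c * (¼ * (ι 4 * (T * T) - X ^ 4))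
          ≈⟨ solve 6 (λ m c q f t x → (m :- c :* t :* t) :+ c :* (q :* (f :* (t :* t) :- x)) :=
                                      ((m :- c :* t :* t) :+ c :* (f :* q) :* (t :* t)) :- c :* q :* x) refl M c ¼ (ι 4) T (X ^ 4) ⟩
        ((M - c * T * T) + c * (ι 4 * ¼) * (T * T)) - c * ¼ * X ^ 4
          ≈⟨ +-congʳ (+-congˡ (*-congʳ (trans (*-congˡ 4*¼≈1) (*-identityʳ c)))) ⟩
        ((M - c * T * T) + c * (T * T)) - c * ¼ * X ^ 4
          ≈⟨ +-congʳ (solve 3 (λ m c t → (m :- c :* t :* t) :+ c :* (t :* t) := m) refl M c T) ⟩
        M - c * ¼ * X ^ 4 ∎
      c≤1 : c ≤ 1#
      c≤1 = ≤-from-difference (+-nonneg (0≤y-x b≤1) 0≤a) (solve 2 (λ a b → (:1 :- b) :+ a := :1 :- (b :- a)) refl a b)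

  module _ {a b : ℝ} (0≤a : 0# ≤ a) (a≤b : a ≤ b) (b≤1 : b ≤ 1#) where

    #Ω[]-estimate : ∀ {X} → 1# ≤ X → ∣ ι (#Ω[ a , b ] X) - (b - a) / ι 4 * X ^ 4 ∣ ≤ ι 6 * X ^ 3
    #Ω[]-estimate {X} 1≤X = let N , N≤X , X<1+N = floor (≤-trans 0≤1 1≤X) in
      ≤-respˡ (∣∣-cong (+-congʳ (reflexive (≡.cong ι (≡.sym (#Ω[]≡ 0≤a a≤b b≤1 {X} {N} N≤X X<1+N))))))
        (totalCount≈X⁴ {X} {N} 1≤X N≤X X<1+N 0≤a a≤b b≤1)

  #Ω-estimate : ∀ {X} → 1# ≤ X → ∣ ι (#Ω X) - ¼ * X ^ 4 ∣ ≤ ι 6 * X ^ 3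
  #Ω-estimate {X} 1≤X = let N , N≤X , X<1+N = floor (≤-trans 0≤1 1≤X) in
    ≤-respˡ (∣∣-cong (+-cong (reflexive (≡.cong ι (≡.sym (#Ω≡ {X} {N} N≤X X<1+N))))
        (-‿cong (*-congʳ (solve 1 (λ q → (:1 :- :0) :* q := q) refl ¼)))))
      (totalCount≈X⁴ {X} {N} 1≤X N≤X X<1+N ≤-refl 0≤1 ≤-refl)

  -- f = c g + O(X³) and g ≥ n X³ as soon as X ≥ 4 (n + 6).
  ratio-limit : ∀ {f g : ℝ → ℝ} {c} → 0# ≤ c → c ≤ 1# →
    (∀ {X} → 1# ≤ X → ∣ f X - c / ι 4 * X ^ 4 ∣ ≤ ι 6 * X ^ 3) →
    (∀ {X} → 1# ≤ X → ∣ g X - ¼ * X ^ 4 ∣ ≤ ι 6 * X ^ 3) →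
    (λ X → f X / g X) ⟶ c
  ratio-limit {f} {g} {c} 0≤c c≤1 f-estimate g-estimate ε 0<ε = X₀ , close
    where
    n = proj₁ (archimedean′ (ι 12) 0<ε)
    12<nε = proj₂ (archimedean′ (ι 12) 0<ε)
    X₀ = ι 4 * ι (n ℕ.+ 6)
    1≤X₀ : 1# ≤ X₀
    1≤X₀ = ≤-respˡ (+-identityʳ 1#) (≤-respʳ (ι-* 4 (n ℕ.+ 6)) (ι-mono {1} {4 ℕ.* (n ℕ.+ 6)}
      (ℕₚ.≤-trans (ℕₚ.≤-trans (ℕ.s≤s ℕ.z≤n) (ℕₚ.m≤n+m 6 n)) (ℕₚ.m≤n*m (n ℕ.+ 6) 4))))
    close : ∀ X → X₀ ≤ X → ∣ f X / g X - c ∣ < ε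
    close X X₀≤X = ≰⇒> λ ε≤ → <⇒≱ D<εg (begin
      ε * G                         ≤⟨ *-monoʳ-≤ (<⇒≤ 0<G) ε≤ ⟩
      ∣ F / G - c ∣ * G             ≈⟨ *-congʳ (∣∣-cong (trans (+-congˡ (-‿cong (sym (trans (*-congˡ G*G⁻¹≈1) (*-identityʳ c)))))
                                         (solve 4 (λ f i c g → f :* i :- c :* (g :* i) := (f :- c :* g) :* i) refl F (G ⁻¹) c G))) ⟩
      ∣ (F - c * G) * G ⁻¹ ∣ * G    ≤⟨ *-monoʳ-≤ (<⇒≤ 0<G) (∣∣-* _ _) ⟩
      D * ∣ G ⁻¹ ∣ * G              ≈⟨ *-congʳ (*-congˡ (∣∣-nonneg (<⇒≤ (⁻¹-pos 0<G)))) ⟩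
      D * G ⁻¹ * G                  ≈⟨ trans (solve 3 (λ d i g → d :* i :* g := d :* (g :* i)) refl D (G ⁻¹) G) (trans (*-congˡ G*G⁻¹≈1) (*-identityʳ D)) ⟩
      D                             ∎)
      where
      F = f X
      G = g X
      D = ∣ F - c * G ∣
      1≤X = ≤-trans 1≤X₀ X₀≤X
      0<X = <-≤-trans 0<1 1≤X
      0<X³ : 0# < X ^ 3
      0<X³ = *-pos 0<X (*-pos 0<X (*-pos 0<X 0<1))
      n+6≤X/4 : ι n + ι 6 ≤ ¼ * X
      n+6≤X/4 = begin
        ι n + ι 6                 ≈⟨ ι-+ n 6 ⟨
        ι (n ℕ.+ 6)               ≈⟨ trans (*-congʳ 4*¼≈1) (*-identityˡ _) ⟨
        ι 4 * ¼ * ι (n ℕ.+ 6)     ≈⟨ solve 3 (λ f q m → f :* q :* m := q :* (f :* m)) refl (ι 4) ¼ (ι (n ℕ.+ 6)) ⟩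
        ¼ * X₀                    ≤⟨ *-monoˡ-≤ 0≤¼ X₀≤X ⟩
        ¼ * X                     ∎
      nX³≤G : ι n * X ^ 3 ≤ G
      nX³≤G = begin
        ι n * X ^ 3
          ≤⟨ ≤-from-difference (*-nonNeg (0≤y-x n+6≤X/4) (<⇒≤ 0<X³))
               (solve 5 (λ n s q x y → (q :* x :- (n :+ s)) :* y := (q :* (x :* y) :- s :* y) :- n :* y) refl (ι n) (ι 6) ¼ X (X ^ 3)) ⟩
        ¼ * X ^ 4 - ι 6 * X ^ 3
          ≤⟨ ≤-from-difference (0≤y-x (≤-trans (-x≤∣x∣ _) (g-estimate 1≤X)))
               (solve 3 (λ g y s → s :- :- (g :- y) := g :- (y :- s)) refl G (¼ * X ^ 4) (ι 6 * X ^ 3)) ⟩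
        G ∎
      D≤12X³ : D ≤ ι 12 * X ^ 3
      D≤12X³ = begin
        ∣ F - c * G ∣
          ≈⟨ ∣∣-cong (solve 5 (λ f c g q y → f :- c :* g := (f :- c :* q :* y) :+ c :* :- (g :- q :* y)) refl F c G ¼ (X ^ 4)) ⟩
        ∣ (F - c / ι 4 * X ^ 4) + c * - (G - ¼ * X ^ 4) ∣
          ≤⟨ ∣∣-triangle _ _ ⟩
        ∣ F - c / ι 4 * X ^ 4 ∣ + ∣ c * - (G - ¼ * X ^ 4) ∣
          ≤⟨ +-mono-≤ (f-estimate 1≤X) (∣∣-contract 0≤c c≤1 (≤-respˡ (sym (∣-x∣ _)) (g-estimate 1≤X))) ⟩
        ι 6 * X ^ 3 + ι 6 * X ^ 3
          ≈⟨ trans (sym (distribʳ _ (ι 6) (ι 6))) (*-congʳ (sym (ι-+ 6 6))) ⟩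
        ι 12 * X ^ 3 ∎
      D<εg : D < ε * G
      D<εg = begin-strict
        D                      ≤⟨ D≤12X³ ⟩
        ι 12 * X ^ 3           <⟨ ≰⇒> (λ le → <⇒≱ 12<nε (*-cancelʳ-≤ 0<X³ le)) ⟩
        ι n * ε * X ^ 3        ≈⟨ solve 3 (λ n ε y → n :* ε :* y := ε :* (n :* y)) refl (ι n) ε (X ^ 3) ⟩
        ε * (ι n * X ^ 3)      ≤⟨ *-monoˡ-≤ (<⇒≤ 0<ε) nX³≤G ⟩
        ε * G                  ∎
      0<G : 0# < G
      0<G = ≰⇒> λ G≤0 → <⇒≱ D<εg (≤-trans (≤-respʳ (zeroʳ ε) (*-monoˡ-≤ (<⇒≤ 0<ε) G≤0)) (0≤∣x∣ _))
      G*G⁻¹≈1 = *-inverseʳ G (0<⇒≉0 0<G)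

  module _ {a b : ℝ} (0≤a : 0# ≤ a) (a≤b : a ≤ b) (b≤1 : b ≤ 1#) where

    arc-asymptotics : (λ X → ι (#Ω[ a , b ] X)) ≐ (λ X → (b - a) / ι 4 * X ^ 4) +O (λ X → X ^ 3)
    arc-asymptotics = ι 6 , 1# , λ X 1≤X → #Ω[]-estimate 0≤a a≤b b≤1 1≤X

    equidistribution : (λ X → ι (#Ω[ a , b ] X) / ι (#Ω X)) ⟶ (b - a)
    equidistribution = ratio-limit (0≤y-x a≤b) b-a≤1 (#Ω[]-estimate 0≤a a≤b b≤1) #Ω-estimate
      where
      b-a≤1 : b - a ≤ 1#
      b-a≤1 = ≤-from-difference (+-nonneg (0≤y-x b≤1) 0≤a) (solve 2 (λ a b → (:1 :- b) :+ a := :1 :- (b :- a)) refl a b)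

theorem2 : (em : ExcludedMiddle 0ℓ) (R : RealField) →
    let open RealField R renaming (Carrier to ℝ)
        open Analysis R
    in (π : ℝ) → IsPi π →
    let open TorusLinks em R π
    in (a b : ℝ) → 0# ≤ a → a ≤ b → b ≤ 1# →
      ((λ X → ι (#Ω[ a , b ] X)) ≐ (λ X → (b - a) / ι 4 * X ^ 4) +O (λ X → X ^ 3))
      × ((λ X → ι (#Ω[ a , b ] X) / ι (#Ω X)) ⟶ (b - a))
theorem2 em R π isPi a b 0≤a a≤b b≤1 =
  arc-asymptotics 0≤a a≤b b≤1 , equidistribution 0≤a a≤b b≤1
  where open Asymptotics em R π isPi
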